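{- Let $n\ge1$. For any sequence $\alpha_1,\dots,\alpha_{n-1}$ of non-negative integers, there is a Gorenstein* poset $P$ of rank $n$ such that (i) $\alpha_S(P)=\prod_{i\in S}\alpha_i$ for all $S\in\mathcal A_n$; and (ii) there is an element $\sigma\in P$ of rank $n$ such that $\alpha_S(\partial\sigma)=\prod_{i\in S}\alpha_i$ for all $S\in\mathcal A_{n-1}$.
   Context: All posets are finite and have a minimal element $\hat 0$. $\partial\sigma=\{\tau\in P:\tau<\sigma\}$. The order complex $\Delta_P$ is the simplicial complex of all chains of $P\setminus\{\hat 0\}$ (including the empty chain); $\operatorname{rank}P$ is the maximal cardinality of an element of $\Delta_P$; for $\sigma\neq\hat 0$, $\operatorname{rank}\sigma$ is the maximal cardinality of a chain $C\in\Delta_P$ with $\max C=\sigma$. Fix an arbitrary field $K$. $P$ is Gorenstein* (over $K$) if for every face $F$ of $\Delta_P$ (including $\emptyset$), $\tilde H_i(\mathrm{lk}_{\Delta_P} F;K)$ is $K$ for $i=\dim\Delta_P-|F|$ and $0$ otherwise. If $P$ is Gorenstein* and $\sigma\in P\setminus\{\hat 0\}$, then $\partial\sigma$ is Gorenstein*; the one-element poset $\{\hat 0\}$ is Gorenstein* of rank $0$. For $P$ of rank $n$ and $S\subset[n]$, $f_S(P)$ is the number of chains in $\Delta_P$ whose set of ranks of elements is exactly $S$, $h_S(P)=\sum_{T\subset S}(-1)^{|S|-|T|}f_T(P)$, $w_S=w_1\cdots w_n$ is the non-commutative monomial with $w_i=\mathbf b$ if $i\in S$ and $w_i=\mathbf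 a$ otherwise, and $\Psi_P(\mathbf a,\mathbf b)=\sum_{S\subset[n]}h_S(P)w_S$. It is known that if $P$ is Gorenstein* there is a unique non-commutative polynomial $\Phi_P(\mathbf c,\mathbf d)\in\mathbb Z\langle\mathbf c,\mathbf d\rangle$, the $\mathbf{cd}$-index of $P$, with $\Phi_P(\mathbf a+\mathbf b,\mathbf a\mathbf b+\mathbf b\mathbf a)=\Psi_P(\mathbf a,\mathbf b)$; it is homogeneous of degree $n$ for $\deg\mathbf c=1,\deg\mathbf d=2$. $\mathcal A_n$ is the set of subsets of $\{1,\dots,n-1\}$ containing no two consecutive integers ($\mathcal A_0=\mathcal A_1=\{\emptyset\}$). There is a bijection $\kappa_n$ from the set of $\mathbf{cd}$-monomials of degree $n$ to $\mathcal A_n$ given by $$\kappa_n(\mathbf c^{s_0}\mathbf d\mathbf c^{s_1}\mathbf d\cdots\mathbf d\mathbf c^{s_k})=\{s_0+1,\;s_0+s_1+3,\;\dots,\;s_0+\cdots+s_{k-1}+2k-1\}.$$ For a Gorenstein* poset $P$ of rank $n$ and $S\in\mathcal A_n$, $\alpha_S(P)$ denotes the coefficient of the monomial $\kappa_n^{ -1}(S)$ in $\Phi_P(\mathbf c,\mathbf d)$. -}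

module Defs where

open import Level using (Level; _⊔_; 0ℓ)
open import Algebra.Bundles using (CommutativeRing)
open import Algebra.Apartness.Bundles using (HeytingField; HeytingCommutativeRing)
open import Algebra.Module.Bundles using (Module)
open import Algebra.Module.Morphism.Structures using (module ModuleMorphisms)
import Algebra.Module.Construct.TensorUnit as TensorUnit
import Algebra.Module.Construct.Zero as Zero
import Algebra.Properties.Ring as RingProperties
open import Data.Bool using (Bool; if_then_else_)
open import Data.Fin using (toℕ)
open import Data.Fin.Subset using (Subset; inside; outside; ∣_∣)
open import Data.Fin.Subset.Properties using (_⊆?_)
open import Data.Integer as ℤ using (ℤ; +_; 0ℤ; 1ℤ; -1ℤ)
import Data.Integer.Properties as ℤₚ
open import Data.Irrelevant using ([_])
open import Data.List using (List; []; _∷_; _++_; map; length; filter; foldr; replicate; last;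
  upTo; concatMap; cartesianProductWith)
open import Data.List.Extrema.Nat using (max)
open import Data.List.Membership.Propositional using (_∈_)
open import Data.List.Properties using (concatMap-++) renaming (≡-dec to List-≡-dec)
open import Data.List.Relation.Binary.Sublist.Propositional using (_⊆_; []; _∷_; _∷ʳ_)
open import Data.List.Relation.Binary.Sublist.Propositional.Properties using (All-resp-⊆)
open import Data.List.Relation.Ternary.Interleaving.Propositional
  using (Interleaving; []; consˡ; consʳ)
open import Data.List.Relation.Unary.All as All using (All; []; _∷_)
import Data.List.Relation.Unary.All.Properties as Allₚ
open import Data.List.Relation.Unary.AllPairs as AllPairs using (AllPairs; []; _∷_)
open import Data.List.Relation.Unary.Any using (here; there)
import Data.List.Relation.Unary.Any as Any
open import Data.List.Relation.Unary.Linked as Linked using (Linked; []; [-]; _∷_)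
open import Data.List.Relation.Unary.Unique.Propositional using (Unique)
open import Data.Maybe using (just)
import Data.Maybe.Properties as Maybeₚ
open import Data.Nat as ℕ using (ℕ; zero; suc; _∸_; _≤_; _<_; z≤n; s≤s)
import Data.Nat.Properties as ℕₚ
open import Data.Product using (Σ-syntax; ∃-syntax; _×_; _,_; proj₁; proj₂; map₁)
open import Data.Refinement using (Refinement-syntax; value; value-injective; _,_)
import Data.Vec as Vec
import Data.Vec.Properties as Vecₚ
import Data.Bool.Properties as Bool
open import Function using (_↔_; mk↔ₛ′; module Inverse)
open import Relation.Binary using (Rel; DecidableEquality; Minimum;
  IsStrictPartialOrder; IsDecPartialOrder)
import Relation.Binary.Construct.NonStrictToStrict as ToStrict
open import Relation.Binary.PropositionalEquality as ≡ using (_≡_; _≢_; refl; cong)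
open import Relation.Nullary using (Dec; yes; no; does; ¬?; _×-dec_; recompute)
open import Relation.Nullary.Negation using (contradiction-irr)
open import Relation.Unary using () renaming (Decidable to Decidable₁)

private variable
  c ℓ ℓ₁ ℓ₂ m ℓm m′ ℓm′ : Level

------------------------------------------------------------------------
-- Formal linear combinations

module LinearCombinations (R : CommutativeRing c ℓ) where

  open CommutativeRing R hiding (refl)
  private module R = CommutativeRing R
  open RingProperties ring using (-1*x≈-x)

  Lin : Set → Set c
  Lin X = List (Carrier × X)

  infixr 7 _·_
  _·_ : {X : Set} → Carrier → Lin X → Lin X
  r · p = map (map₁ (r *_)) p

  neg : {X : Set} → Lin X → Lin X
  neg p = (- 1#) · p

  extend : {X Y : Set} → (X → Lin Y) → Lin X → Lin Y
  extend f = concatMap (λ (r , x) → r · f x)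

  -- Combinations are identified when all their coefficients agree, so Lin X
  -- with the equality _≋_ below is the free R-module on X.
  module Coefficients {X : Set} (_≟_ : DecidableEquality X) where

    coeff : Lin X → X → Carrier
    coeff []            x = 0#
    coeff ((r , y) ∷ p) x = if does (y ≟ x) then r + coeff p x else coeff p x

    infix 4 _≋_
    _≋_ : Rel (Lin X) ℓ
    p ≋ q = ∀ x → coeff p x ≈ coeff q x

    coeff-++ : ∀ p q x → coeff (p ++ q) x ≈ coeff p x + coeff q x
    coeff-++ []            q x = R.sym (+-identityˡ _)
    coeff-++ ((r , y) ∷ p) q x with does (y ≟ x)
    ... | Bool.true  = R.trans (+-congˡ (coeff-++ p q x)) (R.sym (+-assoc _ _ _))
    ... | Bool.false = coeff-++ p q x

    coeff-· : ∀ r p x → coeff (r · p) x ≈ r * coeff p x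
    coeff-· r []            x = R.sym (zeroʳ r)
    coeff-· r ((s , y) ∷ p) x with does (y ≟ x)
    ... | Bool.true  = R.trans (+-congˡ (coeff-· r p x)) (R.sym (distribˡ r _ _))
    ... | Bool.false = coeff-· r p x

    coeff-neg : ∀ p x → coeff (neg p) x ≈ - coeff p x
    coeff-neg p x = R.trans (coeff-· (- 1#) p x) (-1*x≈-x _)

    extend-++ : ∀ {W : Set} (f : W → Lin X) p q → extend f (p ++ q) ≋ extend f p ++ extend f q
    extend-++ f p q x = reflexive (cong (λ u → coeff u x) (concatMap-++ (λ (r , w) → r · f w) p q))

    extend-· : ∀ {W : Set} (f : W → Lin X) r p → extend f (r · p) ≋ r · extend f p
    extend-· f r []            x = R.refl
    extend-· f r ((s , w) ∷ p) x = R.trans (coeff-++ ((r * s) · f w) _ x)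
      (R.trans (+-cong
        (R.trans (coeff-· (r * s) (f w) x)
          (R.trans (*-assoc r s _) (*-congˡ (R.sym (coeff-· s (f w) x)))))
        (R.trans (extend-· f r p x) (coeff-· r (extend f p) x)))
      (R.trans (R.sym (distribˡ r _ _))
      (R.trans (*-congˡ (R.sym (coeff-++ (s · f w) (extend f p) x)))
               (R.sym (coeff-· r ((s · f w) ++ extend f p) x)))))

infix 4 _≅_
_≅_ : {R : CommutativeRing c ℓ} → Module R m ℓm → Module R m′ ℓm′ → Set (c ⊔ m ⊔ m′ ⊔ ℓm ⊔ ℓm′)
M ≅ N = ∃[ f ] IsModuleIsomorphism f
  where open ModuleMorphisms (Module.rawModule M) (Module.rawModule N)

------------------------------------------------------------------------
-- Simplicial complexes and reduced homology

-- A simplicial complex whose vertices are partially ordered so that every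
-- face is totally ordered.  A face is written as the increasing list of its
-- vertices, so each face is represented by exactly one list.
record OrderedComplex : Set₁ where
  field
    Vertex               : Set
    _≟_                  : DecidableEquality Vertex
    _≺_                  : Rel Vertex 0ℓ
    isStrictPartialOrder : IsStrictPartialOrder _≡_ _≺_
    Face                 : List Vertex → Set
    increasing           : ∀ {F} → Face F → AllPairs _≺_ F
    downClosed           : ∀ {F G} → G ⊆ F → Face F → Face G
    emptyFace            : Face []

AllPairs-resp-⊆ : {A : Set} {_∼_ : Rel A 0ℓ} {xs ys : List A} →
                  xs ⊆ ys → AllPairs _∼_ ys → AllPairs _∼_ xs
AllPairs-resp-⊆ []         []       = []
AllPairs-resp-⊆ (y ∷ʳ s)   (_ ∷ ps) = AllPairs-resp-⊆ s ps
AllPairs-resp-⊆ (refl ∷ s) (p ∷ ps) = All-resp-⊆ s p ∷ AllPairs-resp-⊆ s ps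

module _ {A : Set} where

  Interleaving-⊆ʳ : {F G H : List A} → Interleaving F G H → G ⊆ H
  Interleaving-⊆ʳ []        = []
  Interleaving-⊆ʳ (consˡ i) = _ ∷ʳ Interleaving-⊆ʳ i
  Interleaving-⊆ʳ (consʳ i) = refl ∷ Interleaving-⊆ʳ i

  Interleaving-emptyʳ : (F : List A) → Interleaving F [] F
  Interleaving-emptyʳ []      = []
  Interleaving-emptyʳ (x ∷ F) = consˡ (Interleaving-emptyʳ F)

  Interleaving-restrict : {F G G′ H : List A} → G′ ⊆ G → Interleaving F G H →
                          ∃[ H′ ] H′ ⊆ H × Interleaving F G′ H′
  Interleaving-restrict []         []        = [] , [] , []
  Interleaving-restrict s          (consˡ i) =
    let H′ , t , j = Interleaving-restrict s i in _ ∷ H′ , refl ∷ t , consˡ j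
  Interleaving-restrict (y ∷ʳ s)   (consʳ i) =
    let H′ , t , j = Interleaving-restrict s i in H′ , y ∷ʳ t , j
  Interleaving-restrict (refl ∷ s) (consʳ i) =
    let H′ , t , j = Interleaving-restrict s i in _ ∷ H′ , refl ∷ t , consʳ j

-- G is a face of the link of F when F ∩ G = ∅ and F ∪ G is a face, i.e. when
-- some face H is the disjoint union of F and G (H has no repetitions).
link : (Δ : OrderedComplex) (F : List (OrderedComplex.Vertex Δ)) →
       OrderedComplex.Face Δ F → OrderedComplex
link Δ F F∈Δ = record
  { Vertex               = Vertex
  ; _≟_                  = _≟_
  ; _≺_                  = _≺_
  ; isStrictPartialOrder = isStrictPartialOrder
  ; Face                 = λ G → ∃[ H ] Face H × Interleaving F G H
  ; increasing           = λ (H , H∈Δ , i) → AllPairs-resp-⊆ (Interleaving-⊆ʳ i) (increasing H∈Δ)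
  ; downClosed           = λ s (H , H∈Δ , i) →
      let H′ , t , j = Interleaving-restrict s i in H′ , downClosed t H∈Δ , j
  ; emptyFace            = F , F∈Δ , Interleaving-emptyʳ F
  } where open OrderedComplex Δ

module Homology (R : CommutativeRing c ℓ) (Δ : OrderedComplex) where

  open OrderedComplex Δ
  open CommutativeRing R hiding (refl)
  private module R = CommutativeRing R
  open RingProperties ring using (-‿+-comm; -‿involutive; -‿distribʳ-*)
  open LinearCombinations R
  open Coefficients (List-≡-dec _≟_)

  dim : List Vertex → ℤ
  dim F = + length F ℤ.- 1ℤ

  -- ∂ [v₀,…,vᵢ] = Σⱼ (-1)ʲ [v₀,…,v̂ⱼ,…,vᵢ], split as the term j = 0 and the rest.
  -- Vertices have boundary the empty face, which makes the homology reduced.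
  ∂-face : List Vertex → Lin (List Vertex)
  ∂-face []      = []
  ∂-face (v ∷ F) = (1# , F) ∷ neg (map (λ (r , G) → r , v ∷ G) (∂-face F))

  ∂ : Lin (List Vertex) → Lin (List Vertex)
  ∂ = extend ∂-face

  -- The i-chains: Cᵢ is spanned by the faces with i + 1 vertices, for all i : ℤ,
  -- so C₋₁ is spanned by the empty face and Cᵢ is zero for i < -1.
  record Chain (i : ℤ) : Set c where
    constructor mkChain
    field
      combination : Lin (List Vertex)
      onFaces     : All (λ (_ , F) → Face F × dim F ≡ i) combination

  record Cycle (i : ℤ) : Set (c ⊔ ℓ) where
    constructor mkCycle
    field
      chain : Chain i
    open Chain chain public
    field
      ∂≋0 : ∂ combination ≋ []

  open Chain using () renaming (combination to ⟪_⟫)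
  open Cycle using () renaming (combination to ⟦_⟧)

  infix 4 _∼_
  _∼_ : ∀ {i} → Rel (Cycle i) (c ⊔ ℓ)
  _∼_ {i} y z = Σ[ w ∈ Chain (ℤ.suc i) ] ∂ ⟪ w ⟫ ≋ ⟦ y ⟧ ++ neg ⟦ z ⟧

  ∂-++ : ∀ p q x → coeff (∂ (p ++ q)) x ≈ coeff (∂ p) x + coeff (∂ q) x
  ∂-++ p q x = R.trans (extend-++ ∂-face p q x) (coeff-++ (∂ p) (∂ q) x)

  ∂-· : ∀ r p x → coeff (∂ (r · p)) x ≈ r * coeff (∂ p) x
  ∂-· r p x = R.trans (extend-· ∂-face r p x) (coeff-· r (∂ p) x)

  difference : ∀ p q x → coeff (p ++ neg q) x ≈ coeff p x - coeff q x
  difference p q x = R.trans (coeff-++ p (neg q) x) (+-congˡ (coeff-neg q x))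

  _⊹ᶜ_ : ∀ {i} → Chain i → Chain i → Chain i
  mkChain p s ⊹ᶜ mkChain q t = mkChain (p ++ q) (Allₚ.++⁺ s t)

  _·ᶜ_ : ∀ {i} → Carrier → Chain i → Chain i
  r ·ᶜ mkChain p s = mkChain (r · p) (Allₚ.map⁺ s)

  _⊹_ : ∀ {i} → Cycle i → Cycle i → Cycle i
  mkCycle p ∂p ⊹ mkCycle q ∂q = mkCycle (p ⊹ᶜ q) λ x →
    R.trans (∂-++ ⟪ p ⟫ ⟪ q ⟫ x) (R.trans (+-cong (∂p x) (∂q x)) (+-identityˡ 0#))

  _·ᶻ_ : ∀ {i} → Carrier → Cycle i → Cycle i
  r ·ᶻ mkCycle p ∂p = mkCycle (r ·ᶜ p) λ x →
    R.trans (∂-· r ⟪ p ⟫ x) (R.trans (*-congˡ (∂p x)) (zeroʳ r))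

  0ᶻ : ∀ {i} → Cycle i
  0ᶻ = mkCycle (mkChain [] []) (λ _ → R.refl)

  negᶻ : ∀ {i} → Cycle i → Cycle i
  negᶻ = (- 1#) ·ᶻ_

  ≋⇒∼ : ∀ {i} {y z : Cycle i} → ⟦ y ⟧ ≋ ⟦ z ⟧ → y ∼ z
  ≋⇒∼ {y = y} {z} eq = mkChain [] [] , λ x → R.sym
    (R.trans (difference ⟦ y ⟧ ⟦ z ⟧ x) (R.trans (+-congʳ (eq x)) (-‿inverseʳ _)))

  boundary-of : ∀ {i} {y z : Cycle i} (w : Chain (ℤ.suc i)) →
                (∀ x → coeff (∂ ⟪ w ⟫) x ≈ coeff ⟦ y ⟧ x - coeff ⟦ z ⟧ x) → y ∼ z
  boundary-of {y = y} {z} w eq = w , λ x → R.trans (eq x) (R.sym (difference ⟦ y ⟧ ⟦ z ⟧ x))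

  bounds : ∀ {i} {y z : Cycle i} ((w , _) : y ∼ z) →
           ∀ x → coeff (∂ ⟪ w ⟫) x ≈ coeff ⟦ y ⟧ x - coeff ⟦ z ⟧ x
  bounds {y = y} {z} (w , eq) x = R.trans (eq x) (difference ⟦ y ⟧ ⟦ z ⟧ x)

  cancel : ∀ a b d → (a - b) + (b - d) ≈ a - d
  cancel a b d = R.trans (+-assoc a (- b) (b - d)) (+-congˡ
    (R.trans (R.sym (+-assoc (- b) b (- d)))
      (R.trans (+-congʳ (-‿inverseˡ b)) (+-identityˡ (- d)))))

  swap : ∀ a b → - (a - b) ≈ b - a
  swap a b = R.trans (R.sym (-‿+-comm a (- b)))
    (R.trans (+-congˡ (-‿involutive b)) (+-comm (- a) b))

  exchange : ∀ a a′ b b′ → (a - a′) + (b - b′) ≈ (a + b) - (a′ + b′)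
  exchange a a′ b b′ = R.trans (+-assoc a (- a′) (b - b′)) (R.trans (+-congˡ
    (R.trans (R.sym (+-assoc (- a′) b (- b′)))
      (R.trans (+-congʳ (+-comm (- a′) b)) (R.trans (+-assoc b (- a′) (- b′))
        (+-congˡ (-‿+-comm a′ b′)))))) (R.sym (+-assoc a b _)))

  ∼-refl : ∀ {i} {y : Cycle i} → y ∼ y
  ∼-refl {y = y} = ≋⇒∼ {y = y} {y} (λ _ → R.refl)

  ∼-sym : ∀ {i} {y z : Cycle i} → y ∼ z → z ∼ y
  ∼-sym {y = y} {z} e@(w , _) = boundary-of {y = z} {y} ((- 1#) ·ᶜ w) λ x →
    R.trans (∂-· (- 1#) ⟪ w ⟫ x) (R.trans (RingProperties.-1*x≈-x ring _)
      (R.trans (-‿cong (bounds {y = y} {z} e x)) (swap _ _)))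

  ∼-trans : ∀ {i} {y z u : Cycle i} → y ∼ z → z ∼ u → y ∼ u
  ∼-trans {y = y} {z} {u} e@(w , _) f@(w′ , _) = boundary-of {y = y} {u} (w ⊹ᶜ w′) λ x →
    R.trans (∂-++ ⟪ w ⟫ ⟪ w′ ⟫ x)
      (R.trans (+-cong (bounds {y = y} {z} e x) (bounds {y = z} {u} f x)) (cancel _ _ _))

  ⊹-cong : ∀ {i} {y y′ z z′ : Cycle i} → y ∼ y′ → z ∼ z′ → (y ⊹ z) ∼ (y′ ⊹ z′)
  ⊹-cong {i} {y = y} {y′} {z} {z′} e@(w , _) f@(w′ , _) =
    boundary-of {y = y ⊹ z} {y′ ⊹ z′} (w ⊹ᶜ w′) λ x →
    R.trans (∂-++ ⟪ w ⟫ ⟪ w′ ⟫ x)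
      (R.trans (+-cong (bounds {y = y} {y′} e x) (bounds {y = z} {z′} f x))
        (R.trans (exchange _ _ _ _) (R.sym
          (+-cong (coeff-++ ⟦ y ⟧ ⟦ z ⟧ x) (-‿cong (coeff-++ ⟦ y′ ⟧ ⟦ z′ ⟧ x))))))

  ·ᶻ-congʳ : ∀ {i} r {y z : Cycle i} → y ∼ z → (r ·ᶻ y) ∼ (r ·ᶻ z)
  ·ᶻ-congʳ {i} r {y} {z} e@(w , _) = boundary-of {y = r ·ᶻ y} {r ·ᶻ z} (r ·ᶜ w) λ x →
    R.trans (∂-· r ⟪ w ⟫ x) (R.trans (*-congˡ (bounds {y = y} {z} e x))
      (R.trans (distribˡ r _ _) (+-cong (R.sym (coeff-· r ⟦ y ⟧ x))
        (R.trans (R.sym (-‿distribʳ-* r _)) (-‿cong (R.sym (coeff-· r ⟦ z ⟧ x)))))))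

  ·ᶻ-cong : ∀ {i r s} {y z : Cycle i} → r ≈ s → y ∼ z → (r ·ᶻ y) ∼ (s ·ᶻ z)
  ·ᶻ-cong {r = r} {s} {y} {z} r≈s e =
    ∼-trans {y = r ·ᶻ y} {r ·ᶻ z} {s ·ᶻ z} (·ᶻ-congʳ r {y} {z} e) (≋⇒∼ {y = r ·ᶻ z} {s ·ᶻ z} λ x →
      R.trans (coeff-· r ⟦ z ⟧ x) (R.trans (*-congʳ r≈s) (R.sym (coeff-· s ⟦ z ⟧ x))))

  ⊹-assoc : ∀ {i} (y z u : Cycle i) → ((y ⊹ z) ⊹ u) ∼ (y ⊹ (z ⊹ u))
  ⊹-assoc y z u = ≋⇒∼ {y = (y ⊹ z) ⊹ u} {y ⊹ (z ⊹ u)} λ x →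
    R.trans (coeff-++ (⟦ y ⟧ ++ ⟦ z ⟧) ⟦ u ⟧ x) (R.trans (+-congʳ (coeff-++ ⟦ y ⟧ ⟦ z ⟧ x))
      (R.trans (+-assoc _ _ _) (R.sym (R.trans (coeff-++ ⟦ y ⟧ (⟦ z ⟧ ++ ⟦ u ⟧) x)
        (+-congˡ (coeff-++ ⟦ z ⟧ ⟦ u ⟧ x))))))

  ⊹-comm : ∀ {i} (y z : Cycle i) → (y ⊹ z) ∼ (z ⊹ y)
  ⊹-comm y z = ≋⇒∼ {y = y ⊹ z} {z ⊹ y} λ x →
    R.trans (coeff-++ ⟦ y ⟧ ⟦ z ⟧ x) (R.trans (+-comm _ _) (R.sym (coeff-++ ⟦ z ⟧ ⟦ y ⟧ x)))

  ⊹-identityˡ : ∀ {i} (y : Cycle i) → (0ᶻ ⊹ y) ∼ y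
  ⊹-identityˡ y = ≋⇒∼ {y = 0ᶻ ⊹ y} {y} λ _ → R.refl

  ⊹-identityʳ : ∀ {i} (y : Cycle i) → (y ⊹ 0ᶻ) ∼ y
  ⊹-identityʳ y = ≋⇒∼ {y = y ⊹ 0ᶻ} {y} λ x → R.trans (coeff-++ ⟦ y ⟧ [] x) (+-identityʳ _)

  ⊹-inverseʳ : ∀ {i} (y : Cycle i) → (y ⊹ negᶻ y) ∼ 0ᶻ
  ⊹-inverseʳ y = ≋⇒∼ {y = y ⊹ negᶻ y} {0ᶻ} λ x →
    R.trans (difference ⟦ y ⟧ ⟦ y ⟧ x) (-‿inverseʳ _)

  ⊹-inverseˡ : ∀ {i} (y : Cycle i) → (negᶻ y ⊹ y) ∼ 0ᶻ
  ⊹-inverseˡ y = ∼-trans {y = negᶻ y ⊹ y} {y ⊹ negᶻ y} {0ᶻ} (⊹-comm (negᶻ y) y) (⊹-inverseʳ y)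

  ·ᶻ-distribʳ : ∀ {i} (y : Cycle i) r s → ((r + s) ·ᶻ y) ∼ ((r ·ᶻ y) ⊹ (s ·ᶻ y))
  ·ᶻ-distribʳ y r s = ≋⇒∼ {y = (r + s) ·ᶻ y} {(r ·ᶻ y) ⊹ (s ·ᶻ y)} λ x →
    R.trans (coeff-· (r + s) ⟦ y ⟧ x) (R.trans (distribʳ _ r s) (R.sym
      (R.trans (coeff-++ (r · ⟦ y ⟧) (s · ⟦ y ⟧) x)
        (+-cong (coeff-· r ⟦ y ⟧ x) (coeff-· s ⟦ y ⟧ x)))))

  ·ᶻ-distribˡ : ∀ {i} r (y z : Cycle i) → (r ·ᶻ (y ⊹ z)) ∼ ((r ·ᶻ y) ⊹ (r ·ᶻ z))
  ·ᶻ-distribˡ r y z = ≋⇒∼ {y = r ·ᶻ (y ⊹ z)} {(r ·ᶻ y) ⊹ (r ·ᶻ z)} λ x →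
    R.trans (coeff-· r (⟦ y ⟧ ++ ⟦ z ⟧) x) (R.trans (*-congˡ (coeff-++ ⟦ y ⟧ ⟦ z ⟧ x))
      (R.trans (distribˡ r _ _) (R.sym (R.trans (coeff-++ (r · ⟦ y ⟧) (r · ⟦ z ⟧) x)
        (+-cong (coeff-· r ⟦ y ⟧ x) (coeff-· r ⟦ z ⟧ x))))))

  ·ᶻ-assoc : ∀ {i} r s (y : Cycle i) → ((r * s) ·ᶻ y) ∼ (r ·ᶻ (s ·ᶻ y))
  ·ᶻ-assoc r s y = ≋⇒∼ {y = (r * s) ·ᶻ y} {r ·ᶻ (s ·ᶻ y)} λ x →
    R.trans (coeff-· (r * s) ⟦ y ⟧ x) (R.trans (*-assoc r s _)
      (R.sym (R.trans (coeff-· r (s · ⟦ y ⟧) x) (*-congˡ (coeff-· s ⟦ y ⟧ x)))))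

  ·ᶻ-swap : ∀ {i} r s (y : Cycle i) → (r ·ᶻ (s ·ᶻ y)) ∼ (s ·ᶻ (r ·ᶻ y))
  ·ᶻ-swap r s y =
    ∼-trans {y = r ·ᶻ (s ·ᶻ y)} {(r * s) ·ᶻ y} {s ·ᶻ (r ·ᶻ y)}
      (∼-sym {y = (r * s) ·ᶻ y} {r ·ᶻ (s ·ᶻ y)} (·ᶻ-assoc r s y))
      (∼-trans {y = (r * s) ·ᶻ y} {(s * r) ·ᶻ y} {s ·ᶻ (r ·ᶻ y)}
        (·ᶻ-cong {y = y} {y} (*-comm r s) (∼-refl {y = y})) (·ᶻ-assoc s r y))

  ·ᶻ-zeroˡ : ∀ {i} (y : Cycle i) → (0# ·ᶻ y) ∼ 0ᶻ
  ·ᶻ-zeroˡ y = ≋⇒∼ {y = 0# ·ᶻ y} {0ᶻ} λ x → R.trans (coeff-· 0# ⟦ y ⟧ x) (zeroˡ _)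

  ·ᶻ-identityˡ : ∀ {i} (y : Cycle i) → (1# ·ᶻ y) ∼ y
  ·ᶻ-identityˡ y = ≋⇒∼ {y = 1# ·ᶻ y} {y} λ x → R.trans (coeff-· 1# ⟦ y ⟧ x) (*-identityˡ _)

  H̃ : ℤ → Module R (c ⊔ ℓ) (c ⊔ ℓ)
  H̃ i = record
    { Carrierᴹ = Cycle i
    ; _≈ᴹ_     = _∼_
    ; _+ᴹ_     = _⊹_
    ; _*ₗ_     = _·ᶻ_
    ; _*ᵣ_     = λ y r → r ·ᶻ y
    ; 0ᴹ       = 0ᶻ
    ; -ᴹ_      = negᶻ
    ; isModule = record
      { isBimodule = record
        { isBisemimodule = record
          { +ᴹ-isCommutativeMonoid = record
            { isMonoid = record
              { isSemigroup = record
                { isMagma = record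
                  { isEquivalence = record
                    { refl  = λ {y} → ∼-refl {y = y}
                    ; sym   = λ {y} {z} → ∼-sym {y = y} {z}
                    ; trans = λ {y} {z} {u} → ∼-trans {y = y} {z} {u}
                    }
                  ; ∙-cong = λ {y} {y′} {z} {z′} → ⊹-cong {y = y} {y′} {z} {z′}
                  }
                ; assoc = ⊹-assoc
                }
              ; identity = ⊹-identityˡ , ⊹-identityʳ
              }
            ; comm = ⊹-comm
            }
          ; isPreleftSemimodule = record
            { *ₗ-cong      = λ {r} {s} {y} {z} → ·ᶻ-cong {y = y} {z}
            ; *ₗ-zeroˡ     = ·ᶻ-zeroˡ
            ; *ₗ-distribʳ  = ·ᶻ-distribʳ
            ; *ₗ-identityˡ = ·ᶻ-identityˡ
            ; *ₗ-assoc     = ·ᶻ-assoc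
            ; *ₗ-zeroʳ     = λ _ → ∼-refl {y = 0ᶻ {i}}
            ; *ₗ-distribˡ  = ·ᶻ-distribˡ
            }
          ; isPrerightSemimodule = record
            { *ᵣ-cong      = λ {y} {z} e r≈s → ·ᶻ-cong {y = y} {z} r≈s e
            ; *ᵣ-zeroʳ     = ·ᶻ-zeroˡ
            ; *ᵣ-distribˡ  = ·ᶻ-distribʳ
            ; *ᵣ-identityʳ = ·ᶻ-identityˡ
            ; *ᵣ-assoc     = λ y r s → ∼-trans {y = s ·ᶻ (r ·ᶻ y)} {r ·ᶻ (s ·ᶻ y)} {(r * s) ·ᶻ y}
                (·ᶻ-swap s r y) (∼-sym {y = (r * s) ·ᶻ y} {r ·ᶻ (s ·ᶻ y)} (·ᶻ-assoc r s y))
            ; *ᵣ-zeroˡ     = λ _ → ∼-refl {y = 0ᶻ {i}}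
            ; *ᵣ-distribʳ  = ·ᶻ-distribˡ
            }
          ; *ₗ-*ᵣ-assoc = λ r y s → ·ᶻ-swap s r y
          }
        ; -ᴹ‿cong    = λ {y} {z} → ·ᶻ-congʳ (- 1#) {y} {z}
        ; -ᴹ‿inverse = ⊹-inverseˡ , ⊹-inverseʳ
        }
      ; *ₗ-*ᵣ-coincident = λ r y → ∼-refl {y = r ·ᶻ y}
      }
    }

------------------------------------------------------------------------
-- Finite posets

record FinitePoset : Set₁ where
  infix 4 _≤ₚ_
  field
    Carrier           : Set
    _≤ₚ_              : Rel Carrier 0ℓ
    isDecPartialOrder : IsDecPartialOrder _≡_ _≤ₚ_
    elements          : List Carrier
    elements-complete : ∀ x → x ∈ elements
    elements-unique   : Unique elements
    0̂                 : Carrier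
    0̂-minimum         : Minimum _≤ₚ_ 0̂

  open IsDecPartialOrder isDecPartialOrder public
    using (_≟_; _≤?_; isPartialOrder) renaming (refl to ≤ₚ-refl; trans to ≤ₚ-trans; antisym to ≤ₚ-antisym)
  open ToStrict _≡_ _≤ₚ_ public using () renaming (_<_ to _<ₚ_)

  _<?ₚ_ : ∀ x y → Dec (x <ₚ y)
  _<?ₚ_ = ToStrict.<-decidable _≡_ _≤ₚ_ _≟_ _≤?_

  -- A chain of P∖{0̂}, written as its increasing list of elements.
  IsChain : List Carrier → Set
  IsChain C = AllPairs _<ₚ_ C × All (_≢ 0̂) C

  isChain? : Decidable₁ IsChain
  isChain? C = AllPairs.allPairs? _<?ₚ_ C ×-dec All.all? (λ x → ¬? (x ≟ 0̂)) C

  orderComplex : OrderedComplex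
  orderComplex = record
    { Vertex               = Carrier
    ; _≟_                  = _≟_
    ; _≺_                  = _<ₚ_
    ; isStrictPartialOrder = ToStrict.<-isStrictPartialOrder _≡_ _≤ₚ_ isPartialOrder
    ; Face                 = IsChain
    ; increasing           = proj₁
    ; downClosed           = λ s (inc , ≢0̂) → AllPairs-resp-⊆ s inc , All-resp-⊆ s ≢0̂
    ; emptyFace            = [] , []
    }

  words : ℕ → List (List Carrier)
  words zero    = [] ∷ []
  words (suc k) = cartesianProductWith _∷_ elements (words k)

  -- All chains of P∖{0̂}, each listed once: a chain has no repetitions, hence
  -- at most as many entries as P has elements.
  chains : List (List Carrier)
  chains = concatMap (λ k → filter isChain? (words k)) (upTo (suc (length elements)))

  rank : ℕ
  rank = max 0 (map length chains)

  -- The rank of an element other than 0̂; the maximum of a chain is the last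
  -- entry of its increasing list.
  rankOf : Carrier → ℕ
  rankOf σ = max 0 (map length (filter (λ C → Maybeₚ.≡-dec _≟_ (last C) (just σ)) chains))

  -- Index i : Fin rank stands for the rank i + 1.
  rankSet : List Carrier → Subset rank
  rankSet C = Vec.tabulate λ i → does (Any.any? (λ x → rankOf x ℕ.≟ suc (toℕ i)) C)

module _ (P : FinitePoset) where

  open FinitePoset P

  restrict : ∀ σ → List Carrier → List [ τ ∈ Carrier ∣ τ <ₚ σ ]
  restrict σ []       = []
  restrict σ (x ∷ xs) with x <?ₚ σ
  ... | yes x<σ = (x , [ x<σ ]) ∷ restrict σ xs
  ... | no  _   = restrict σ xs

  restrict-complete : ∀ σ xs (τ : [ τ ∈ Carrier ∣ τ <ₚ σ ]) → value τ ∈ xs → τ ∈ restrict σ xs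
  restrict-complete σ (x ∷ xs) (τ , [ τ<σ ]) τ∈ with x <?ₚ σ | τ∈
  ... | yes _   | here refl = here refl
  ... | yes _   | there τ∈′ = there (restrict-complete σ xs (τ , [ τ<σ ]) τ∈′)
  ... | no  x≮σ | here refl = contradiction-irr τ<σ x≮σ
  ... | no  _   | there τ∈′ = restrict-complete σ xs (τ , [ τ<σ ]) τ∈′

  restrict-fresh : ∀ σ x xs .(x<σ : x <ₚ σ) → All (x ≢_) xs → All ((x , [ x<σ ]) ≢_) (restrict σ xs)
  restrict-fresh σ x []       x<σ []         = []
  restrict-fresh σ x (y ∷ xs) x<σ (x≢y ∷ ps) with y <?ₚ σ
  ... | yes _ = (λ eq → x≢y (cong value eq)) ∷ restrict-fresh σ x xs x<σ ps
  ... | no  _ = restrict-fresh σ x xs x<σ ps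

  restrict-unique : ∀ σ xs → Unique xs → Unique (restrict σ xs)
  restrict-unique σ []       []       = []
  restrict-unique σ (x ∷ xs) (p ∷ ps) with x <?ₚ σ
  ... | yes x<σ = restrict-fresh σ x xs x<σ p ∷ restrict-unique σ xs ps
  ... | no  _   = restrict-unique σ xs ps

  -- ∂σ = {τ ∈ P : τ < σ} with the induced order; its least element needs σ ≠ 0̂.
  ∂ₚ : (σ : Carrier) → σ ≢ 0̂ → FinitePoset
  ∂ₚ σ σ≢0̂ = record
    { Carrier           = [ τ ∈ Carrier ∣ τ <ₚ σ ]
    ; _≤ₚ_              = λ τ υ → value τ ≤ₚ value υ
    ; isDecPartialOrder = record
      { isPartialOrder = record
        { isPreorder = record
          { isEquivalence = ≡.isEquivalence
          ; reflexive     = λ { refl → ≤ₚ-refl }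
          ; trans         = ≤ₚ-trans
          }
        ; antisym = λ p q → value-injective (≤ₚ-antisym p q)
        }
      ; _≟_  = λ τ υ → Data.Refinement._≟_ _≟_ τ υ
      ; _≤?_ = λ τ υ → value τ ≤? value υ
      }
    ; elements          = restrict σ elements
    ; elements-complete = λ τ → restrict-complete σ elements τ (elements-complete (value τ))
    ; elements-unique   = restrict-unique σ elements elements-unique
    ; 0̂                 = 0̂ , [ (0̂-minimum σ , λ 0̂≡σ → σ≢0̂ (≡.sym 0̂≡σ)) ]
    ; 0̂-minimum         = λ τ → 0̂-minimum (value τ)
    }

-- A field is a HeytingField; classically, with x # y taken to be x ≉ y, these are
-- exactly the fields.  Only the underlying commutative ring enters the definition.
IsGorenstein* : HeytingField c ℓ₁ ℓ₂ → FinitePoset → Set (c ⊔ ℓ₁)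
IsGorenstein* {c} {ℓ₁} K P =
  ∀ F (F∈Δ : Face F) (i : ℤ) → let open Homology R (link orderComplex F F∈Δ) using (H̃) in
    (i ≡ dimΔ ℤ.- + length F → H̃ i ≅ TensorUnit.⟨module⟩ {R = R})
  × (i ≢ dimΔ ℤ.- + length F → H̃ i ≅ Zero.⟨module⟩ {c = c} {ℓ = ℓ₁} {R = R})
  where
  open FinitePoset P
  open OrderedComplex orderComplex using (Face)
  R = HeytingCommutativeRing.commutativeRing (HeytingField.heytingCommutativeRing K)
  -- rank is the largest number of vertices of a face.
  dimΔ = + rank ℤ.- 1ℤ

------------------------------------------------------------------------
-- The flag vectors and the ab-index

subsets : ∀ n → List (Subset n)
subsets zero    = Vec.[] ∷ []
subsets (suc n) = cartesianProductWith Vec._∷_ (outside ∷ inside ∷ []) (subsets n)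

data AB : Set where
  𝐚 𝐛 : AB

data CD : Set where
  𝐜 𝐝 : CD

_≟ᴬᴮ_ : DecidableEquality AB
𝐚 ≟ᴬᴮ 𝐚 = yes refl
𝐚 ≟ᴬᴮ 𝐛 = no λ ()
𝐛 ≟ᴬᴮ 𝐚 = no λ ()
𝐛 ≟ᴬᴮ 𝐛 = yes refl

_≟ᶜᵈ_ : DecidableEquality CD
𝐜 ≟ᶜᵈ 𝐜 = yes refl
𝐜 ≟ᶜᵈ 𝐝 = no λ ()
𝐝 ≟ᶜᵈ 𝐜 = no λ ()
𝐝 ≟ᶜᵈ 𝐝 = yes refl

open LinearCombinations ℤₚ.+-*-commutativeRing

ℤ⟨_⟩ : Set → Set
ℤ⟨ X ⟩ = Lin (List X)

_⊛_ : {X : Set} → ℤ⟨ X ⟩ → ℤ⟨ X ⟩ → ℤ⟨ X ⟩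
_⊛_ = cartesianProductWith (λ (r , u) (s , v) → r ℤ.* s , u ++ v)

module ABPoly = Coefficients (List-≡-dec _≟ᴬᴮ_)
module CDPoly = Coefficients (List-≡-dec _≟ᶜᵈ_)

module _ (P : FinitePoset) where

  open FinitePoset P

  flag-f : Subset rank → ℕ
  flag-f S = length (filter (λ C → Vecₚ.≡-dec Bool._≟_ (rankSet C) S) chains)

  flag-h : Subset rank → ℤ
  flag-h S = foldr ℤ._+_ 0ℤ
    (map (λ T → (-1ℤ ℤ.^ (∣ S ∣ ∸ ∣ T ∣)) ℤ.* + flag-f T) (filter (_⊆? S) (subsets rank)))

  abMonomial : Subset rank → List AB
  abMonomial S = Vec.toList (Vec.map (λ i∈S → if i∈S then 𝐛 else 𝐚) S)

  Ψ : ℤ⟨ AB ⟩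
  Ψ = map (λ S → flag-h S , abMonomial S) (subsets rank)

------------------------------------------------------------------------
-- The cd-index

-- Φ ↦ Φ(𝐚 + 𝐛, 𝐚𝐛 + 𝐛𝐚)
cd→ab : ℤ⟨ CD ⟩ → ℤ⟨ AB ⟩
cd→ab = extend (foldr (λ x p → letter x ⊛ p) ((1ℤ , []) ∷ []))
  where
  letter : CD → ℤ⟨ AB ⟩
  letter 𝐜 = (1ℤ , 𝐚 ∷ []) ∷ (1ℤ , 𝐛 ∷ []) ∷ []
  letter 𝐝 = (1ℤ , 𝐚 ∷ 𝐛 ∷ []) ∷ (1ℤ , 𝐛 ∷ 𝐚 ∷ []) ∷ []

-- Substitution is injective, so this determines Φ up to CDPoly._≋_.
IsCDIndex : FinitePoset → ℤ⟨ CD ⟩ → Set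
IsCDIndex P Φ = cd→ab Φ ABPoly.≋ Ψ P

degree : List CD → ℕ
degree []      = 0
degree (𝐜 ∷ u) = 1 ℕ.+ degree u
degree (𝐝 ∷ u) = 2 ℕ.+ degree u

Monomial : ℕ → Set
Monomial n = [ u ∈ List CD ∣ degree u ≡ n ]

-- Subsets of {1,…,n-1} without consecutive elements, written as increasing lists.
𝒜 : ℕ → Set
𝒜 n = [ S ∈ List ℕ ∣ All (λ i → 1 ≤ i × i < n) S × Linked (λ i j → 2 ℕ.+ i ≤ j) S ]

-- The element s₀ + ⋯ + sⱼ₋₁ + 2j - 1 contributed by the j-th 𝐝 is one more than
-- the degree of the prefix before that 𝐝; k is the degree already passed.
dPositions : ℕ → List CD → List ℕ
dPositions k []      = []
dPositions k (𝐜 ∷ u) = dPositions (1 ℕ.+ k) u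
dPositions k (𝐝 ∷ u) = suc k ∷ dPositions (2 ℕ.+ k) u

module κ-inverse (n : ℕ) where

  fromPositions : ℕ → List ℕ → List CD
  fromPositions k []      = replicate (n ∸ k) 𝐜
  fromPositions k (i ∷ S) = replicate (i ∸ suc k) 𝐜 ++ 𝐝 ∷ fromPositions (suc i) S

  data Valid : ℕ → List ℕ → Set where
    []  : ∀ {k} → k ≤ n → Valid k []
    _∷_ : ∀ {k i S} → k < i × i < n → Valid (suc i) S → Valid k (i ∷ S)

  weaken : ∀ {k S} → Valid (suc k) S → Valid k S
  weaken ([] p)            = [] (ℕₚ.<⇒≤ p)
  weaken ((p , q) ∷ valid) = (ℕₚ.<-trans (ℕₚ.n<1+n _) p , q) ∷ valid

  Valid⇒bounds : ∀ {k S} → Valid k S → All (λ i → k < i × i < n) S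
  Valid⇒bounds ([] _)       = []
  Valid⇒bounds ((p , q) ∷ v) = (p , q) ∷
    All.map (λ (p′ , q′) → ℕₚ.<-trans p (ℕₚ.<-trans (ℕₚ.n<1+n _) p′) , q′) (Valid⇒bounds v)

  Valid⇒gaps : ∀ {k S} → Valid k S → Linked (λ i j → 2 ℕ.+ i ≤ j) S
  Valid⇒gaps ([] _)                = []
  Valid⇒gaps (_ ∷ [] _)            = [-]
  Valid⇒gaps (_ ∷ v@((p , _) ∷ _)) = p ∷ Valid⇒gaps v

  bounds⇒Valid : ∀ {k S} → k ≤ n → All (λ i → k < i × i < n) S →
                 Linked (λ i j → 2 ℕ.+ i ≤ j) S → Valid k S
  bounds⇒Valid k≤n []                        []       = [] k≤n
  bounds⇒Valid k≤n (pq@(_ , q) ∷ [])         [-]      = pq ∷ [] q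
  bounds⇒Valid k≤n (pq@(_ , q) ∷ ps@(_ ∷ _)) (g ∷ gs) =
    pq ∷ bounds⇒Valid q (lift g ps gs) gs
    where
    lift : ∀ {i j S} → 2 ℕ.+ i ≤ j → All (λ i → _ < i × i < n) (j ∷ S) →
           Linked (λ i j → 2 ℕ.+ i ≤ j) (j ∷ S) → All (λ j → suc i < j × j < n) (j ∷ S)
    lift g ((_ , q) ∷ [])         [-]       = (g , q) ∷ []
    lift g ((_ , q) ∷ ps@(_ ∷ _)) (g′ ∷ gs) =
      (g , q) ∷ lift (ℕₚ.≤-trans g (ℕₚ.≤-trans (ℕₚ.m≤n+m _ 2) g′)) ps gs

  dPositions-valid : ∀ k u → degree u ℕ.+ k ≡ n → Valid k (dPositions k u)
  dPositions-valid k []      refl = [] ℕₚ.≤-refl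
  dPositions-valid k (𝐜 ∷ u) eq   =
    weaken (dPositions-valid (suc k) u (≡.trans (ℕₚ.+-suc (degree u) k) eq))
  dPositions-valid k (𝐝 ∷ u) eq   = (ℕₚ.≤-refl , 2+k≤n) ∷ dPositions-valid (2 ℕ.+ k) u eq′
    where
    eq′ : degree u ℕ.+ (2 ℕ.+ k) ≡ n
    eq′ = ≡.trans (≡.trans (ℕₚ.+-suc (degree u) (suc k)) (cong suc (ℕₚ.+-suc (degree u) k))) eq
    2+k≤n : 2 ℕ.+ k ≤ n
    2+k≤n = ℕₚ.≤-trans (ℕₚ.m≤n+m _ (degree u)) (ℕₚ.≤-reflexive eq′)

  degree-replicate : ∀ m u → degree (replicate m 𝐜 ++ u) ≡ m ℕ.+ degree u
  degree-replicate zero    u = refl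
  degree-replicate (suc m) u = cong suc (degree-replicate m u)

  dPositions-replicate : ∀ m k u → dPositions k (replicate m 𝐜 ++ u) ≡ dPositions (m ℕ.+ k) u
  dPositions-replicate zero    k u = refl
  dPositions-replicate (suc m) k u =
    ≡.trans (dPositions-replicate m (suc k) u) (cong (λ j → dPositions j u) (ℕₚ.+-suc m k))

  skip : ∀ {k i} → k < i → suc (i ∸ suc k ℕ.+ k) ≡ i
  skip {k} {i} k<i = ≡.trans (≡.sym (ℕₚ.+-suc (i ∸ suc k) k)) (ℕₚ.m∸n+n≡m k<i)

  replicate-++[] : ∀ m → replicate m 𝐜 ++ [] ≡ replicate m 𝐜
  replicate-++[] zero    = refl
  replicate-++[] (suc m) = cong (𝐜 ∷_) (replicate-++[] m)

  degree-fromPositions : ∀ {k S} → Valid k S → degree (fromPositions k S) ℕ.+ k ≡ n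
  degree-fromPositions {k} ([] k≤n) = ≡.trans (cong (ℕ._+ k)
    (≡.trans (cong degree (≡.sym (replicate-++[] (n ∸ k))))
      (≡.trans (degree-replicate (n ∸ k) []) (ℕₚ.+-identityʳ _)))) (ℕₚ.m∸n+n≡m k≤n)
  degree-fromPositions {k} {i ∷ S} ((k<i , _) ∷ v) = begin
    degree (replicate d 𝐜 ++ 𝐝 ∷ u) ℕ.+ k   ≡⟨ cong (ℕ._+ k) (degree-replicate d (𝐝 ∷ u)) ⟩
    d ℕ.+ (2 ℕ.+ degree u) ℕ.+ k            ≡⟨ cong (ℕ._+ k) (ℕₚ.+-comm d (2 ℕ.+ degree u)) ⟩
    2 ℕ.+ (degree u ℕ.+ d ℕ.+ k)            ≡⟨ cong (2 ℕ.+_) (ℕₚ.+-assoc (degree u) d k) ⟩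
    2 ℕ.+ (degree u ℕ.+ (d ℕ.+ k))          ≡⟨ cong suc (ℕₚ.+-suc (degree u) (d ℕ.+ k)) ⟨
    suc (degree u ℕ.+ suc (d ℕ.+ k))        ≡⟨ ℕₚ.+-suc (degree u) (suc (d ℕ.+ k)) ⟨
    degree u ℕ.+ suc (suc (d ℕ.+ k))        ≡⟨ cong (λ j → degree u ℕ.+ suc j) (skip k<i) ⟩
    degree u ℕ.+ suc i                      ≡⟨ degree-fromPositions v ⟩
    n                                       ∎
    where
    open ≡.≡-Reasoning
    d = i ∸ suc k
    u = fromPositions (suc i) S

  dPositions-fromPositions : ∀ {k S} → Valid k S → dPositions k (fromPositions k S) ≡ S
  dPositions-fromPositions {k} ([] k≤n) =
    ≡.trans (cong (dPositions k) (≡.sym (replicate-++[] (n ∸ k)))) (dPositions-replicate (n ∸ k) k [])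
  dPositions-fromPositions {k} {i ∷ S} ((k<i , _) ∷ v) =
    ≡.trans (dPositions-replicate (i ∸ suc k) k (𝐝 ∷ fromPositions (suc i) S))
      (≡.trans (cong (λ j → j ∷ dPositions (suc j) (fromPositions (suc i) S)) (skip k<i))
        (cong (i ∷_) (dPositions-fromPositions v)))

  ∸-step : ∀ {j k} → k < j → j ∸ k ≡ suc (j ∸ suc k)
  ∸-step {suc j} {k} (s≤s k≤j) = ℕₚ.+-∸-assoc 1 k≤j

  fromPositions-step : ∀ {k S} → Valid (suc k) S →
                       fromPositions k S ≡ 𝐜 ∷ fromPositions (suc k) S
  fromPositions-step ([] k<n) = cong (λ j → replicate j 𝐜) (∸-step k<n)
  fromPositions-step {k} {i ∷ S} ((k<i , _) ∷ _) =
    cong (λ j → replicate j 𝐜 ++ 𝐝 ∷ fromPositions (suc i) S) (∸-step k<i)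

  fromPositions-dPositions : ∀ k u → degree u ℕ.+ k ≡ n → fromPositions k (dPositions k u) ≡ u
  fromPositions-dPositions k []      refl = cong (λ j → replicate j 𝐜) (ℕₚ.n∸n≡0 k)
  fromPositions-dPositions k (𝐜 ∷ u) eq   =
    ≡.trans (fromPositions-step (dPositions-valid (suc k) u eq′))
      (cong (𝐜 ∷_) (fromPositions-dPositions (suc k) u eq′))
    where
    eq′ : degree u ℕ.+ suc k ≡ n
    eq′ = ≡.trans (ℕₚ.+-suc (degree u) k) eq
  fromPositions-dPositions k (𝐝 ∷ u) eq   =
    ≡.trans (cong (λ j → replicate j 𝐜 ++ 𝐝 ∷ fromPositions (2 ℕ.+ k) (dPositions (2 ℕ.+ k) u))
        (ℕₚ.n∸n≡0 k))
      (cong (𝐝 ∷_) (fromPositions-dPositions (2 ℕ.+ k) u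
        (≡.trans (≡.trans (ℕₚ.+-suc (degree u) (suc k)) (cong suc (ℕₚ.+-suc (degree u) k))) eq)))

κ : ∀ n → Monomial n ↔ 𝒜 n
κ n = mk↔ₛ′ to from to∘from from∘to
  where
  open κ-inverse n

  valid : ∀ {S} → All (λ i → 1 ≤ i × i < n) S × Linked (λ i j → 2 ℕ.+ i ≤ j) S → Valid 0 S
  valid (bs , gs) = bounds⇒Valid z≤n bs gs

  to : Monomial n → 𝒜 n
  to (u , [ eq ]) = dPositions 0 u , [ (Valid⇒bounds (valid′ u eq) , Valid⇒gaps (valid′ u eq)) ]
    where
    valid′ : ∀ u → degree u ≡ n → Valid 0 (dPositions 0 u)
    valid′ u eq = dPositions-valid 0 u (≡.trans (ℕₚ.+-identityʳ _) eq)

  from : 𝒜 n → Monomial n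
  from (S , [ S∈𝒜 ]) = fromPositions 0 S ,
    [ ≡.trans (≡.sym (ℕₚ.+-identityʳ _)) (degree-fromPositions (valid S∈𝒜)) ]

  to∘from : ∀ S → to (from S) ≡ S
  to∘from (S , [ S∈𝒜 ]) = value-injective (dPositions-fromPositions (valid (recompute dec S∈𝒜)))
    where
    dec : Dec (All (λ i → 1 ≤ i × i < n) S × Linked (λ i j → 2 ℕ.+ i ≤ j) S)
    dec = All.all? (λ i → (1 ℕ.≤? i) ×-dec (i ℕ.<? n)) S
          ×-dec Linked.linked? (λ i j → 2 ℕ.+ i ℕ.≤? j) S

  from∘to : ∀ u → from (to u) ≡ u
  from∘to (u , [ eq ]) = value-injective (fromPositions-dPositions 0 u
    (≡.trans (ℕₚ.+-identityʳ _) (recompute (degree u ℕ.≟ n) eq)))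

-- The coefficient α_S of κₙ⁻¹(S) in Φ.
α[_,_] : ∀ {n} → ℤ⟨ CD ⟩ → 𝒜 n → ℤ
α[_,_] {n} Φ S = CDPoly.coeff Φ (value (Inverse.from (κ n) S))

{-# OPTIONS --safe #-}

-- The polynomials Φₖ with coefficients ∏ αᵢ, where now i > k, satisfy
-- Φₖ = 𝐜 Φₖ₊₁ + αₖ₊₁ 𝐝 Φₖ₊₂.  Adding two minimal elements below a poset multiplies its
-- cd-index by 𝐜.  If in addition an atom is split into b + 1 copies τ 0, …, τ b, and b new
-- minimal elements are inserted, the i-th one below τ i and τ (i+1), then the cd-index grows
-- by b 𝐝 Φ, where Φ is the cd-index of the poset above that atom.  Iterating this downwards
-- from every level gives one infinite ranked poset, in which the elements below top n,
-- together with 0̂, form a poset Pₙ as required; as top (n - 1) lies in Pₙ and the elements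
-- below it are those of Pₙ₋₁, it is the facet asked for in (ii).
--
-- The link of a chain in the order complex is built from above by attaching minimal vertices
-- one at a time.  A vertex with acyclic link preserves acyclicity, and a vertex whose link is
-- a homology sphere turns an acyclic complex into a homology sphere of one dimension more;
-- the new elements of a level and the copies they lie under are attached so that the complex
-- stays acyclic until the last of them.

module Submission where

open import Defs
open import Algebra.Apartness.Bundles using (HeytingField; HeytingCommutativeRing)
open import Algebra.Bundles using (CommutativeRing)
import Algebra.Module.Construct.TensorUnit as TensorUnit
import Algebra.Module.Construct.Zero as Zero
import Algebra.Properties.Ring as RingProperties
open import Data.Bool using (Bool; true; false; if_then_else_; _∧_; _∨_; T)
import Data.Bool.Properties as Boolₚ
open import Data.Empty using (⊥; ⊥-elim)
open import Data.Fin using (Fin; zero; suc; toℕ; fromℕ; fromℕ<; inject₁)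
import Data.Fin.Properties as Finₚ
open import Data.Fin.Subset using (Subset; inside; outside; ∣_∣)
open import Data.Fin.Subset.Properties using (_⊆?_; p⊆q⇒∣p∣≤∣q∣)
open import Data.Integer as ℤ using (ℤ; +_; -[1+_]; 0ℤ; 1ℤ; -1ℤ)
import Data.Integer.Properties as ℤₚ
import Data.Integer.Solver as ℤSolver
open import Data.Irrelevant using ([_])
open import Data.List using (List; []; _∷_; _++_; map; length; foldr; filter; concatMap;
  cartesianProductWith; deduplicate; allFin; tabulate; last; upTo)
open import Data.List.Extrema.Nat using (max; max≤v⁺; v≤max⁺)
open import Data.List.Membership.Propositional using (_∈_; find; lose)
open import Data.List.Membership.Propositional.Properties
open import Data.List.Properties using (length-map; length-++; last-map; map-++; map-∘; map-cong;
  map-injective; ∷-injectiveˡ; ∷-injectiveʳ; ++-identityʳ; concatMap-++; concatMap-cong)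
  renaming (≡-dec to List-≡-dec)
open import Data.List.Relation.Binary.Disjoint.Propositional using (Disjoint)
open import Data.List.Relation.Binary.Pointwise using (Pointwise; []; _∷_; Pointwise-length)
open import Data.List.Relation.Ternary.Interleaving.Propositional
  using (Interleaving; []; consˡ; consʳ)
open import Data.List.Relation.Unary.All as All using (All; []; _∷_)
import Data.List.Relation.Unary.All.Properties as Allₚ
open import Data.List.Relation.Unary.AllPairs as AllPairs using (AllPairs; []; _∷_)
import Data.List.Relation.Unary.AllPairs.Properties as AllPairsₚ
open import Data.List.Relation.Unary.Any as Any using (here; there)
import Data.List.Relation.Unary.Any.Properties as Anyₚ
open import Data.List.Relation.Unary.Linked using (Linked; []; [-]; _∷_)
import Data.List.Relation.Unary.Linked.Properties as Linkedₚ
open import Data.List.Relation.Unary.Unique.DecPropositional.Properties using (deduplicate-!)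
open import Data.List.Relation.Unary.Unique.Propositional using (Unique)
import Data.List.Relation.Unary.Unique.Propositional.Properties as Uniqueₚ
open import Data.Maybe as Maybe using (Maybe; just; nothing)
import Data.Maybe.Properties as Maybeₚ
open import Data.Nat as ℕ using (ℕ; zero; suc; _≤_; _∸_; _≡ᵇ_)
open import Data.Nat.ListAction using (product)
import Data.Nat.Properties as ℕₚ
import Data.Nat.Solver as ℕSolver
open import Data.Product using (Σ-syntax; ∃-syntax; _×_; _,_; proj₁; proj₂)
import Data.Refinement
open import Data.Refinement using (Refinement-syntax; value; value-injective; _,_)
open import Data.Sum as Sum using (_⊎_; inj₁; inj₂)
open import Data.Unit using (⊤; tt)
open import Data.Vec as Vec using ([]; _∷_)
import Data.Vec.Properties as Vecₚ
open import Function using (_∘_; id; mk⇔; module Inverse)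
open import Level using (_⊔_)
open import Relation.Binary using (DecidableEquality; Decidable; IsStrictPartialOrder)
import Relation.Binary.Construct.StrictToNonStrict as ToNonStrict
open import Relation.Binary.PropositionalEquality as ≡ using (_≡_; _≢_; refl)
open import Relation.Nullary using (Dec; yes; no; does; ¬_; _⊎-dec_; recompute)
open import Relation.Nullary.Decidable using (map′; dec-true; dec-false; does-⇔)

-- Reduced homology of complexes of chains

-- An extra copy of the split atom adds the flags of Φ only to rank sets that contain the level of
-- the atom. Its new minimal element lies below two copies and below everything above the atom.
-- After Möbius inversion the coefficients behind a first letter 𝐚 therefore grow by 𝐛 Φ, and those
-- behind a first letter 𝐛 by 𝐚 Φ, which together is 𝐝 Φ. If both minimal elements of the 𝐜 step lay
-- below all copies, a copy would lie above too many elements. One of them is therefore put below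
-- the first copy only and the other below the last copy only, so that minimal elements and copies
-- alternate along a path. The obstacle is the order of attachment. A copy attached by itself has a
-- sphere as its link and destroys acyclicity; after its minimal element it is no longer a minimal
-- vertex. Hence the two are added as a pair: in the enlarged complex the link of the copy is a cone
-- whose apex is that minimal element. Every minimal element at an end of the path sees a single
-- copy, so the induction runs over sections in which one copy is kept.

module Words {c ℓ} (R : CommutativeRing c ℓ) {X : Set} (_≟_ : DecidableEquality X) where

  open CommutativeRing R hiding (refl; zero)
  private module R = CommutativeRing R
  open LinearCombinations R
  _≟ᴸ_ = List-≡-dec _≟_
  open Coefficients _≟ᴸ_

  ≋-sym : ∀ {p q} → p ≋ q → q ≋ p
  ≋-sym e x = R.sym (e x)

  ≋-trans : ∀ {p q r} → p ≋ q → q ≋ r → p ≋ r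
  ≋-trans e f x = R.trans (e x) (f x)

  coeff-here : ∀ r p x → coeff ((r , x) ∷ p) x ≈ r + coeff p x
  coeff-here r p x with x ≟ᴸ x
  ... | yes _ = R.refl
  ... | no ≢ = ⊥-elim (≢ refl)

  coeff-there : ∀ r y p {x} → y ≢ x → coeff ((r , y) ∷ p) x ≈ coeff p x
  coeff-there r y p {x} y≢x with y ≟ᴸ x
  ... | yes y≡x = ⊥-elim (y≢x y≡x)
  ... | no _ = R.refl

  coeff-∷ : ∀ r y p x → coeff ((r , y) ∷ p) x ≈ r * coeff ((1# , y) ∷ []) x + coeff p x
  coeff-∷ r y p x with y ≟ᴸ x
  ... | yes _ = +-congʳ (R.sym (R.trans (*-congˡ (+-identityʳ 1#)) (*-identityʳ r)))
  ... | no _ = R.sym (R.trans (+-congʳ (zeroʳ r)) (+-identityˡ _))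

  coeff-absent : ∀ {p x} → All (λ (_ , F) → F ≢ x) p → coeff p x ≈ 0#
  coeff-absent [] = R.refl
  coeff-absent {(r , y) ∷ p} (y≢x ∷ ps) = R.trans (coeff-there r y p y≢x) (coeff-absent ps)

  cons : X → Lin (List X) → Lin (List X)
  cons v = map (λ (r , F) → r , v ∷ F)

  cons-· : ∀ v r p → cons v (r · p) ≡ r · cons v p
  cons-· v r []            = refl
  cons-· v r ((s , F) ∷ p) = ≡.cong (_ ∷_) (cons-· v r p)

  coeff-cons : ∀ v p F → coeff (cons v p) (v ∷ F) ≈ coeff p F
  coeff-cons v []            F = R.refl
  coeff-cons v ((r , G) ∷ p) F = go (G ≟ᴸ F)
    where
    go : Dec (G ≡ F) → coeff (cons v ((r , G) ∷ p)) (v ∷ F) ≈ coeff ((r , G) ∷ p) F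
    go (yes refl) = R.trans (coeff-here r (cons v p) (v ∷ F))
      (R.trans (+-congˡ (coeff-cons v p F)) (R.sym (coeff-here r p F)))
    go (no G≢F)   = R.trans (coeff-there r (v ∷ G) (cons v p) λ { refl → G≢F refl })
      (R.trans (coeff-cons v p F) (R.sym (coeff-there r G p G≢F)))

  coeff-cons-≢ : ∀ v p {F} → (∀ G → F ≢ v ∷ G) → coeff (cons v p) F ≈ 0#
  coeff-cons-≢ v p F≢ = coeff-absent (Allₚ.map⁺ (All.universal (λ (_ , G) eq → F≢ G (≡.sym eq)) p))

  data StartsWith? (v : X) : List X → Set where
    starts : ∀ F → StartsWith? v (v ∷ F)
    other  : ∀ {F} → (∀ G → F ≢ v ∷ G) → StartsWith? v F

  startsWith? : ∀ v F → StartsWith? v F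
  startsWith? v []      = other λ _ ()
  startsWith? v (x ∷ F) with x ≟ v
  ... | yes refl = starts F
  ... | no x≢v   = other λ { _ refl → x≢v refl }

  cons-cong : ∀ v {p q} → p ≋ q → cons v p ≋ cons v q
  cons-cong v {p} {q} e G with startsWith? v G
  ... | starts F = R.trans (coeff-cons v p F) (R.trans (e F) (R.sym (coeff-cons v q F)))
  ... | other ≢  = R.trans (coeff-cons-≢ v p ≢) (R.sym (coeff-cons-≢ v q ≢))

module Chains {c ℓ} (R : CommutativeRing c ℓ) (Δ : OrderedComplex) where

  open OrderedComplex Δ using (Vertex; _≟_; _≺_; isStrictPartialOrder)
  open CommutativeRing R hiding (refl; zero)
  private module R = CommutativeRing R
  open RingProperties ring using (-‿distribʳ-*; -0#≈0#; -‿involutive; -1*x≈-x; +-inverseˡ-unique; +-inverseʳ-unique)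
  open LinearCombinations R
  open Words R _≟_ public
  open Coefficients _≟ᴸ_
  open Homology R Δ using (∂-face; ∂; ∂-++; ∂-·)
  open import Relation.Binary.Reasoning.Setoid R.setoid

  sumOver : {A : Set} → List A → (A → Carrier) → Carrier
  sumOver []       g = 0#
  sumOver (x ∷ xs) g = g x + sumOver xs g

  sumOver-cong : {A : Set} (xs : List A) {g h : A → Carrier} →
                 (∀ x → g x ≈ h x) → sumOver xs g ≈ sumOver xs h
  sumOver-cong []       e = R.refl
  sumOver-cong (x ∷ xs) e = +-cong (e x) (sumOver-cong xs e)

  sumOver-0 : {A : Set} (xs : List A) → sumOver xs (λ _ → 0#) ≈ 0#
  sumOver-0 []       = R.refl
  sumOver-0 (x ∷ xs) = R.trans (+-identityˡ _) (sumOver-0 xs)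

  sumOver-∷ : ∀ r F p (φ : List Vertex → Carrier) {xs} → Unique xs → F ∈ xs →
              sumOver xs (λ G → coeff ((r , F) ∷ p) G * φ G)
              ≈ r * φ F + sumOver xs (λ G → coeff p G * φ G)
  sumOver-∷ r F p φ {_ ∷ xs} (F∉xs ∷ _) (here refl) = begin
    coeff ((r , F) ∷ p) F * φ F + sumOver xs (λ G → coeff ((r , F) ∷ p) G * φ G)
      ≈⟨ +-cong (R.trans (*-congʳ (coeff-here r p F)) (distribʳ _ _ _)) (absent xs F∉xs) ⟩
    (r * φ F + coeff p F * φ F) + sumOver xs (λ G → coeff p G * φ G)
      ≈⟨ +-assoc _ _ _ ⟩
    r * φ F + (coeff p F * φ F + sumOver xs (λ G → coeff p G * φ G)) ∎
    where
    absent : ∀ xs → All (F ≢_) xs → sumOver xs (λ G → coeff ((r , F) ∷ p) G * φ G)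
                                  ≈ sumOver xs (λ G → coeff p G * φ G)
    absent []       []       = R.refl
    absent (x ∷ xs) (q ∷ qs) = +-cong (*-congʳ (coeff-there r F p q)) (absent xs qs)
  sumOver-∷ r F p φ {x ∷ xs} (x∉xs ∷ u) (there F∈xs) = begin
    coeff ((r , F) ∷ p) x * φ x + sumOver xs (λ G → coeff ((r , F) ∷ p) G * φ G)
      ≈⟨ +-cong (*-congʳ (coeff-there r F p λ { refl → All.lookup x∉xs F∈xs refl }))
                (sumOver-∷ r F p φ u F∈xs) ⟩
    coeff p x * φ x + (r * φ F + sumOver xs (λ G → coeff p G * φ G))
      ≈⟨ R.sym (+-assoc _ _ _) ⟩
    (coeff p x * φ x + r * φ F) + sumOver xs (λ G → coeff p G * φ G)
      ≈⟨ +-congʳ (+-comm _ _) ⟩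
    (r * φ F + coeff p x * φ x) + sumOver xs (λ G → coeff p G * φ G)
      ≈⟨ +-assoc _ _ _ ⟩
    r * φ F + (coeff p x * φ x + sumOver xs (λ G → coeff p G * φ G)) ∎

  extend-as-sum : ∀ (f : List Vertex → Lin (List Vertex)) p {xs} → Unique xs →
                  All (λ (_ , F) → F ∈ xs) p → ∀ x →
                  coeff (extend f p) x ≈ sumOver xs (λ F → coeff p F * coeff (f F) x)
  extend-as-sum f []            {xs} u []      x =
    R.sym (R.trans (sumOver-cong xs λ F → zeroˡ _) (sumOver-0 xs))
  extend-as-sum f ((r , F) ∷ p) {xs} u (∈ ∷ s) x = begin
    coeff (r · f F ++ extend f p) x             ≈⟨ coeff-++ (r · f F) (extend f p) x ⟩
    coeff (r · f F) x + coeff (extend f p) x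
      ≈⟨ +-cong (coeff-· r (f F) x) (extend-as-sum f p u s x) ⟩
    r * coeff (f F) x + sumOver xs (λ G → coeff p G * coeff (f G) x)
      ≈⟨ R.sym (sumOver-∷ r F p (λ G → coeff (f G) x) u ∈) ⟩
    sumOver xs (λ G → coeff ((r , F) ∷ p) G * coeff (f G) x) ∎

  -- `∂` works on lists of terms, while `≋` sees only collected coefficients. Writing both
  -- boundaries as sums over one duplicate-free list of faces makes them depend on the coefficients
  -- alone.
  ∂-cong : ∀ p q → p ≋ q → ∂ p ≋ ∂ q
  ∂-cong p q p≋q x = begin
    coeff (∂ p) x                                        ≈⟨ extend-as-sum ∂-face p u ∈p x ⟩
    sumOver keys (λ F → coeff p F * coeff (∂-face F) x)
      ≈⟨ sumOver-cong keys (λ F → *-congʳ (p≋q F)) ⟩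
    sumOver keys (λ F → coeff q F * coeff (∂-face F) x)  ≈⟨ R.sym (extend-as-sum ∂-face q u ∈q x) ⟩
    coeff (∂ q) x                                        ∎
    where
    faces = map proj₂ (p ++ q)
    keys = deduplicate _≟ᴸ_ faces
    u = deduplicate-! _≟ᴸ_ faces
    ∈p : All (λ (_ , F) → F ∈ keys) p
    ∈p = All.tabulate λ ∈ → ∈-deduplicate⁺ _≟ᴸ_ (∈-map⁺ proj₂ (∈-++⁺ˡ ∈))
    ∈q : All (λ (_ , F) → F ∈ keys) q
    ∈q = All.tabulate λ ∈ → ∈-deduplicate⁺ _≟ᴸ_ (∈-map⁺ proj₂ (∈-++⁺ʳ p ∈))

  ∂-cons : ∀ v q x → coeff (∂ (cons v q)) x ≈ coeff q x - coeff (cons v (∂ q)) x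
  ∂-cons v []            x = R.sym (-‿inverseʳ 0#)
  ∂-cons v ((r , F) ∷ q) x = begin
    coeff (r · ∂-face (v ∷ F) ++ ∂ (cons v q)) x
      ≈⟨ coeff-++ (r · ∂-face (v ∷ F)) _ x ⟩
    coeff (r · ∂-face (v ∷ F)) x + coeff (∂ (cons v q)) x
      ≈⟨ +-cong (R.trans (coeff-· r (∂-face (v ∷ F)) x) (*-congˡ face)) (∂-cons v q x) ⟩
    r * (e - f) + (coeff q x - coeff (cons v (∂ q)) x)
      ≈⟨ +-congʳ (R.trans (distribˡ r e (- f)) (+-congˡ (R.sym (-‿distribʳ-* r f)))) ⟩
    (r * e - r * f) + (coeff q x - coeff (cons v (∂ q)) x)
      ≈⟨ Homology.exchange R Δ _ _ _ _ ⟩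
    (r * e + coeff q x) - (r * f + coeff (cons v (∂ q)) x)
      ≈⟨ +-cong (R.sym (coeff-∷ r F q x)) (-‿cong (R.sym cons∂)) ⟩
    coeff ((r , F) ∷ q) x - coeff (cons v (∂ ((r , F) ∷ q))) x ∎
    where
    e = coeff ((1# , F) ∷ []) x
    f = coeff (cons v (∂-face F)) x
    face : coeff (∂-face (v ∷ F)) x ≈ e - f
    face = R.trans (coeff-++ ((1# , F) ∷ []) (neg (cons v (∂-face F))) x)
                   (+-congˡ (coeff-neg (cons v (∂-face F)) x))
    cons∂ : coeff (cons v (∂ ((r , F) ∷ q))) x ≈ r * f + coeff (cons v (∂ q)) x
    cons∂ = begin
      coeff (cons v (r · ∂-face F ++ ∂ q)) x
        ≈⟨ R.reflexive (≡.cong (λ u → coeff u x) (map-++ _ (r · ∂-face F) (∂ q))) ⟩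
      coeff (cons v (r · ∂-face F) ++ cons v (∂ q)) x
        ≈⟨ coeff-++ (cons v (r · ∂-face F)) _ x ⟩
      coeff (cons v (r · ∂-face F)) x + coeff (cons v (∂ q)) x
        ≈⟨ +-congʳ (R.trans (R.reflexive (≡.cong (λ u → coeff u x) (cons-· v r (∂-face F))))
                            (coeff-· r (cons v (∂-face F)) x)) ⟩
      r * f + coeff (cons v (∂ q)) x ∎

  Avoids : Vertex → Lin (List Vertex) → Set _
  Avoids v = All (λ (_ , F) → All (_≢ v) F)

  avoids-coeff : ∀ {v p} → Avoids v p → ∀ F → coeff p (v ∷ F) ≈ 0#
  avoids-coeff s F = coeff-absent (All.map (λ { (x≢v ∷ _) refl → x≢v refl }) s)

  avoids-· : ∀ {v} r {p} → Avoids v p → Avoids v (r · p)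
  avoids-· r s = Allₚ.map⁺ s

  avoids-∂-face : ∀ {v F} → All (_≢ v) F → Avoids v (∂-face F)
  avoids-∂-face []         = []
  avoids-∂-face (x≢v ∷ s) =
    s ∷ Allₚ.map⁺ (Allₚ.map⁺ (All.map (x≢v ∷_) (avoids-∂-face s)))

  avoids-∂ : ∀ {v p} → Avoids v p → Avoids v (∂ p)
  avoids-∂ []                = []
  avoids-∂ {p = (r , F) ∷ _} (a ∷ s) = Allₚ.++⁺ (avoids-· r (avoids-∂-face a)) (avoids-∂ s)

  coeff-∂-split : ∀ v q s x → coeff (∂ (cons v q ++ s)) x
                              ≈ (coeff q x - coeff (cons v (∂ q)) x) + coeff (∂ s) x
  coeff-∂-split v q s x = R.trans (∂-++ (cons v q) s x) (+-congʳ (∂-cons v q x))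

  -- As `q`, `s` and `X₂` avoid `v`, the faces of the boundary that start with `v` come only from
  -- the term `- v ∗ ∂ q`. Here the hypothesis is compared on these faces, in `∂-split-rest` on all
  -- others.
  ∂-split-cons : ∀ {v q s X₁ X₂} → Avoids v q → Avoids v s → Avoids v X₂ →
                 ∂ (cons v q ++ s) ≋ cons v X₁ ++ X₂ → ∀ F → - coeff (∂ q) F ≈ coeff X₁ F
  ∂-split-cons {v} {q} {s} {X₁} {X₂} aq as aX e F = begin
    - coeff (∂ q) F                            ≈⟨ R.sym (+-identityʳ _) ⟩
    - coeff (∂ q) F + 0#                       ≈⟨ R.sym (+-congʳ (+-identityˡ _)) ⟩
    (0# - coeff (∂ q) F) + 0#
      ≈⟨ R.sym (+-cong (+-cong (avoids-coeff aq F) (-‿cong (coeff-cons v (∂ q) F)))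
                       (avoids-coeff (avoids-∂ as) F)) ⟩
    (coeff q (v ∷ F) - coeff (cons v (∂ q)) (v ∷ F)) + coeff (∂ s) (v ∷ F)
      ≈⟨ R.sym (coeff-∂-split v q s (v ∷ F)) ⟩
    coeff (∂ (cons v q ++ s)) (v ∷ F)          ≈⟨ e (v ∷ F) ⟩
    coeff (cons v X₁ ++ X₂) (v ∷ F)            ≈⟨ coeff-++ (cons v X₁) X₂ (v ∷ F) ⟩
    coeff (cons v X₁) (v ∷ F) + coeff X₂ (v ∷ F)
      ≈⟨ +-cong (coeff-cons v X₁ F) (avoids-coeff aX F) ⟩
    coeff X₁ F + 0#                            ≈⟨ +-identityʳ _ ⟩
    coeff X₁ F                                 ∎

  ∂-split-rest : ∀ {v q s X₁ X₂} → Avoids v q → Avoids v s → Avoids v X₂ →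
                 ∂ (cons v q ++ s) ≋ cons v X₁ ++ X₂ →
                 ∀ F → coeff q F + coeff (∂ s) F ≈ coeff X₂ F
  ∂-split-rest {v} {q} {s} {X₁} {X₂} aq as aX e G with startsWith? v G
  ... | starts F = begin
    coeff q (v ∷ F) + coeff (∂ s) (v ∷ F)
      ≈⟨ +-cong (avoids-coeff aq F) (avoids-coeff (avoids-∂ as) F) ⟩
    0# + 0#            ≈⟨ +-identityˡ _ ⟩
    0#                 ≈⟨ R.sym (avoids-coeff aX F) ⟩
    coeff X₂ (v ∷ F)   ∎
  ... | other ≢ = begin
    coeff q G + coeff (∂ s) G
      ≈⟨ +-congʳ (R.sym (R.trans (+-congˡ (R.trans (-‿cong (coeff-cons-≢ v (∂ q) ≢)) -0#≈0#))
                                 (+-identityʳ _))) ⟩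
    (coeff q G - coeff (cons v (∂ q)) G) + coeff (∂ s) G
      ≈⟨ R.sym (coeff-∂-split v q s G) ⟩
    coeff (∂ (cons v q ++ s)) G          ≈⟨ e G ⟩
    coeff (cons v X₁ ++ X₂) G            ≈⟨ coeff-++ (cons v X₁) X₂ G ⟩
    coeff (cons v X₁) G + coeff X₂ G     ≈⟨ +-congʳ (coeff-cons-≢ v X₁ ≢) ⟩
    0# + coeff X₂ G                      ≈⟨ +-identityˡ _ ⟩
    coeff X₂ G                           ∎

  -- Together with `rest` this decomposes a chain into its link part at `v` and the part without
  -- `v`. Looking only at first vertices suffices, since `v` will be minimal among the vertices in
  -- use.
  tails : Vertex → Lin (List Vertex) → Lin (List Vertex)
  tails v []            = []
  tails v ((r , F) ∷ p) with startsWith? v F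
  ... | starts G = (r , G) ∷ tails v p
  ... | other _  = tails v p

  rest : Vertex → Lin (List Vertex) → Lin (List Vertex)
  rest v []            = []
  rest v ((r , F) ∷ p) with startsWith? v F
  ... | starts G = rest v p
  ... | other _  = (r , F) ∷ rest v p

  split : ∀ v p → p ≋ cons v (tails v p) ++ rest v p
  split v []            x = R.refl
  split v ((r , F) ∷ p) x with startsWith? v F
  ... | starts G = R.trans (coeff-∷ r (v ∷ G) p x)
        (R.trans (+-congˡ (split v p x)) (R.sym (coeff-∷ r (v ∷ G) (cons v (tails v p) ++ rest v p) x)))
  ... | other _  = begin
    coeff ((r , F) ∷ p) x                              ≈⟨ coeff-∷ r F p x ⟩
    re + coeff p x                                     ≈⟨ +-congˡ (split v p x) ⟩
    re + coeff (cons v (tails v p) ++ rest v p) x      ≈⟨ +-congˡ (coeff-++ (cons v (tails v p)) _ x) ⟩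
    re + (ct + coeff (rest v p) x)                     ≈⟨ R.sym (+-assoc re ct _) ⟩
    (re + ct) + coeff (rest v p) x                     ≈⟨ +-congʳ (+-comm re ct) ⟩
    (ct + re) + coeff (rest v p) x                     ≈⟨ +-assoc ct re _ ⟩
    ct + (re + coeff (rest v p) x)                     ≈⟨ R.sym (+-congˡ (coeff-∷ r F (rest v p) x)) ⟩
    ct + coeff ((r , F) ∷ rest v p) x                  ≈⟨ R.sym (coeff-++ (cons v (tails v p)) _ x) ⟩
    coeff (cons v (tails v p) ++ (r , F) ∷ rest v p) x ∎
    where
    re = r * coeff ((1# , F) ∷ []) x
    ct = coeff (cons v (tails v p)) x

  ∂-split : ∀ v p → ∂ p ≋ ∂ (cons v (tails v p) ++ rest v p)
  ∂-split v p = ∂-cong p (cons v (tails v p) ++ rest v p) (split v p)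

  All-tails : ∀ {ℓ′} {P : List Vertex → Set ℓ′} {v p} →
              All (λ (_ , F) → P F) p → All (λ (_ , F) → P (v ∷ F)) (tails v p)
  All-tails []                              = []
  All-tails {v = v} {(r , F) ∷ p} (px ∷ ps) with startsWith? v F
  ... | starts G = px ∷ All-tails ps
  ... | other _  = All-tails ps

  All-rest : ∀ {ℓ′} {P : List Vertex → Set ℓ′} {v p} →
             All (λ (_ , F) → P F) p →
             All (λ (_ , F) → P F × (∀ G → F ≢ v ∷ G)) (rest v p)
  All-rest []                              = []
  All-rest {v = v} {(r , F) ∷ p} (px ∷ ps) with startsWith? v F
  ... | starts G = All-rest ps
  ... | other ≢  = (px , ≢) ∷ All-rest ps

  neg-· : ∀ p x → coeff (∂ (neg p)) x ≈ - coeff (∂ p) x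
  neg-· p x = R.trans (∂-· (- 1#) p x) (-1*x≈-x _)

  ∂-∂-face : ∀ F → ∂ (∂-face F) ≋ []
  ∂-∂-face []      x = R.refl
  ∂-∂-face (v ∷ F) x = begin
    coeff (1# · ∂-face F ++ ∂ (neg (cons v d))) x      ≈⟨ coeff-++ (1# · ∂-face F) _ x ⟩
    coeff (1# · d) x + coeff (∂ (neg (cons v d))) x
      ≈⟨ +-cong (R.trans (coeff-· 1# d x) (*-identityˡ _)) (neg-· (cons v d) x) ⟩
    coeff d x - coeff (∂ (cons v d)) x
      ≈⟨ +-congˡ (-‿cong (R.trans (∂-cons v d x)
           (R.trans (+-congˡ (R.trans (-‿cong (cons-cong v {∂ d} {[]} (∂-∂-face F) x)) -0#≈0#))
                    (+-identityʳ _)))) ⟩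
    coeff d x - coeff d x                              ≈⟨ -‿inverseʳ _ ⟩
    0#                                                 ∎
    where d = ∂-face F

  ∂-∂ : ∀ p → ∂ (∂ p) ≋ []
  ∂-∂ []            x = R.refl
  ∂-∂ ((r , F) ∷ p) x = begin
    coeff (∂ (r · ∂-face F ++ ∂ p)) x                  ≈⟨ ∂-++ (r · ∂-face F) (∂ p) x ⟩
    coeff (∂ (r · ∂-face F)) x + coeff (∂ (∂ p)) x
      ≈⟨ +-cong (R.trans (∂-· r (∂-face F) x) (R.trans (*-congˡ (∂-∂-face F x)) (zeroʳ r))) (∂-∂ p x) ⟩
    0# + 0#                                            ≈⟨ +-identityˡ _ ⟩
    0#                                                 ∎

  Simplex : (Vertex → Set) → List Vertex → Set
  Simplex W F = AllPairs _≺_ F × All W F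

  -- ℓ counts vertices, so these are the chains of dimension ℓ - 1.
  Supp : (Vertex → Set) → ℕ → Lin (List Vertex) → Set c
  Supp W ℓ = All (λ (_ , F) → Simplex W F × length F ≡ ℓ)

  Bounds : (Vertex → Set) → ℕ → Lin (List Vertex) → Set (c ⊔ ℓ)
  Bounds W ℓ p = Σ[ w ∈ Lin (List Vertex) ] Supp W ℓ w × ∂ w ≋ p

  -- The case `ℓ = 0` is included: the empty face, too, has to bound, as in reduced homology.
  Acyclic : (Vertex → Set) → Set (c ⊔ ℓ)
  Acyclic W = ∀ ℓ p → Supp W ℓ p → ∂ p ≋ [] → Bounds W (suc ℓ) p

  -- The reduced homology of a sphere of dimension N - 1.
  record Sphere (N : ℕ) (W : Vertex → Set) : Set (c ⊔ ℓ) where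
    field
      exact       : ∀ ℓ → ℓ ≢ N → ∀ p → Supp W ℓ p → ∂ p ≋ [] → Bounds W (suc ℓ) p
      fundamental : Lin (List Vertex)
      supp        : Supp W N fundamental
      cycle       : ∂ fundamental ≋ []
      spans       : ∀ p → Supp W N p → ∂ p ≋ [] →
                    Σ[ r ∈ Carrier ] Bounds W (suc N) (p ++ neg (r · fundamental))
      free        : ∀ r w → Supp W (suc N) w → ∂ w ≋ r · fundamental → r ≈ 0#

  Supp-mono : ∀ {W W′ ℓ p} → (∀ {x} → W x → W′ x) → Supp W ℓ p → Supp W′ ℓ p
  Supp-mono f = All.map λ ((inc , ∈W) , len) → (inc , All.map f ∈W) , len

  Supp-++ : ∀ {W ℓ p q} → Supp W ℓ p → Supp W ℓ q → Supp W ℓ (p ++ q)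
  Supp-++ = Allₚ.++⁺

  Supp-· : ∀ {W ℓ p} r → Supp W ℓ p → Supp W ℓ (r · p)
  Supp-· r = Allₚ.map⁺

  Bounds-mono : ∀ {W W′ ℓ} p → (∀ {x} → W x → W′ x) → Bounds W ℓ p → Bounds W′ ℓ p
  Bounds-mono p f (w , s , e) = w , Supp-mono f s , e

  Bounds-resp : ∀ {W ℓ} p q → p ≋ q → Bounds W ℓ p → Bounds W ℓ q
  Bounds-resp p q p≋q (w , s , e) = w , s , ≋-trans {∂ w} {p} {q} e p≋q

  Sphere-resp : ∀ {N W W′} → (∀ {x} → W x → W′ x) → (∀ {x} → W′ x → W x) → Sphere N W → Sphere N W′
  Sphere-resp f g S = record
    { exact       = λ ℓ ℓ≢N p s e → Bounds-mono p f (exact ℓ ℓ≢N p (Supp-mono g s) e)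
    ; fundamental = fundamental
    ; supp        = Supp-mono f supp
    ; cycle       = cycle
    ; spans       = λ p s e → let r , b = spans p (Supp-mono g s) e in r , Bounds-mono (p ++ neg (r · fundamental)) f b
    ; free        = λ r w s e → free r w (Supp-mono g s) e
    } where open Sphere S

  -- Only minimal vertices are attached: v then comes first in each of its faces, and the
  -- join with v is v ∷_ without signs.
  record Attach (W : Vertex → Set) (v : Vertex) (Y L : Vertex → Set) : Set where
    field
      W∋v     : W v
      Y⊆W     : ∀ {x} → Y x → W x
      W⊆Y     : ∀ {x} → W x → x ≢ v → Y x
      Y∌v     : ∀ {x} → Y x → x ≢ v
      minimal : ∀ {x} → W x → ¬ x ≺ v
      L⊆Y     : ∀ {x} → L x → Y x
      v≺L     : ∀ {x} → L x → v ≺ x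
      L⊇      : ∀ {x} → Y x → v ≺ x → L x

  ≺-irrefl : ∀ {x y} → x ≺ y → x ≢ y
  ≺-irrefl x≺y x≡y = IsStrictPartialOrder.irrefl isStrictPartialOrder x≡y x≺y

  module _ {W v Y L} (A : Attach W v Y L) where

    open Attach A

    supp-tails : ∀ {ℓ p} → Supp W ℓ p → All (λ (_ , F) → Simplex L F × suc (length F) ≡ ℓ) (tails v p)
    supp-tails s = All.map
      (λ { (((v≺ ∷ inc) , (_ ∷ ∈W)) , len) →
        (inc , All.zipWith (λ (v≺x , x∈W) → L⊇ (W⊆Y x∈W (≺-irrefl v≺x ∘ ≡.sym)) v≺x) (v≺ , ∈W)) , len })
      (All-tails s)

    supp-tails-suc : ∀ {ℓ p} → Supp W (suc ℓ) p → Supp L ℓ (tails v p)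
    supp-tails-suc s = All.map (λ (σ , len) → σ , ℕₚ.suc-injective len) (supp-tails s)

    supp-rest : ∀ {ℓ p} → Supp W ℓ p → Supp Y ℓ (rest v p)
    supp-rest s = All.map (λ (((inc , ∈W) , len) , ≢) → (inc , inY inc ∈W ≢) , len) (All-rest s)
      where
      inY : ∀ {F} → AllPairs _≺_ F → All W F → (∀ G → F ≢ v ∷ G) → All Y F
      inY []        []         ≢ = []
      inY {x ∷ F} (x≺ ∷ _) (x∈W ∷ ∈W) ≢ = W⊆Y x∈W (λ { refl → ≢ F refl }) ∷
        All.zipWith (λ (x≺y , y∈W) → W⊆Y y∈W λ { refl → minimal x∈W x≺y }) (x≺ , ∈W)

    supp-cons : ∀ {ℓ q} → Supp L ℓ q → Supp W (suc ℓ) (cons v q)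
    supp-cons s = Allₚ.map⁺ (All.map (λ ((inc , ∈L) , len) →
      (All.map v≺L ∈L ∷ inc , W∋v ∷ All.map (Y⊆W ∘ L⊆Y) ∈L) , ≡.cong suc len) s)

    avoids-Y : ∀ {ℓ p} → Supp Y ℓ p → Avoids v p
    avoids-Y = All.map λ ((_ , ∈Y) , _) → All.map Y∌v ∈Y

    avoids-tails : ∀ {ℓ p} → Supp W ℓ p → Avoids v (tails v p)
    avoids-tails s = All.map (λ ((_ , ∈L) , _) → All.map (Y∌v ∘ L⊆Y) ∈L) (supp-tails s)

    tails+∂rest : ∀ {ℓ p} → Supp W ℓ p → ∂ p ≋ [] → ∀ x → coeff (tails v p) x + coeff (∂ (rest v p)) x ≈ 0#
    tails+∂rest {p = p} s e = ∂-split-rest {X₁ = []} {[]} (avoids-tails s) (avoids-Y (supp-rest s)) []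
      (λ x → R.trans (R.sym (∂-split v p x)) (e x))

    ∂-tails : ∀ {ℓ p} → Supp W ℓ p → ∂ p ≋ [] → ∂ (tails v p) ≋ []
    ∂-tails {p = p} s e x = R.trans (R.sym (-‿involutive _)) (R.trans (-‿cong
      (∂-split-cons {X₁ = []} {[]} (avoids-tails s) (avoids-Y (supp-rest s)) []
        (λ y → R.trans (R.sym (∂-split v p y)) (e y)) x)) -0#≈0#)

    -- Contraction to the apex: for a cycle `p` the link part equals `- ∂ p₀`, where `p₀` is the
    -- part without `v`, so the boundary of `v ∗ p₀` is `p` itself.
    cone-acyclic : (∀ {x} → Y x → v ≺ x) → Acyclic W
    cone-acyclic v≺Y ℓ p s e = cons v (rest v p) , supp-cons (Supp-mono (λ y → L⊇ y (v≺Y y)) (supp-rest s)) ,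
      λ x → begin
      coeff (∂ (cons v p₀)) x                          ≈⟨ ∂-cons v p₀ x ⟩
      coeff p₀ x - coeff (cons v (∂ p₀)) x             ≈⟨ +-comm _ _ ⟩
      - coeff (cons v (∂ p₀)) x + coeff p₀ x           ≈⟨ +-congʳ (R.sym (coeff-neg (cons v (∂ p₀)) x)) ⟩
      coeff (neg (cons v (∂ p₀))) x + coeff p₀ x
        ≈⟨ +-congʳ (R.reflexive (≡.cong (λ u → coeff u x) (≡.sym (cons-· v (- 1#) (∂ p₀))))) ⟩
      coeff (cons v (neg (∂ p₀))) x + coeff p₀ x       ≈⟨ +-congʳ (cons-cong v {neg (∂ p₀)} {tails v p} q≋ x) ⟩
      coeff (cons v (tails v p)) x + coeff p₀ x        ≈⟨ R.sym (coeff-++ (cons v (tails v p)) p₀ x) ⟩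
      coeff (cons v (tails v p) ++ p₀) x               ≈⟨ R.sym (split v p x) ⟩
      coeff p x                                        ∎
      where
      p₀ = rest v p
      q≋ : neg (∂ p₀) ≋ tails v p
      q≋ x = R.trans (coeff-neg (∂ p₀) x) (R.sym (+-inverseˡ-unique _ _ (tails+∂rest s e x)))

    -- Replace the cone `v ∗ q` by the filling `u` of its base: `s + u` lies in `Y` and is a cycle
    -- because `q + ∂ s = 0`. If `w` fills it there, then `w - v ∗ u` fills the original cycle.
    fill : Acyclic Y → ∀ {ℓ q s} → Supp L ℓ q → Supp Y (suc ℓ) s → ∂ (cons v q ++ s) ≋ [] →
           Bounds L (suc ℓ) q → Bounds W (suc (suc ℓ)) (cons v q ++ s)
    fill acY {ℓ} {q} {s} q∈ s∈ e (u , u∈ , ∂u) =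
      w ++ neg (cons v u) , Supp-++ (Supp-mono Y⊆W w∈) (Supp-· _ (supp-cons u∈)) , eq
      where
      cyc : ∂ (s ++ u) ≋ []
      cyc x = begin
        coeff (∂ (s ++ u)) x            ≈⟨ ∂-++ s u x ⟩
        coeff (∂ s) x + coeff (∂ u) x   ≈⟨ +-congˡ (∂u x) ⟩
        coeff (∂ s) x + coeff q x       ≈⟨ +-comm _ _ ⟩
        coeff q x + coeff (∂ s) x
          ≈⟨ ∂-split-rest {X₁ = []} {[]} (avoids-Y (Supp-mono L⊆Y q∈)) (avoids-Y s∈) [] e x ⟩
        0#                              ∎
      filling = acY (suc ℓ) (s ++ u) (Supp-++ s∈ (Supp-mono L⊆Y u∈)) cyc
      w = proj₁ filling
      w∈ = proj₁ (proj₂ filling)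
      eq : ∂ (w ++ neg (cons v u)) ≋ cons v q ++ s
      eq x = begin
        coeff (∂ (w ++ neg (cons v u))) x                ≈⟨ ∂-++ w _ x ⟩
        coeff (∂ w) x + coeff (∂ (neg (cons v u))) x
          ≈⟨ +-cong (R.trans (proj₂ (proj₂ filling) x) (coeff-++ s u x))
               (R.trans (neg-· (cons v u) x) (-‿cong (R.trans (∂-cons v u x)
                 (+-congˡ (-‿cong (cons-cong v {∂ u} {q} ∂u x)))))) ⟩
        (coeff s x + coeff u x) - (coeff u x - coeff (cons v q) x)
          ≈⟨ +-congˡ (Homology.swap R Δ _ _) ⟩
        (coeff s x + coeff u x) + (coeff (cons v q) x - coeff u x) ≈⟨ +-congˡ (+-comm _ _) ⟩
        (coeff s x + coeff u x) + (- coeff u x + coeff (cons v q) x) ≈⟨ +-assoc _ _ _ ⟩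
        coeff s x + (coeff u x + (- coeff u x + coeff (cons v q) x))
          ≈⟨ +-congˡ (R.trans (R.sym (+-assoc _ _ _)) (R.trans (+-congʳ (-‿inverseʳ _)) (+-identityˡ _))) ⟩
        coeff s x + coeff (cons v q) x                   ≈⟨ +-comm _ _ ⟩
        coeff (cons v q) x + coeff s x                   ≈⟨ R.sym (coeff-++ (cons v q) s x) ⟩
        coeff (cons v q ++ s) x                          ∎

    fill-tails : Acyclic Y → ∀ {ℓ p} → Supp W (suc ℓ) p → ∂ p ≋ [] →
                 Bounds L (suc ℓ) (tails v p) → Bounds W (suc (suc ℓ)) p
    fill-tails acY {p = p} s e b = Bounds-resp (cons v (tails v p) ++ rest v p) p (≋-sym {p} {cons v (tails v p) ++ rest v p} (split v p))
      (fill acY (supp-tails-suc s) (supp-rest s)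
        (λ x → R.trans (R.sym (∂-split v p x)) (e x)) b)

    restrict-0 : ∀ {p} → Supp W 0 p → Supp Y 0 p
    restrict-0 = All.map λ { {_ , []} ((inc , []) , len) → ([] , []) , refl }

    attach-acyclic : Acyclic L → Acyclic Y → Acyclic W
    -- For `ℓ = 0` only the empty face occurs, and it already belongs to `Y`.
    attach-acyclic acL acY zero    p s e = Bounds-mono p Y⊆W (acY zero p (restrict-0 s) e)
    attach-acyclic acL acY (suc ℓ) p s e =
      fill-tails acY s e (acL ℓ (tails v p) (supp-tails-suc s) (∂-tails s e))

    -- The new fundamental cycle consists of two hemispheres: the cone `v ∗ ζ` over the fundamental
    -- cycle of the link, and a filling `u` of `ζ` in `Y`. Its link part is `ζ`, so the multiple of
    -- it that a cycle represents is read off in the link.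
    attach-sphere : ∀ {N} → Sphere N L → Acyclic Y → Sphere (suc N) W
    attach-sphere {N} S acY = record
      { exact       = exact′
      ; fundamental = z
      ; supp        = Supp-++ (supp-cons supp) (Supp-· _ (Supp-mono Y⊆W u∈))
      ; cycle       = ∂z
      ; spans       = spans′
      ; free        = free′
      }
      where
      open Sphere S renaming (fundamental to ζ)
      hemisphere = acY N ζ (Supp-mono L⊆Y supp) cycle
      u = proj₁ hemisphere
      u∈ = proj₁ (proj₂ hemisphere)
      ∂u = proj₂ (proj₂ hemisphere)
      z = cons v ζ ++ neg u

      ∂z : ∂ z ≋ []
      ∂z x = begin
        coeff (∂ z) x                                     ≈⟨ coeff-∂-split v ζ (neg u) x ⟩
        (coeff ζ x - coeff (cons v (∂ ζ)) x) + coeff (∂ (neg u)) x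
          ≈⟨ +-cong (R.trans (+-congˡ (R.trans (-‿cong (cons-cong v {∂ ζ} {[]} cycle x)) -0#≈0#)) (+-identityʳ _))
                    (R.trans (neg-· u x) (-‿cong (∂u x))) ⟩
        coeff ζ x - coeff ζ x                             ≈⟨ -‿inverseʳ _ ⟩
        0#                                                ∎

      exact′ : ∀ ℓ → ℓ ≢ suc N → ∀ p → Supp W ℓ p → ∂ p ≋ [] → Bounds W (suc ℓ) p
      exact′ zero    _   p s e = Bounds-mono p Y⊆W (acY zero p (restrict-0 s) e)
      exact′ (suc ℓ) ℓ≢N p s e = fill-tails acY s e
        (exact ℓ (ℓ≢N ∘ ≡.cong suc) (tails v p) (supp-tails-suc s) (∂-tails s e))

      spans′ : ∀ p → Supp W (suc N) p → ∂ p ≋ [] → Σ[ r ∈ Carrier ] Bounds W (suc (suc N)) (p ++ neg (r · z))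
      spans′ p s e = r , Bounds-resp (cons v q′ ++ s′) (p ++ neg (r · z)) (≋-sym {p ++ neg (r · z)} {cons v q′ ++ s′} eq)
        (fill acY (Supp-++ (supp-tails-suc s) (Supp-· _ (Supp-· r supp)))
                  (Supp-++ (supp-rest s) (Supp-· r u∈))
                  (λ x → R.trans (R.sym (∂-cong (p ++ neg (r · z)) (cons v q′ ++ s′) eq x)) (cyc x)) (proj₂ sp))
        where
        sp = spans (tails v p) (supp-tails-suc s) (∂-tails s e)
        r = proj₁ sp
        -- The link part and the rest of `p - r z`. The rest gains `r u` because `z` contains `- u`.
        q′ = tails v p ++ neg (r · ζ)
        s′ = rest v p ++ r · u
        cyc : ∂ (p ++ neg (r · z)) ≋ []
        cyc x = begin
          coeff (∂ (p ++ neg (r · z))) x               ≈⟨ ∂-++ p (neg (r · z)) x ⟩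
          coeff (∂ p) x + coeff (∂ (neg (r · z))) x
            ≈⟨ +-cong (e x) (R.trans (neg-· (r · z) x) (-‿cong
                 (R.trans (∂-· r z x) (R.trans (*-congˡ (∂z x)) (zeroʳ r))))) ⟩
          0# - 0#                                      ≈⟨ -‿inverseʳ 0# ⟩
          0#                                           ∎
        eq : p ++ neg (r · z) ≋ cons v q′ ++ s′
        eq x = begin
          coeff (p ++ neg (r · z)) x                   ≈⟨ Homology.difference R Δ p (r · z) x ⟩
          coeff p x - coeff (r · z) x
            ≈⟨ +-cong (R.trans (split v p x) (coeff-++ (cons v (tails v p)) (rest v p) x))
                      (-‿cong (R.trans (coeff-· r z x) (R.trans (*-congˡ
                        (Homology.difference R Δ (cons v ζ) u x)) (R.trans (distribˡ r _ _)
                        (+-congˡ (R.sym (-‿distribʳ-* r _))))))) ⟩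
          (ct + cr) - (r * cζ - r * cu)                ≈⟨ R.sym (Homology.exchange R Δ _ _ _ _) ⟩
          (ct - r * cζ) + (cr - - (r * cu))
            ≈⟨ +-cong (+-cong R.refl (-‿cong (R.sym (R.trans
                 (R.reflexive (≡.cong (λ w → coeff w x) (cons-· v r ζ))) (coeff-· r (cons v ζ) x)))))
                 (+-congˡ (R.trans (-‿involutive _) (R.sym (coeff-· r u x)))) ⟩
          (ct - coeff (cons v (r · ζ)) x) + (cr + coeff (r · u) x)
            ≈⟨ +-cong (R.sym consq′) (R.sym (coeff-++ (rest v p) (r · u) x)) ⟩
          coeff (cons v q′) x + coeff s′ x             ≈⟨ R.sym (coeff-++ (cons v q′) s′ x) ⟩
          coeff (cons v q′ ++ s′) x                    ∎
          where
          ct = coeff (cons v (tails v p)) x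
          cr = coeff (rest v p) x
          cζ = coeff (cons v ζ) x
          cu = coeff u x
          consq′ : coeff (cons v q′) x ≈ ct - coeff (cons v (r · ζ)) x
          consq′ = begin
            coeff (cons v (tails v p ++ neg (r · ζ))) x
              ≈⟨ R.reflexive (≡.cong (λ w → coeff w x) (map-++ _ (tails v p) (neg (r · ζ)))) ⟩
            coeff (cons v (tails v p) ++ cons v (neg (r · ζ))) x
              ≈⟨ coeff-++ (cons v (tails v p)) _ x ⟩
            ct + coeff (cons v (neg (r · ζ))) x
              ≈⟨ +-congˡ (R.trans (R.reflexive (≡.cong (λ w → coeff w x) (cons-· v (- 1#) (r · ζ))))
                                  (coeff-neg (cons v (r · ζ)) x)) ⟩
            ct - coeff (cons v (r · ζ)) x ∎

      free′ : ∀ r w → Supp W (suc (suc N)) w → ∂ w ≋ r · z → r ≈ 0#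
      -- Comparing link parts in `∂ w = r z` gives `∂ (- q) = r ζ`, a relation inside the link.
      free′ r w s e = free r (neg q) (Supp-· _ (supp-tails-suc s)) λ x →
        R.trans (neg-· q x) (∂-split-cons {X₁ = r · ζ} {r · neg u} (avoids-tails s) (avoids-Y (supp-rest s))
          (avoids-· r (avoids-· _ (avoids-Y u∈)))
          (λ y → R.trans (R.sym (∂-split v w y)) (R.trans (e y) (R.reflexive (≡.cong (λ t → coeff t y)
            (≡.trans (map-++ _ (cons v ζ) (neg u)) (≡.cong (_++ r · neg u) (≡.sym (cons-· v r ζ)))))))) x)
        where q = tails v w

  -- Attaching v and then t, where v is the only vertex below t: a cycle p is
  -- moved off t by subtracting the boundary of v ∗ t ∗ q, q being the link of t in p - v ∗ -.
  attach-below-acyclic : ∀ {W v X L⁺ t X′ D L Y} → Attach W v X L⁺ → Attach X t X′ D → Attach L⁺ t L D →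
                         Attach Y v X′ L → Acyclic Y → Acyclic W
  attach-below-acyclic {W} {v} {X} {L⁺} {t} {X′} {D} {L} {Y} A₁ A₂ A₃ A₄ acY = go
    where
    Y⊆W : ∀ {x} → Y x → W x
    Y⊆W {x} y with x ≟ v
    ... | yes refl = Attach.W∋v A₁
    ... | no x≢v   = Attach.Y⊆W A₁ (Attach.Y⊆W A₂ (Attach.W⊆Y A₄ y x≢v))

    go : Acyclic W
    go zero    p s e = Bounds-mono p Y⊆W (acY zero p (All.map (λ { {_ , []} _ → ([] , []) , refl }) s) e)
    go (suc ℓ) p p∈ e = proj₁ filling ++ join , Supp-++ (Supp-mono Y⊆W (proj₁ (proj₂ filling))) join∈ , λ x → begin
      coeff (∂ (proj₁ filling ++ join)) x            ≈⟨ ∂-++ (proj₁ filling) join x ⟩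
      coeff (∂ (proj₁ filling)) x + coeff (∂ join) x ≈⟨ +-congʳ (proj₂ (proj₂ filling) x) ⟩
      coeff p″ x + coeff (∂ join) x                  ≈⟨ p″+∂join x ⟩
      coeff p x                                      ∎
      where
      q = tails v p
      s = rest v p
      q₂ = tails t s
      s′ = rest t s
      q₃ = tails t q
      q₄ = rest t q
      q∈ = supp-tails-suc A₁ p∈
      s∈ = supp-rest A₁ p∈
      q₂∈ = supp-tails-suc A₂ s∈
      s′∈ = supp-rest A₂ s∈
      q₄∈ = supp-rest A₃ q∈
      join = cons v (cons t q₂)
      join∈ : Supp W (suc (suc ℓ)) join
      join∈ = supp-cons A₁ (supp-cons A₃ q₂∈)
      -- This is `p` minus the boundary of `join`: the terms through `t` have cancelled, at the cost
      -- of the new term `v ∗ q₂`.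
      p″ = cons v (q₄ ++ q₂) ++ s′
      p″∈ : Supp Y (suc ℓ) p″
      p″∈ = Supp-++ (supp-cons A₄ (Supp-++ q₄∈ (Supp-mono (Attach.L⊆Y A₃) q₂∈)))
                    (Supp-mono (Attach.Y⊆W A₄) s′∈)

      -- Read off from the faces of `∂ p = 0` that contain `t` but not `v`: they come from removing
      -- `v` in `v ∗ t ∗ q₃` and from taking the boundary of `q₂` in `t ∗ q₂`.
      ∂q₂ : ∂ q₂ ≋ q₃
      ∂q₂ x = begin
        coeff (∂ q₂) x             ≈⟨ R.sym (-‿involutive _) ⟩
        - - coeff (∂ q₂) x
          ≈⟨ -‿cong (∂-split-cons {X₁ = neg q₃} {neg q₄} (avoids-tails A₂ s∈) (avoids-Y A₂ s′∈)
                       (avoids-· _ (avoids-Y A₃ q₄∈)) eq x) ⟩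
        - coeff (neg q₃) x         ≈⟨ -‿cong (coeff-neg q₃ x) ⟩
        - - coeff q₃ x             ≈⟨ -‿involutive _ ⟩
        coeff q₃ x                 ∎
        where
        eq : ∂ (cons t q₂ ++ s′) ≋ cons t (neg q₃) ++ neg q₄
        eq y = begin
          coeff (∂ (cons t q₂ ++ s′)) y           ≈⟨ R.sym (∂-split t s y) ⟩
          coeff (∂ s) y
            ≈⟨ +-inverseʳ-unique _ _ (tails+∂rest A₁ p∈ e y) ⟩
          - coeff q y                             ≈⟨ -‿cong (split t q y) ⟩
          - coeff (cons t q₃ ++ q₄) y             ≈⟨ R.sym (coeff-neg (cons t q₃ ++ q₄) y) ⟩
          coeff (neg (cons t q₃ ++ q₄)) y
            ≈⟨ R.reflexive (≡.cong (λ w → coeff w y) (≡.trans (map-++ _ (cons t q₃) q₄)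
                 (≡.cong (_++ neg q₄) (≡.sym (cons-· t (- 1#) q₃))))) ⟩
          coeff (cons t (neg q₃) ++ neg q₄) y     ∎

      p″+∂join : ∀ x → coeff p″ x + coeff (∂ join) x ≈ coeff p x
      p″+∂join x = begin
        coeff p″ x + coeff (∂ join) x
          ≈⟨ +-cong (R.trans (coeff-++ (cons v (q₄ ++ q₂)) s′ x) (+-congʳ (R.trans
               (R.reflexive (≡.cong (λ w → coeff w x) (map-++ _ q₄ q₂))) (coeff-++ (cons v q₄) (cons v q₂) x))))
               (R.trans (∂-cons v (cons t q₂) x) (+-congˡ (-‿cong ∂tq₂))) ⟩
        ((c₄ + c₂) + cs) + (ct - (c₂ - c₃))      ≈⟨ +-congʳ (+-congʳ (+-comm _ _)) ⟩
        ((c₂ + c₄) + cs) + (ct - (c₂ - c₃))      ≈⟨ +-congʳ (+-assoc _ _ _) ⟩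
        (c₂ + (c₄ + cs)) + (ct - (c₂ - c₃))
          ≈⟨ +-cong (R.sym (R.trans (+-congˡ (-‿involutive _)) (+-comm _ _)))
                    (R.trans (+-congˡ (Homology.swap R Δ _ _))
                      (R.trans (R.sym (+-assoc _ _ _)) (+-congʳ (+-comm _ _)))) ⟩
        ((c₄ + cs) - - c₂) + ((c₃ + ct) - c₂)    ≈⟨ Homology.exchange R Δ _ _ _ _ ⟩
        ((c₄ + cs) + (c₃ + ct)) - (- c₂ + c₂)
          ≈⟨ R.trans (+-congˡ (R.trans (-‿cong (-‿inverseˡ _)) -0#≈0#)) (+-identityʳ _) ⟩
        (c₄ + cs) + (c₃ + ct)                    ≈⟨ +-comm _ _ ⟩
        (c₃ + ct) + (c₄ + cs)                    ≈⟨ +-assoc _ _ _ ⟩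
        c₃ + (ct + (c₄ + cs))
          ≈⟨ +-congˡ (R.trans (R.sym (+-assoc _ _ _)) (R.trans (+-congʳ (+-comm _ _)) (+-assoc _ _ _))) ⟩
        c₃ + (c₄ + (ct + cs))                    ≈⟨ R.sym (+-assoc _ _ _) ⟩
        (c₃ + c₄) + (ct + cs)
          ≈⟨ R.sym (+-cong cq (R.trans (split t s x) (coeff-++ (cons t q₂) s′ x))) ⟩
        coeff (cons v q) x + coeff s x           ≈⟨ R.sym (R.trans (split v p x) (coeff-++ (cons v q) s x)) ⟩
        coeff p x                                ∎
        where
        c₄ = coeff (cons v q₄) x
        c₂ = coeff (cons v q₂) x
        c₃ = coeff (cons v (cons t q₃)) x
        ct = coeff (cons t q₂) x
        cs = coeff s′ x
        ∂tq₂ : coeff (cons v (∂ (cons t q₂))) x ≈ c₂ - c₃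
        ∂tq₂ = begin
          coeff (cons v (∂ (cons t q₂))) x
            ≈⟨ cons-cong v {∂ (cons t q₂)} {q₂ ++ neg (cons t q₃)} (λ y → R.trans (∂-cons t q₂ y)
                 (R.trans (+-congˡ (-‿cong (cons-cong t {∂ q₂} {q₃} ∂q₂ y)))
                          (R.sym (Homology.difference R Δ q₂ (cons t q₃) y)))) x ⟩
          coeff (cons v (q₂ ++ neg (cons t q₃))) x
            ≈⟨ R.reflexive (≡.cong (λ w → coeff w x) (≡.trans (map-++ _ q₂ _)
                 (≡.cong (cons v q₂ ++_) (cons-· v (- 1#) (cons t q₃))))) ⟩
          coeff (cons v q₂ ++ neg (cons v (cons t q₃))) x
            ≈⟨ Homology.difference R Δ (cons v q₂) _ x ⟩
          c₂ - c₃ ∎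
        cq : coeff (cons v q) x ≈ c₃ + c₄
        cq = R.trans (cons-cong v {q} {cons t q₃ ++ q₄} (split t q) x)
          (R.trans (R.reflexive (≡.cong (λ w → coeff w x) (map-++ _ (cons t q₃) q₄)))
                   (coeff-++ (cons v (cons t q₃)) _ x))

      ∂p″ : ∂ p″ ≋ []
      ∂p″ x = begin
        coeff (∂ p″) x                                ≈⟨ R.sym (+-identityʳ _) ⟩
        coeff (∂ p″) x + 0#                           ≈⟨ +-congˡ (R.sym (∂-∂ join x)) ⟩
        coeff (∂ p″) x + coeff (∂ (∂ join)) x         ≈⟨ R.sym (∂-++ p″ (∂ join) x) ⟩
        coeff (∂ (p″ ++ ∂ join)) x
          ≈⟨ ∂-cong (p″ ++ ∂ join) p (λ y → R.trans (coeff-++ p″ _ y) (p″+∂join y)) x ⟩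
        coeff (∂ p) x                                 ≈⟨ e x ⟩
        0#                                            ∎

      filling = acY (suc ℓ) p″ p″∈ ∂p″

  -- The sphere of dimension `-1`: the complex whose only face is empty, with that face as
  -- fundamental cycle.
  empty-sphere : ∀ {W} → (∀ {x} → ¬ W x) → Sphere 0 W
  empty-sphere {W} W∌ = record
    { exact       = λ { zero 0≢0 → ⊥-elim (0≢0 refl) ; (suc ℓ) _ p s _ → [] , [] , λ x →
                      R.sym (R.reflexive (≡.cong (λ u → coeff u x) (none s))) }
    ; fundamental = (1# , []) ∷ []
    ; supp        = (([] , []) , refl) ∷ []
    ; cycle       = λ _ → R.refl
    ; spans       = λ p s _ → coeff p [] , [] , [] , λ x → R.sym (begin
        coeff (p ++ neg (coeff p [] · ((1# , []) ∷ []))) x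
          ≈⟨ Homology.difference R Δ p (coeff p [] · ((1# , []) ∷ [])) x ⟩
        coeff p x - coeff (coeff p [] · ((1# , []) ∷ [])) x
          ≈⟨ +-congˡ (-‿cong (R.sym (scalar p s x))) ⟩
        coeff p x - coeff p x                        ≈⟨ -‿inverseʳ _ ⟩
        0#                                           ∎)
    ; free        = λ r w s e → R.sym (begin
        0#                                           ≈⟨ R.reflexive (≡.cong (λ u → coeff (∂ u) []) (≡.sym (none s))) ⟩
        coeff (∂ w) []                               ≈⟨ e [] ⟩
        r * 1# + 0#                                  ≈⟨ R.trans (+-identityʳ _) (*-identityʳ r) ⟩
        r                                            ∎)
    }
    where
    none : ∀ {ℓ p} → Supp W (suc ℓ) p → p ≡ []
    none []                                  = refl
    none (_∷_ {_ , _ ∷ _} ((_ , x∈W ∷ _) , _) _) = ⊥-elim (W∌ x∈W)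
    none (_∷_ {_ , []} (_ , ()) _)
    scalar : ∀ p → Supp W 0 p → p ≋ coeff p [] · ((1# , []) ∷ [])
    scalar p s []      = R.sym (R.trans (+-identityʳ _) (*-identityʳ _))
    scalar p s (_ ∷ _) = coeff-absent (All.map (λ { (_ , ()) refl }) s)

-- Reduced homology modules of a homology sphere

module SphereHomology {c ℓ} (R : CommutativeRing c ℓ) (Δ : OrderedComplex) {N W}
  (S : Chains.Sphere R Δ N W)
  (face⇒ : ∀ {F} → OrderedComplex.Face Δ F → Chains.Simplex R Δ W F)
  (face⇐ : ∀ {F} → Chains.Simplex R Δ W F → OrderedComplex.Face Δ F)
  where

  open OrderedComplex Δ using (Vertex; Face)
  open CommutativeRing R hiding (refl; zero)
  private module R = CommutativeRing R
  open RingProperties ring using (-‿distribʳ-*; -‿distribˡ-*; -0#≈0#; -‿involutive; -1*x≈-x; +-inverseˡ-unique)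
  open LinearCombinations R
  open Chains R Δ
  open Coefficients _≟ᴸ_
  open Homology R Δ
  open Sphere S renaming (fundamental to ζ)
  open import Relation.Binary.Reasoning.Setoid R.setoid

  dimension : ℕ → ℤ
  dimension n = + n ℤ.- 1ℤ

  dimension-injective : ∀ {m n} → dimension m ≡ dimension n → m ≡ n
  dimension-injective {zero}  {zero}  _    = refl
  dimension-injective {suc m} {suc n} refl = refl

  suc-dimension : ∀ n → ℤ.suc (dimension n) ≡ dimension (suc n)
  suc-dimension zero    = refl
  suc-dimension (suc n) = refl

  onFaces⇒Supp : ∀ {ℓ p} → All (λ (_ , F) → Face F × dim F ≡ dimension ℓ) p → Supp W ℓ p
  onFaces⇒Supp = All.map λ (F∈ , len) → face⇒ F∈ , dimension-injective len

  Supp⇒onFaces : ∀ {ℓ p} → Supp W ℓ p → All (λ (_ , F) → Face F × dim F ≡ dimension ℓ) p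
  Supp⇒onFaces = All.map λ (F∈ , len) → face⇐ F∈ , ≡.cong dimension len

  ∂Chain : ∀ ℓ p → Bounds W (suc ℓ) p → Σ[ w ∈ Chain (ℤ.suc (dimension ℓ)) ] ∂ (Chain.combination w) ≋ p
  ∂Chain ℓ p (w , s , e) = mkChain w (All.map (λ (f , eq) → f , ≡.trans eq (≡.sym (suc-dimension ℓ)))
    (Supp⇒onFaces s)) , e

  ∂Chain⁻¹ : ∀ ℓ p → Σ[ w ∈ Chain (ℤ.suc (dimension ℓ)) ] ∂ (Chain.combination w) ≋ p → Bounds W (suc ℓ) p
  ∂Chain⁻¹ ℓ p (mkChain w f , e) =
    w , onFaces⇒Supp (All.map (λ (f , eq) → f , ≡.trans eq (suc-dimension ℓ)) f) , e

  -- `r` is the degree of the cycle `p`: the class of `p` is `r` times the fundamental class.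
  -- Existence is `spans`, uniqueness is `free`, and the degree is the isomorphism in `H̃-top`.
  Degree : Lin (List Vertex) → Carrier → Set _
  Degree p r = Σ[ w ∈ Lin (List Vertex) ] Supp W (suc N) w ×
    (∀ x → coeff (∂ w) x ≈ coeff p x - r * coeff ζ x)

  degree-unique : ∀ p {r s} → Degree p r → Degree p s → r ≈ s
  degree-unique p {r} {s} (w , w∈ , ∂w) (w′ , w′∈ , ∂w′) = R.trans
    (+-inverseˡ-unique r (- s) (free (r - s) (w′ ++ neg w) (Supp-++ w′∈ (Supp-· _ w∈)) λ x → begin
      coeff (∂ (w′ ++ neg w)) x
        ≈⟨ R.trans (∂-++ w′ (neg w) x) (+-cong (∂w′ x) (R.trans (neg-· w x) (-‿cong (∂w x)))) ⟩
      (coeff p x - s * coeff ζ x) - (coeff p x - r * coeff ζ x)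
        ≈⟨ +-comm _ _ ⟩
      - (coeff p x - r * coeff ζ x) + (coeff p x - s * coeff ζ x)
        ≈⟨ +-congʳ (swap _ _) ⟩
      (r * coeff ζ x - coeff p x) + (coeff p x - s * coeff ζ x)
        ≈⟨ cancel _ _ _ ⟩
      r * coeff ζ x - s * coeff ζ x
        ≈⟨ R.sym (R.trans (distribʳ _ _ _) (+-congˡ (R.sym (-‿distribˡ-* _ _)))) ⟩
      (r - s) * coeff ζ x                          ≈⟨ R.sym (coeff-· (r - s) ζ x) ⟩
      coeff ((r - s) · ζ) x                        ∎))
    (-‿involutive s)

  degree-++ : ∀ p q {r s} → Degree p r → Degree q s → Degree (p ++ q) (r + s)
  degree-++ p q {r} {s} (w , w∈ , ∂w) (w′ , w′∈ , ∂w′) = w ++ w′ , Supp-++ w∈ w′∈ , λ x → begin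
    coeff (∂ (w ++ w′)) x                          ≈⟨ R.trans (∂-++ w w′ x) (+-cong (∂w x) (∂w′ x)) ⟩
    (coeff p x - r * coeff ζ x) + (coeff q x - s * coeff ζ x)
      ≈⟨ exchange _ _ _ _ ⟩
    (coeff p x + coeff q x) - (r * coeff ζ x + s * coeff ζ x)
      ≈⟨ R.sym (+-cong (coeff-++ p q x) (-‿cong (distribʳ _ _ _))) ⟩
    coeff (p ++ q) x - (r + s) * coeff ζ x         ∎

  degree-· : ∀ t p {r} → Degree p r → Degree (t · p) (t * r)
  degree-· t p {r} (w , w∈ , ∂w) = t · w , Supp-· t w∈ , λ x → begin
    coeff (∂ (t · w)) x                            ≈⟨ R.trans (∂-· t w x) (*-congˡ (∂w x)) ⟩
    t * (coeff p x - r * coeff ζ x)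
      ≈⟨ R.trans (distribˡ _ _ _) (+-congˡ (R.sym (-‿distribʳ-* _ _))) ⟩
    t * coeff p x - t * (r * coeff ζ x)
      ≈⟨ R.sym (+-cong (coeff-· t p x) (-‿cong (*-assoc t r _))) ⟩
    coeff (t · p) x - (t * r) * coeff ζ x          ∎

  degree-resp : ∀ p {r s} → r ≈ s → Degree p r → Degree p s
  degree-resp p r≈s (w , w∈ , ∂w) = w , w∈ , λ x → R.trans (∂w x) (+-congˡ (-‿cong (*-congʳ r≈s)))

  degree-0 : ∀ p → Bounds W (suc N) p → Degree p 0#
  degree-0 p (w , w∈ , ∂w) = w , w∈ , λ x → R.trans (∂w x)
    (R.sym (R.trans (+-congˡ (R.trans (-‿cong (zeroˡ _)) -0#≈0#)) (+-identityʳ _)))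

  degree-0⁻¹ : ∀ p → Degree p 0# → Bounds W (suc N) p
  degree-0⁻¹ p (w , w∈ , ∂w) = w , w∈ , λ x → R.trans (∂w x)
    (R.trans (+-congˡ (R.trans (-‿cong (zeroˡ _)) -0#≈0#)) (+-identityʳ _))

  degree-ζ : Degree ζ 1#
  degree-ζ = [] , [] , λ x → R.sym (R.trans (+-congˡ (-‿cong (*-identityˡ _))) (-‿inverseʳ _))

  cycle-degree : (y : Cycle (dimension N)) → Σ[ r ∈ Carrier ] Degree (Cycle.combination y) r
  cycle-degree y =
    let r , w , w∈ , ∂w = spans (Cycle.combination y) (onFaces⇒Supp (Cycle.onFaces y)) (Cycle.∂≋0 y)
    in r , w , w∈ , λ x → R.trans (∂w x)
      (R.trans (difference (Cycle.combination y) (r · ζ) x) (+-congˡ (-‿cong (coeff-· r ζ x))))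

  degree-cong : ∀ {y z} → y ∼ z → proj₁ (cycle-degree y) ≈ proj₁ (cycle-degree z)
  degree-cong {y} {z} y∼z = R.sym (+-inverseˡ-unique′ (degree-unique (p ++ neg q)
    (degree-++ p (neg q) (proj₂ (cycle-degree y)) (degree-· (- 1#) q (proj₂ (cycle-degree z))))
    (degree-0 (p ++ neg q) (∂Chain⁻¹ N (p ++ neg q) y∼z))))
    where
    p = Cycle.combination y
    q = Cycle.combination z
    +-inverseˡ-unique′ : ∀ {r s} → r + - 1# * s ≈ 0# → s ≈ r
    +-inverseˡ-unique′ {r} {s} e = R.sym (R.trans (+-inverseˡ-unique _ _ e)
      (R.trans (-‿cong (-1*x≈-x s)) (-‿involutive s)))

  degree-injective : ∀ {y z} → proj₁ (cycle-degree y) ≈ proj₁ (cycle-degree z) → y ∼ z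
  degree-injective {y} {z} e = ∂Chain N (p ++ neg q) (degree-0⁻¹ (p ++ neg q) (degree-resp (p ++ neg q)
    (R.trans (+-cong e (-1*x≈-x _)) (-‿inverseʳ _))
    (degree-++ p (neg q) (proj₂ (cycle-degree y)) (degree-· (- 1#) q (proj₂ (cycle-degree z))))))
    where
    p = Cycle.combination y
    q = Cycle.combination z

  ζ-multiple : Carrier → Cycle (dimension N)
  ζ-multiple r = r ·ᶻ mkCycle (mkChain ζ (Supp⇒onFaces supp)) cycle

  H̃-top : H̃ (dimension N) ≅ TensorUnit.⟨module⟩ {R = R}
  H̃-top = proj₁ ∘ cycle-degree , record
    { isModuleMonomorphism = record
      { isModuleHomomorphism = record
        { isBimoduleHomomorphism = record
          { +ᴹ-isGroupHomomorphism = record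
            { isMonoidHomomorphism = record
              { isMagmaHomomorphism = record
                { isRelHomomorphism = record { cong = λ {y} {z} → degree-cong {y} {z} }
                ; homo = λ y z → degree-unique (comb y ++ comb z) (proj₂ (cycle-degree (y ⊹ z)))
                           (degree-++ (comb y) (comb z) (proj₂ (cycle-degree y)) (proj₂ (cycle-degree z)))
                }
              ; ε-homo = degree-unique [] (proj₂ (cycle-degree 0ᶻ)) (degree-0 [] ([] , [] , λ _ → R.refl))
              }
            ; ⁻¹-homo = λ y → R.trans (scalar (- 1#) y) (-1*x≈-x _)
            }
          ; *ₗ-homo = scalar
          ; *ᵣ-homo = λ r y → R.trans (scalar r y) (*-comm _ _)
          }
        }
      ; injective = λ {y} {z} → degree-injective {y} {z}
      }
    ; surjective = λ r → ζ-multiple r , λ {y} e → R.trans (degree-cong {y} {ζ-multiple r} e)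
        (degree-unique (r · ζ) (proj₂ (cycle-degree (ζ-multiple r)))
          (degree-resp (r · ζ) (*-identityʳ r) (degree-· r ζ degree-ζ)))
    }
    where
    comb = Cycle.combination
    scalar : ∀ r y → proj₁ (cycle-degree (r ·ᶻ y)) ≈ r * proj₁ (cycle-degree y)
    scalar r y = degree-unique (r · comb y) (proj₂ (cycle-degree (r ·ᶻ y))) (degree-· r (comb y) (proj₂ (cycle-degree y)))

  trivial : ∀ {i} → (∀ (y : Cycle i) → y ∼ 0ᶻ) → H̃ i ≅ Zero.⟨module⟩ {c = c} {ℓ = ℓ} {R = R}
  trivial {i} y∼0 = _ , record
    { isModuleMonomorphism = record
      { isModuleHomomorphism = record
        { isBimoduleHomomorphism = record
          { +ᴹ-isGroupHomomorphism = record
            { isMonoidHomomorphism = record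
              { isMagmaHomomorphism = record { isRelHomomorphism = _ ; homo = _ }
              ; ε-homo = _
              }
            ; ⁻¹-homo = _
            }
          ; *ₗ-homo = _
          ; *ᵣ-homo = _
          }
        }
      ; injective = λ {y} {z} _ → ∼-trans {y = y} {0ᶻ} {z} (y∼0 y) (∼-sym {y = z} {0ᶻ} (y∼0 z))
      }
    ; surjective = λ _ → 0ᶻ , _
    }

  dimension? : ∀ i → (∃[ n ] i ≡ dimension n) ⊎ (∀ n → dimension n ≢ i)
  dimension? (+ n)          = inj₁ (suc n , refl)
  dimension? -[1+ zero ]    = inj₁ (0 , refl)
  dimension? -[1+ (suc k) ] = inj₂ λ { zero () ; (suc n) () }

  H̃-other : ∀ {i} → i ≢ dimension N → H̃ i ≅ Zero.⟨module⟩ {c = c} {ℓ = ℓ} {R = R}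
  H̃-other {i} i≢ with dimension? i
  ... | inj₁ (n , refl) = trivial λ y →
    let w , w∈ , ∂w = exact n (i≢ ∘ ≡.cong dimension) (Cycle.combination y)
                        (onFaces⇒Supp (Cycle.onFaces y)) (Cycle.∂≋0 y)
    in ∂Chain n (Cycle.combination y ++ []) (w , w∈ , λ x → R.trans (∂w x)
         (R.sym (R.trans (coeff-++ (Cycle.combination y) [] x) (+-identityʳ _))))
  -- Below dimension `-1` there are no faces, so a chain can only be the empty list.
  ... | inj₂ none = trivial λ
    { (mkCycle (mkChain [] _) _)             → mkChain [] [] , λ _ → R.refl
    ; (mkCycle (mkChain ((_ , F) ∷ _) ((_ , e) ∷ _)) _) → ⊥-elim (none (length F) e)
    }

-- The ranked poset

module Tower (α : ℕ → ℕ) where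

  -- The elements of levels k, k + 1, …; level k is rank k + 1 in the paper.  Level k consists
  -- of the copies τ 0, …, τ a of one element, where a is α k (or 0 when k = 0), and of the new
  -- elements μ 0, …, μ b with b = α (suc k).  The τ's have the same elements above them.
  data E (a k : ℕ) : Set where
    τ  : Fin (suc a) → E a k
    μ  : Fin (suc (α (suc k))) → E a k
    up : E (α (suc k)) (suc k) → E a k

  τ-injective : ∀ {a k} {i j : Fin (suc a)} → τ {a} {k} i ≡ τ j → i ≡ j
  τ-injective refl = refl

  μ-injective : ∀ {a k} {i j : Fin (suc (α (suc k)))} → μ {a} {k} i ≡ μ j → i ≡ j
  μ-injective refl = refl

  up-injective : ∀ {a k} {x y : E (α (suc k)) (suc k)} → up {a} {k} x ≡ up y → x ≡ y
  up-injective refl = refl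

  level : ∀ {a k} → E a k → ℕ
  level (τ _)  = 0
  level (μ _)  = 0
  level (up x) = suc (level x)

  -- Describes the section in which the one copy `τ t` stands for the unsplit element. An element of
  -- the level below that is a `τ` sees the section of the first copy, the last `μ` there sees that
  -- of the last copy.
  Only : ∀ {a k} → Fin (suc a) → E a k → Set
  Only t (τ j)  = j ≡ t
  Only t (μ _)  = ⊤
  Only t (up _) = ⊤

  Last : ∀ {b} → Fin (suc b) → Set
  Last {b} i = toℕ i ≡ b

  Adjacent : ∀ {b} → Fin (suc b) → Fin (suc b) → Set
  Adjacent i j = toℕ j ≡ toℕ i ⊎ toℕ j ≡ suc (toℕ i)

  infix 4 _⊏_
  -- The `τ`s, copies of one element, and the last `μ` are the two minimal elements of the 𝐜 step;
  -- the remaining `μ i` are the inserted ones. Counting the `τ`s of level 0 once, every `up (τ j)`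
  -- lies above exactly two elements: the pairs are `τ`, `μ 0` for the first copy and `μ (j - 1)`,
  -- `μ j` for each later one. The condition `Only zero y` in the last clause for `μ` says that
  -- `up y` lies above the split atom.
  _⊏_ : ∀ {a k} → E a k → E a k → Set
  _    ⊏ τ _         = ⊥
  _    ⊏ μ _         = ⊥
  τ _  ⊏ up y        = Only zero y
  μ i  ⊏ up (τ j)    = Adjacent i j
  μ i  ⊏ up (μ _)    = Last i
  μ i  ⊏ up (up y)   = Last i ⊎ Only zero y
  up x ⊏ up y        = x ⊏ y

  ⊏-irrefl : ∀ {a k} (x : E a k) → ¬ x ⊏ x
  ⊏-irrefl (up x) p = ⊏-irrefl x p

  ⊏-trans : ∀ {a k} (x y z : E a k) → x ⊏ y → y ⊏ z → x ⊏ z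
  ⊏-trans (τ _)  (up y)      (up (up z)) _        _ = tt
  ⊏-trans (μ i)  (up (τ j))  (up (up z)) _        q = inj₂ q
  ⊏-trans (μ i)  (up (μ j))  (up (up z)) p        _ = inj₁ p
  ⊏-trans (μ i)  (up (up y)) (up (up (up z))) p   q = inj₂ tt
  ⊏-trans (up x) (up y)      (up z)      p        q = ⊏-trans x y z p q

  ⊏-asym : ∀ {a k} (x y : E a k) → x ⊏ y → ¬ y ⊏ x
  ⊏-asym x y p q = ⊏-irrefl x (⊏-trans x y x p q)

  ⊏⇒level< : ∀ {a k} (x y : E a k) → x ⊏ y → level x ℕ.< level y
  ⊏⇒level< (τ _)  (up y) _ = ℕ.s≤s ℕ.z≤n
  ⊏⇒level< (μ _)  (up y) _ = ℕ.s≤s ℕ.z≤n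
  ⊏⇒level< (up x) (up y) p = ℕ.s≤s (⊏⇒level< x y p)

  only? : ∀ {a k} (t : Fin (suc a)) (x : E a k) → Dec (Only t x)
  only? t (τ j)  = j Finₚ.≟ t
  only? t (μ _)  = yes tt
  only? t (up _) = yes tt

  last? : ∀ {b} (i : Fin (suc b)) → Dec (Last i)
  last? {b} i = toℕ i ℕ.≟ b

  infix 4 _⊏?_
  _⊏?_ : ∀ {a k} → Decidable (_⊏_ {a} {k})
  τ _  ⊏? τ _       = no λ ()
  μ _  ⊏? τ _       = no λ ()
  up _ ⊏? τ _       = no λ ()
  τ _  ⊏? μ _       = no λ ()
  μ _  ⊏? μ _       = no λ ()
  up _ ⊏? μ _       = no λ ()
  τ _  ⊏? up y      = only? zero y
  μ i  ⊏? up (τ j)  = (toℕ j ℕ.≟ toℕ i) ⊎-dec (toℕ j ℕ.≟ suc (toℕ i))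
  μ i  ⊏? up (μ _)  = last? i
  μ i  ⊏? up (up y) = last? i ⊎-dec only? zero y
  up x ⊏? up y      = x ⊏? y

  infix 4 _≟ᴱ_
  _≟ᴱ_ : ∀ {a k} → DecidableEquality (E a k)
  τ i  ≟ᴱ τ j  = map′ (≡.cong τ) (λ { refl → refl }) (i Finₚ.≟ j)
  τ _  ≟ᴱ μ _  = no λ ()
  τ _  ≟ᴱ up _ = no λ ()
  μ _  ≟ᴱ τ _  = no λ ()
  μ i  ≟ᴱ μ j  = map′ (≡.cong μ) (λ { refl → refl }) (i Finₚ.≟ j)
  μ _  ≟ᴱ up _ = no λ ()
  up _ ≟ᴱ τ _  = no λ ()
  up _ ≟ᴱ μ _  = no λ ()
  up x ≟ᴱ up y = map′ (≡.cong up) (λ { refl → refl }) (x ≟ᴱ y)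

-- Intervals and links

module Intervals {c ℓ} (R : CommutativeRing c ℓ) (Δ : OrderedComplex) (α : ℕ → ℕ) where

  open import Data.Nat using (_+_)
  open OrderedComplex Δ using (Vertex; _≟_; _≺_; isStrictPartialOrder)
  open Chains R Δ
  open Tower α

  -- Links are built from the top interval downwards; L is the part above x already built.
  record Labelling {a k} (x : E a k) (L : Vertex → Set) : Set₁ where
    field
      Label      : Vertex → E a k → Set
      functional : ∀ {v e f} → Label v e → Label v f → e ≡ f
      injective  : ∀ {v w e} → Label v e → Label w e → v ≡ w
      reflects   : ∀ {v w e f} → Label v e → Label w f → v ≺ w → e ⊏ f
      preserves  : ∀ {v w e f} → Label v e → Label w f → e ⊏ f → v ≺ w
      total      : ∀ {e} → e ⊏ x → ∃[ v ] Label v e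
      below      : ∀ {v l e} → e ⊏ x → Label v e → L l → v ≺ l

    ⟨_⟩ : (E a k → Set) → Vertex → Set
    ⟨ P ⟩ v = (∃[ e ] P e × Label v e) ⊎ L v

  open Labelling using (⟨_⟩)

  shift : ∀ {a k} {x : E (α (suc k)) (suc k)} {L} → Labelling {a} {k} (up x) L → Labelling x L
  shift ρ = record
    { Label      = λ v e → Label v (up e)
    ; functional = λ p q → up-injective (functional p q)
    ; injective  = injective
    ; reflects   = reflects
    ; preserves  = preserves
    ; total      = total
    ; below      = below
    }
    where open Labelling ρ

  Up : ∀ {a k} → (E (α (suc k)) (suc k) → Set) → E a k → Set
  Up P (up e) = P e
  Up P _      = ⊥

  shift⇒ : ∀ {a k x L} (ρ : Labelling {a} {k} (up x) L) {P Q} → (∀ e → P e → Q (up e)) →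
           ∀ {v} → ⟨ shift ρ ⟩ P v → ⟨ ρ ⟩ Q v
  shift⇒ ρ f (inj₁ (e , p , l)) = inj₁ (up e , f e p , l)
  shift⇒ ρ f (inj₂ l)           = inj₂ l

  shift⇐ : ∀ {a k x L} (ρ : Labelling {a} {k} (up x) L) {P Q} → (∀ e → Q e → Up P e) →
           ∀ {v} → ⟨ ρ ⟩ Q v → ⟨ shift ρ ⟩ P v
  shift⇐ ρ f (inj₁ (up e , p , l)) = inj₁ (e , f (up e) p , l)
  shift⇐ ρ f (inj₁ (τ j , p , l)) = ⊥-elim (f (τ j) p)
  shift⇐ ρ f (inj₁ (μ j , p , l)) = ⊥-elim (f (μ j) p)
  shift⇐ ρ f (inj₂ l)              = inj₂ l

  shift-sphere : ∀ {a k x L N} (ρ : Labelling {a} {k} (up x) L) {P Q} → (∀ e → P e → Q (up e)) →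
                 (∀ e → Q e → Up P e) → Sphere N (⟨ shift ρ ⟩ P) → Sphere N (⟨ ρ ⟩ Q)
  shift-sphere ρ f g = Sphere-resp (shift⇒ ρ f) (shift⇐ ρ g)

  module _ {a k} {x : E a k} {L} (ρ : Labelling x L) where

    open Labelling ρ hiding (⟨_⟩)

    ⟨⟩-mono : ∀ {P Q} → (∀ e → P e → Q e) → ∀ {v} → ⟨ ρ ⟩ P v → ⟨ ρ ⟩ Q v
    ⟨⟩-mono f (inj₁ (e , p , l)) = inj₁ (e , f e p , l)
    ⟨⟩-mono f (inj₂ l)           = inj₂ l

    ⟨⟩-sphere : ∀ {N P Q} → (∀ e → P e → Q e) → (∀ e → Q e → P e) → Sphere N (⟨ ρ ⟩ P) → Sphere N (⟨ ρ ⟩ Q)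
    ⟨⟩-sphere f g = Sphere-resp (⟨⟩-mono f) (⟨⟩-mono g)

    empty-interval : ∀ {N P} → (∀ e → ¬ P e) → Sphere N L → Sphere N (⟨ ρ ⟩ P)
    empty-interval P∌ = Sphere-resp inj₂ λ { (inj₁ (e , p , _)) → ⊥-elim (P∌ e p) ; (inj₂ l) → l }

    -- The conditions of `Attach`, stated for elements below `x`. They survive the addition of `L`
    -- to `P`, `Q` and `M`, since every vertex labelled by an element below `x` lies below all of
    -- `L`.
    record Attachᴱ (P : E a k → Set) (e₀ : E a k) (Q M : E a k → Set) : Set where
      field
        bounded : ∀ e → P e → e ⊏ x
        P∋      : P e₀
        Q⊆P     : ∀ e → Q e → P e
        P⊆Q     : ∀ e → P e → e ≡ e₀ ⊎ Q e
        Q∌      : ¬ Q e₀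
        minimal : ∀ e → P e → ¬ e ⊏ e₀
        M⊆Q     : ∀ e → M e → Q e
        e₀⊏M    : ∀ e → M e → e₀ ⊏ e
        M⊇      : ∀ e → Q e → e₀ ⊏ e → M e

    attach : ∀ {P e₀ Q M v} → Label v e₀ → Attachᴱ P e₀ Q M → Attach (⟨ ρ ⟩ P) v (⟨ ρ ⟩ Q) (⟨ ρ ⟩ M)
    attach {P} {e₀} {Q} {M} {v} v∈ A = record
      { W∋v     = inj₁ (e₀ , P∋ , v∈)
      ; Y⊆W     = ⟨⟩-mono Q⊆P
      ; W⊆Y     = λ
        { (inj₁ (e , p , l)) x≢v → inj₁ (e , inQ (P⊆Q e p) (λ { refl → x≢v (injective l v∈) }) , l)
        ; (inj₂ l) _ → inj₂ l }
      ; Y∌v     = λ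
        { (inj₁ (e , q , l)) refl → Q∌ (≡.subst Q (functional l v∈) q)
        ; (inj₂ l) refl → ≺-irrefl (below (bounded e₀ P∋) v∈ l) refl }
      ; minimal = λ
        { (inj₁ (e , p , l)) x≺v → minimal e p (reflects l v∈ x≺v)
        ; (inj₂ l) x≺v → IsStrictPartialOrder.asym isStrictPartialOrder x≺v (below (bounded e₀ P∋) v∈ l) }
      ; L⊆Y     = ⟨⟩-mono M⊆Q
      ; v≺L     = λ
        { (inj₁ (e , m , l)) → preserves v∈ l (e₀⊏M e m)
        ; (inj₂ l) → below (bounded e₀ P∋) v∈ l }
      ; L⊇      = λ
        { (inj₁ (e , q , l)) v≺x → inj₁ (e , M⊇ e q (reflects v∈ l v≺x) , l)
        ; (inj₂ l) _ → inj₂ l }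
      }
      where
      open Attachᴱ A
      inQ : ∀ {e} → e ≡ e₀ ⊎ Q e → e ≢ e₀ → Q e
      inQ (inj₁ e≡) e≢ = ⊥-elim (e≢ e≡)
      inQ (inj₂ q)  _  = q

    vertex : ∀ {P e₀ Q M} → Attachᴱ P e₀ Q M → ∃[ v ] Label v e₀
    vertex A = total (Attachᴱ.bounded A _ (Attachᴱ.P∋ A))

    sphereᴱ : ∀ {N P e₀ Q M} → Attachᴱ P e₀ Q M → Sphere N (⟨ ρ ⟩ M) → Acyclic (⟨ ρ ⟩ Q) →
              Sphere (suc N) (⟨ ρ ⟩ P)
    sphereᴱ A = attach-sphere (attach (proj₂ (vertex A)) A)

    coneᴱ : ∀ {P e₀ Q} → Attachᴱ P e₀ Q Q → Acyclic (⟨ ρ ⟩ P)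
    coneᴱ A = cone-acyclic A′ (Attach.v≺L A′)
      where A′ = attach (proj₂ (vertex A)) A

    -- The intermediate set `Y`, which has `e₁` but not `e₂`, is acyclic because `e₁` is attached to
    -- `X′` along the acyclic link `M`.
    attach-belowᴱ : ∀ {P e₁ X M⁺ e₂ X′ D M Y} → Attachᴱ P e₁ X M⁺ → Attachᴱ X e₂ X′ D →
                    Attachᴱ M⁺ e₂ M D → Attachᴱ Y e₁ X′ M → Acyclic (⟨ ρ ⟩ M) → Acyclic (⟨ ρ ⟩ X′) →
                    Acyclic (⟨ ρ ⟩ P)
    attach-belowᴱ A₁ A₂ A₃ A₄ acM acX′ = attach-below-acyclic
      (attach l₁ A₁) (attach l₂ A₂) (attach l₂ A₃) (attach l₁ A₄)
      (attach-acyclic (attach l₁ A₄) acM acX′)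
      where
      l₁ = proj₂ (vertex A₁)
      l₂ = proj₂ (vertex A₂)

    -- The cone with apex `e₂` over `Q` is acyclic, and attaching `e₁` along the same sphere `Q`
    -- closes it up.
    suspensionᴱ : ∀ {N P Q e₁ e₂} → (∀ e → P e → e ⊏ x) → e₁ ≢ e₂ → ¬ e₁ ⊏ e₂ → ¬ e₂ ⊏ e₁ →
                  P e₁ → P e₂ → (∀ e → Q e → P e × e₁ ⊏ e × e₂ ⊏ e) →
                  (∀ e → P e → e ≡ e₁ ⊎ e ≡ e₂ ⊎ Q e) →
                  Sphere N (⟨ ρ ⟩ Q) → Sphere (suc N) (⟨ ρ ⟩ P)
    suspensionᴱ {P = P} {Q} {e₁} {e₂} bounded e₁≢e₂ e₁⋢e₂ e₂⋢e₁ P∋e₁ P∋e₂ Q⇒ P⇒ S =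
      sphereᴱ A₁ S (coneᴱ A₂)
      where
      Q∌ : ∀ e → (∀ f → Q f → e ⊏ f) → ¬ Q e
      Q∌ e e⊏ q = ⊏-irrefl e (e⊏ e q)
      A₂ : Attachᴱ (λ e → e ≡ e₂ ⊎ Q e) e₂ Q Q
      A₂ = record
        { bounded = λ { e (inj₁ refl) → bounded e P∋e₂ ; e (inj₂ q) → bounded e (proj₁ (Q⇒ e q)) }
        ; P∋ = inj₁ refl ; Q⊆P = λ e → inj₂ ; P⊆Q = λ e → id
        ; Q∌ = Q∌ e₂ (λ f q → proj₂ (proj₂ (Q⇒ f q)))
        ; minimal = λ { e (inj₁ refl) → ⊏-irrefl e₂ ; e (inj₂ q) → ⊏-asym e₂ e (proj₂ (proj₂ (Q⇒ e q))) }
        ; M⊆Q = λ e → id ; e₀⊏M = λ e q → proj₂ (proj₂ (Q⇒ e q)) ; M⊇ = λ e q _ → q }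
      A₁ : Attachᴱ P e₁ (λ e → e ≡ e₂ ⊎ Q e) Q
      A₁ = record
        { bounded = bounded
        ; P∋ = P∋e₁
        ; Q⊆P = λ { e (inj₁ refl) → P∋e₂ ; e (inj₂ q) → proj₁ (Q⇒ e q) }
        ; P⊆Q = P⇒
        ; Q∌ = λ { (inj₁ e≡) → e₁≢e₂ e≡ ; (inj₂ q) → Q∌ e₁ (λ f q → proj₁ (proj₂ (Q⇒ f q))) q }
        ; minimal = λ e p e⊏e₁ → case-min e (P⇒ e p) e⊏e₁
        ; M⊆Q = λ e → inj₂
        ; e₀⊏M = λ e q → proj₁ (proj₂ (Q⇒ e q))
        ; M⊇ = λ { e (inj₁ refl) e₁⊏e → ⊥-elim (e₁⋢e₂ e₁⊏e) ; e (inj₂ q) _ → q }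
        }
        where
        case-min : ∀ e → e ≡ e₁ ⊎ e ≡ e₂ ⊎ Q e → ¬ e ⊏ e₁
        case-min e (inj₁ refl)        = ⊏-irrefl e₁
        case-min e (inj₂ (inj₁ refl)) = e₂⋢e₁
        case-min e (inj₂ (inj₂ q))    = ⊏-asym e₁ e (proj₁ (proj₂ (Q⇒ e q)))

  -- Below x = up (up y) with Only zero y, the vertices τ t, μ 0, …, μ b and
  -- up (τ 0), …, up (τ b) form the path τ t – up (τ 0) – μ 0 – up (τ 1) – ⋯ – up (τ b) – μ b.
  -- Initial ρ i keeps the part of the path up to up (τ i), and everything above the path.
  module Path {a k} {y : E (α (2 + k)) (2 + k)} {L} (ρ : Labelling {a} {k} (up (up y)) L)
              (base : Only zero y) (t : Fin (suc a)) where

    b = α (suc k)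

    Initial : ℕ → E a k → Set
    Initial i (τ j)       = j ≡ t
    Initial i (μ j)       = toℕ j ℕ.< i
    Initial i (up (τ j))  = toℕ j ℕ.≤ i
    Initial i (up (μ j))  = _⊏_ {b} (μ j) (up y)
    Initial i (up (up z)) = z ⊏ y

    bounded : ∀ i e → Initial i e → e ⊏ up (up y)
    bounded i (τ j)       p = tt
    bounded i (μ j)       p = inj₂ base
    bounded i (up (τ j))  p = base
    bounded i (up (μ j))  p = p
    bounded i (up (up z)) p = p

    -- With `up (τ 0)` as the only copy and no `μ` of level 0, everything kept lies above `τ t`.
    initial-0 : Acyclic (⟨ ρ ⟩ (Initial 0))
    initial-0 = coneᴱ ρ {Initial 0} {τ t} {Up (λ e → Initial 0 (up e))} record
      { bounded = bounded 0
      ; P∋ = refl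
      ; Q⊆P = λ { (up e) p → p }
      ; P⊆Q = λ { (τ j) refl → inj₁ refl ; (up e) p → inj₂ p }
      ; Q∌ = λ ()
      ; minimal = λ e _ ()
      ; M⊆Q = λ e p → p
      ; e₀⊏M = λ { (up (τ zero)) _ → refl ; (up (μ _)) _ → tt ; (up (up _)) _ → tt }
      ; M⊇ = λ e p _ → p
      }

    module _ (i : ℕ) (i<b : i ℕ.< b) where

      j₀ j₁ : Fin (suc b)
      j₀ = fromℕ< (ℕₚ.m<n⇒m<1+n i<b)
      j₁ = fromℕ< (ℕ.s≤s i<b)

      toℕ-j₀ : toℕ j₀ ≡ i
      toℕ-j₀ = Finₚ.toℕ-fromℕ< (ℕₚ.m<n⇒m<1+n i<b)

      toℕ-j₁ : toℕ j₁ ≡ suc i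
      toℕ-j₁ = Finₚ.toℕ-fromℕ< (ℕ.s≤s i<b)

      is-j₀ : ∀ j → toℕ j ≡ i → j ≡ j₀
      is-j₀ j e = Finₚ.toℕ-injective (≡.trans e (≡.sym toℕ-j₀))

      is-j₁ : ∀ j → toℕ j ≡ suc i → j ≡ j₁
      is-j₁ j e = Finₚ.toℕ-injective (≡.trans e (≡.sym toℕ-j₁))

      ≤-suc : ∀ {m n} → m ℕ.≤ suc n → m ≡ suc n ⊎ m ℕ.≤ n
      ≤-suc {m} {n} m≤ with m ℕ.≟ suc n
      ... | yes e = inj₁ e
      ... | no ≢  = inj₂ (ℕ.s≤s⁻¹ (ℕₚ.≤∧≢⇒< m≤ ≢))

      ¬last : toℕ j₀ ≢ b
      ¬last e = ℕₚ.<⇒≢ i<b (≡.trans (≡.sym toℕ-j₀) e)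

      -- `WithTau` adds `up (τ (i + 1))` to `Initial i`, and `WithMu` adds `μ i`. `D` is the part
      -- above the copies, hence the link of the new copy in `WithTau`. `M` and `M⁺` are the links
      -- of `μ i` without and with the new copy.
      WithTau WithMu D M M⁺ : E a k → Set
      WithTau (up (τ j)) = toℕ j ℕ.≤ suc i
      WithTau e          = Initial i e
      WithMu  (μ j)      = toℕ j ℕ.< suc i
      WithMu  e          = Initial i e
      D (up (up z))      = Only zero z × z ⊏ y
      D _                = ⊥
      M (up (τ j))       = j ≡ j₀
      M e                = D e
      M⁺ (up (τ j))      = Adjacent j₀ j
      M⁺ e               = D e

      A₁ : Attachᴱ ρ (Initial (suc i)) (μ j₀) WithTau M⁺
      A₁ = record
        { bounded = bounded (suc i)
        ; P∋ = ℕ.s≤s (ℕₚ.≤-reflexive toℕ-j₀)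
        ; Q⊆P = λ { (τ j) p → p ; (μ j) p → ℕₚ.m<n⇒m<1+n p ; (up (τ j)) p → p
                  ; (up (μ j)) p → p ; (up (up z)) p → p }
        ; P⊆Q = λ { (τ j) p → inj₂ p
                  ; (μ j) (ℕ.s≤s p) → Sum.map (λ e → ≡.cong μ (is-j₀ j e)) id (<-or p)
                  ; (up (τ j)) p → inj₂ p ; (up (μ j)) p → inj₂ p ; (up (up z)) p → inj₂ p }
        ; Q∌ = λ p → ℕₚ.<⇒≢ p toℕ-j₀
        ; minimal = λ e _ ()
        ; M⊆Q = λ { (up (τ j)) (inj₁ e) → ℕₚ.m≤n⇒m≤1+n (ℕₚ.≤-reflexive (≡.trans e toℕ-j₀))
                  ; (up (τ j)) (inj₂ e) → ℕₚ.≤-reflexive (≡.trans e (≡.cong suc toℕ-j₀))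
                  ; (up (up z)) (_ , p) → p }
        ; e₀⊏M = λ { (up (τ j)) p → p ; (up (up z)) (p , _) → inj₂ p }
        ; M⊇ = λ { (up (τ j)) _ p → p ; (up (μ j)) _ p → ⊥-elim (¬last p)
                 ; (up (up z)) _ (inj₁ p) → ⊥-elim (¬last p) ; (up (up z)) q (inj₂ p) → p , q }
        }
        where
        <-or : ∀ {m} → m ℕ.≤ i → m ≡ i ⊎ m ℕ.< i
        <-or p = Sum.swap (ℕₚ.m≤n⇒m<n∨m≡n p)

      A₂ : Attachᴱ ρ WithTau (up (τ j₁)) (Initial i) D
      A₂ = record
        { bounded = λ { (τ j) p → tt ; (μ j) p → inj₂ base ; (up (τ j)) p → base
                      ; (up (μ j)) p → p ; (up (up z)) p → p }
        ; P∋ = ℕₚ.≤-reflexive toℕ-j₁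
        ; Q⊆P = λ { (τ j) p → p ; (μ j) p → p ; (up (τ j)) p → ℕₚ.m≤n⇒m≤1+n p
                  ; (up (μ j)) p → p ; (up (up z)) p → p }
        ; P⊆Q = λ { (τ j) p → inj₂ p ; (μ j) p → inj₂ p
                  ; (up (τ j)) p → Sum.map (λ e → ≡.cong (λ j → up (τ j)) (is-j₁ j e)) id (≤-suc p)
                  ; (up (μ j)) p → inj₂ p ; (up (up z)) p → inj₂ p }
        ; Q∌ = λ p → ℕₚ.<-irrefl refl (≡.subst (ℕ._≤ i) toℕ-j₁ p)
        ; minimal = λ { (τ j) p e → ℕₚ.0≢1+n (≡.trans (≡.cong toℕ (≡.sym e)) toℕ-j₁)
                      ; (μ j) p (inj₁ e) → ℕₚ.<⇒≱ p (≡.subst (i ℕ.≤_) (≡.trans (≡.sym toℕ-j₁) e) (ℕₚ.n≤1+n i))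
                      ; (μ j) p (inj₂ e) → ℕₚ.<⇒≢ p (ℕₚ.suc-injective (≡.trans (≡.sym e) toℕ-j₁))
                      ; (up e) p () }
        ; M⊆Q = λ { (up (up z)) (_ , p) → p }
        ; e₀⊏M = λ { (up (up z)) (p , _) → p }
        ; M⊇ = λ { (up (up z)) q p → p , q ; (up (τ _)) _ () ; (up (μ _)) _ () }
        }

      A₃ : Attachᴱ ρ M⁺ (up (τ j₁)) M D
      A₃ = record
        { bounded = λ { (up (τ j)) p → base ; (up (up z)) (_ , p) → p }
        ; P∋ = inj₂ (≡.trans toℕ-j₁ (≡.cong suc (≡.sym toℕ-j₀)))
        ; Q⊆P = λ { (up (τ j)) refl → inj₁ refl ; (up (up z)) p → p }
        ; P⊆Q = λ { (up (τ j)) (inj₁ e) → inj₂ (Finₚ.toℕ-injective e)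
                  ; (up (τ j)) (inj₂ e) → inj₁ (≡.cong (λ j → up (τ j)) (is-j₁ j (≡.trans e (≡.cong suc toℕ-j₀))))
                  ; (up (up z)) p → inj₂ p }
        ; Q∌ = λ e → ℕₚ.1+n≢n (≡.trans (≡.sym toℕ-j₁) (≡.trans (≡.cong toℕ e) toℕ-j₀))
        ; minimal = λ { (up (τ _)) _ () ; (up (up _)) _ () }
        ; M⊆Q = λ { (up (up z)) p → p }
        ; e₀⊏M = λ { (up (up z)) (p , _) → p }
        ; M⊇ = λ { (up (up z)) p _ → p ; (up (τ _)) _ () }
        }

      A₄ : Attachᴱ ρ WithMu (μ j₀) (Initial i) M
      A₄ = record
        { bounded = λ { (τ j) p → tt ; (μ j) p → inj₂ base ; (up (τ j)) p → base
                      ; (up (μ j)) p → p ; (up (up z)) p → p }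
        ; P∋ = ℕ.s≤s (ℕₚ.≤-reflexive toℕ-j₀)
        ; Q⊆P = λ { (τ j) p → p ; (μ j) p → ℕₚ.m<n⇒m<1+n p ; (up (τ j)) p → p
                  ; (up (μ j)) p → p ; (up (up z)) p → p }
        ; P⊆Q = λ { (τ j) p → inj₂ p
                  ; (μ j) (ℕ.s≤s p) → Sum.map (λ e → ≡.cong μ (is-j₀ j e)) id
                                        (Sum.swap (ℕₚ.m≤n⇒m<n∨m≡n p))
                  ; (up (τ j)) p → inj₂ p ; (up (μ j)) p → inj₂ p ; (up (up z)) p → inj₂ p }
        ; Q∌ = λ p → ℕₚ.<⇒≢ p toℕ-j₀
        ; minimal = λ e _ ()
        ; M⊆Q = λ { (up (τ j)) refl → ℕₚ.≤-reflexive toℕ-j₀ ; (up (up z)) (_ , p) → p }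
        ; e₀⊏M = λ { (up (τ j)) refl → inj₁ refl ; (up (up z)) (p , _) → inj₂ p }
        ; M⊇ = λ { (up (τ j)) _ (inj₁ e) → Finₚ.toℕ-injective e
                 ; (up (τ j)) q (inj₂ e) → ⊥-elim (ℕₚ.<-irrefl refl
                     (ℕₚ.≤-trans (ℕₚ.≤-reflexive (≡.sym (≡.trans e (≡.cong suc toℕ-j₀)))) q))
                 ; (up (μ j)) _ p → ⊥-elim (¬last p)
                 ; (up (up z)) _ (inj₁ p) → ⊥-elim (¬last p) ; (up (up z)) q (inj₂ p) → p , q }
        }

      A₅ : Attachᴱ ρ M (up (τ j₀)) D D
      A₅ = record
        { bounded = λ { (up (τ j)) p → base ; (up (up z)) (_ , p) → p }
        ; P∋ = refl
        ; Q⊆P = λ { (up (up z)) p → p }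
        ; P⊆Q = λ { (up (τ j)) refl → inj₁ refl ; (up (up z)) p → inj₂ p }
        ; Q∌ = λ ()
        ; minimal = λ { (up (τ _)) _ () ; (up (up _)) _ () }
        ; M⊆Q = λ e p → p
        ; e₀⊏M = λ { (up (up z)) (p , _) → p }
        ; M⊇ = λ e p _ → p
        }

      -- Among the elements kept, only `μ i` lies below the new copy `up (τ (i + 1))`, so the pair
      -- can be added at once. The link `M` of `μ i` before that is a cone with apex `up (τ i)`.
      initial-step : Acyclic (⟨ ρ ⟩ (Initial i)) → Acyclic (⟨ ρ ⟩ (Initial (suc i)))
      initial-step = attach-belowᴱ ρ A₁ A₂ A₃ A₄ (coneᴱ ρ A₅)

    initial-acyclic : ∀ i → i ℕ.≤ b → Acyclic (⟨ ρ ⟩ (Initial i))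
    initial-acyclic zero    _   = initial-0
    initial-acyclic (suc i) i<b = initial-step i i<b (initial-acyclic i (ℕₚ.<⇒≤ i<b))

    -- The end `μ b` of the path is the last vertex attached. Of the copies it sees only `up (τ b)`,
    -- so its link is the section of the last copy, one level higher.
    path-sphere : ∀ {N} → Sphere N (⟨ shift ρ ⟩ (λ e → Only (fromℕ b) e × e ⊏ up y)) →
                  Sphere (suc N) (⟨ ρ ⟩ (λ e → Only t e × e ⊏ up (up y)))
    path-sphere S = sphereᴱ ρ {P = λ e → Only t e × e ⊏ up (up y)} {μ (fromℕ b)} {Initial b}
      record
        { bounded = λ e → proj₂
        ; P∋ = tt , inj₂ base
        ; Q⊆P = λ { (τ j) p → p , tt ; (μ j) p → tt , inj₂ base ; (up (τ j)) p → tt , base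
                  ; (up (μ j)) p → tt , p ; (up (up z)) p → tt , p }
        ; P⊆Q = λ { (τ j) (p , _) → inj₂ p
                  ; (μ j) _ → Sum.map (λ e → ≡.cong μ (Finₚ.toℕ-injective
                                (≡.trans e (≡.sym (Finₚ.toℕ-fromℕ b))))) id
                                (Sum.swap (ℕₚ.m≤n⇒m<n∨m≡n (Finₚ.toℕ≤pred[n] j)))
                  ; (up (τ j)) _ → inj₂ (Finₚ.toℕ≤pred[n] j)
                  ; (up (μ j)) (_ , p) → inj₂ p ; (up (up z)) (_ , p) → inj₂ p }
        ; Q∌ = λ p → ℕₚ.<⇒≢ p (Finₚ.toℕ-fromℕ b)
        ; minimal = λ e _ ()
        ; M⊆Q = λ { (up (τ j)) _ → Finₚ.toℕ≤pred[n] j ; (up (μ j)) (_ , p) → p ; (up (up z)) (_ , p) → p }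
        ; e₀⊏M = λ { (up (τ j)) (refl , _) → inj₁ refl
                   ; (up (μ j)) _ → Finₚ.toℕ-fromℕ b ; (up (up z)) _ → inj₁ (Finₚ.toℕ-fromℕ b) }
        ; M⊇ = λ { (up (τ j)) _ (inj₁ e) → Finₚ.toℕ-injective e , base
                 ; (up (τ j)) _ (inj₂ e) → ⊥-elim (ℕₚ.<-irrefl (≡.trans e (≡.cong suc (Finₚ.toℕ-fromℕ b)))
                     (Finₚ.toℕ<n j))
                 ; (up (μ j)) p _ → tt , p ; (up (up z)) p _ → tt , p }
        }
      (shift-sphere ρ {λ e → Only (fromℕ b) e × e ⊏ up y}
        {Up (λ e → Only (fromℕ b) e × e ⊏ up y)} (λ e p → p) (λ { (up e) p → p }) S)
      (initial-acyclic b ℕₚ.≤-refl)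

  last-unique : ∀ {b} (i : Fin (suc b)) → Last i → i ≡ fromℕ b
  last-unique {b} i l = Finₚ.toℕ-injective (≡.trans l (≡.sym (Finₚ.toℕ-fromℕ b)))

  -- If `Only zero y` fails, `y` is a copy other than the first. Then neither a copy of level 1 nor
  -- a `μ` of level 0 other than the last lies below `up (up y)`, and `τ t` and the last `μ` suspend
  -- the rest.
  two-levels-sphere : ∀ {a k L N} {y : E (α (2 + k)) (2 + k)} (ρ : Labelling {a} {k} (up (up y)) L) →
                      Dec (Only zero y) → (∀ t → Sphere N (⟨ shift ρ ⟩ (λ e → Only t e × e ⊏ up y))) →
                      ∀ t → Sphere (suc N) (⟨ ρ ⟩ (λ e → Only t e × e ⊏ up (up y)))
  two-levels-sphere ρ (yes base) S t = Path.path-sphere ρ base t (S (fromℕ _))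
  two-levels-sphere {k = k} {y = y} ρ (no ¬base) S t =
    suspensionᴱ ρ {P = λ e → Only t e × e ⊏ up (up y)} {Up Q} {τ t} {μ (fromℕ _)}
      (λ e → proj₂) (λ ()) (λ ()) (λ ()) (refl , tt) (tt , inj₁ (Finₚ.toℕ-fromℕ _))
      (λ { (up (τ i)) (o , p) → ⊥-elim (¬base p)
         ; (up (μ i)) (o , p) → (tt , p) , tt , Finₚ.toℕ-fromℕ _
         ; (up (up e)) (o , p) → (tt , p) , tt , inj₁ (Finₚ.toℕ-fromℕ _) })
      (λ { (τ j) (refl , _) → inj₁ refl
         ; (μ i) (_ , inj₁ l) → inj₂ (inj₁ (≡.cong μ (last-unique i l)))
         ; (μ i) (_ , inj₂ b) → ⊥-elim (¬base b)
         ; (up (τ i)) (_ , p) → ⊥-elim (¬base p)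
         ; (up (μ i)) (_ , p) → inj₂ (inj₂ (tt , p))
         ; (up (up e)) (_ , p) → inj₂ (inj₂ (tt , p)) })
      -- No copy of level 1 lies below `up (up y)` here, so the section is the same for every index;
      -- `zero` is an arbitrary choice.
      (shift-sphere ρ {Q} {Up Q} (λ e p → p) (λ { (up e) p → p }) (S zero))
    where
    Q : E (α (suc k)) (suc k) → Set
    Q e = Only zero e × e ⊏ up y

  -- Every level below `x` raises the dimension by one. The copy `t` has to be arbitrary, because
  -- the path passes from `t` to the section of the last copy in the next level.
  lower-sphere : ∀ {a k L N} (t : Fin (suc a)) (x : E a k) (ρ : Labelling x L) → Sphere N L →
                 Sphere (level x + N) (⟨ ρ ⟩ (λ e → Only t e × e ⊏ x))
  lower-sphere t (τ j) ρ S = empty-interval ρ (λ e → proj₂) S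
  lower-sphere t (μ j) ρ S = empty-interval ρ (λ e → proj₂) S
  lower-sphere t (up (τ zero)) ρ S =
    suspensionᴱ ρ {P = λ e → Only t e × e ⊏ up (τ zero)} {λ _ → ⊥} {τ t} {μ zero}
      (λ e → proj₂) (λ ()) (λ ()) (λ ()) (refl , refl) (tt , inj₁ refl) (λ _ ())
      (λ { (τ j) (refl , _) → inj₁ refl
         ; (μ zero) _ → inj₂ (inj₁ refl)
         ; (μ (suc j)) (_ , inj₁ ()) ; (μ (suc j)) (_ , inj₂ ()) })
      (empty-interval ρ (λ _ ()) S)
  lower-sphere t (up (τ (suc j))) ρ S =
    suspensionᴱ ρ {P = λ e → Only t e × e ⊏ up (τ (suc j))} {λ _ → ⊥} {μ (suc j)} {μ (inject₁ j)}
      (λ e → proj₂) (λ e → ℕₚ.1+n≢n (≡.trans (≡.cong toℕ (μ-injective e)) (Finₚ.toℕ-inject₁ j))) (λ ()) (λ ())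
      (tt , inj₁ refl) (tt , inj₂ (≡.cong suc (≡.sym (Finₚ.toℕ-inject₁ j)))) (λ _ ())
      (λ { (τ j) (_ , ())
         ; (μ i) (_ , inj₁ e) → inj₁ (≡.cong μ (Finₚ.toℕ-injective (≡.sym e)))
         ; (μ i) (_ , inj₂ e) → inj₂ (inj₁ (≡.cong μ (Finₚ.toℕ-injective
             (≡.trans (≡.sym (ℕₚ.suc-injective e)) (≡.sym (Finₚ.toℕ-inject₁ j)))))) })
      (empty-interval ρ (λ _ ()) S)
  lower-sphere {k = k} t (up (μ i)) ρ S =
    suspensionᴱ ρ {P = λ e → Only t e × e ⊏ up (μ i)} {λ _ → ⊥} {τ t} {μ (fromℕ _)}
      (λ e → proj₂) (λ ()) (λ ()) (λ ()) (refl , tt) (tt , Finₚ.toℕ-fromℕ _) (λ _ ())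
      (λ { (τ j) (refl , _) → inj₁ refl
         ; (μ i) (_ , l) → inj₂ (inj₁ (≡.cong μ (last-unique i l))) })
      (empty-interval ρ (λ _ ()) S)
  lower-sphere t (up (up y)) ρ S =
    two-levels-sphere ρ (only? zero y) (λ t → lower-sphere t (up y) (shift ρ) S) t

  -- What lies above a `τ` or above the last `μ` is a section with one copy, so `lower-sphere`
  -- applies. Above any other `μ i` the two copies `up (τ i)` and `up (τ (i + 1))` suspend the
  -- elements above the split atom. The number `d` counts the levels strictly between `x` and `y`.
  between : ∀ {a k} (x y : E a k) → x ⊏ y → ∃[ d ] d + suc (level x) ≡ level y ×
            (∀ {L N} (ρ : Labelling y L) → Sphere N L → Sphere (d + N) (⟨ ρ ⟩ (λ e → x ⊏ e × e ⊏ y)))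
  between (up x) (up y) p =
    let d , eq , f = between x y p
    in d , ≡.trans (ℕₚ.+-suc d _) (≡.cong suc eq) , λ ρ S →
      shift-sphere ρ {λ e → x ⊏ e × e ⊏ y} {λ e → up x ⊏ e × e ⊏ up y} (λ e p → p)
        (λ { (up e) p → p ; (τ _) (() , _) ; (μ _) (() , _) }) (f (shift ρ) S)
  between (τ j) (up y) p = level y , ℕₚ.+-comm (level y) 1 , λ ρ S →
    shift-sphere ρ {λ e → Only zero e × e ⊏ y} {λ e → τ j ⊏ e × e ⊏ up y} (λ e p → p)
      (λ { (up e) p → p ; (τ _) (() , _) ; (μ _) (() , _) }) (lower-sphere zero y (shift ρ) S)
  between (μ i) (up y) p with last? i
  ... | yes l = level y , ℕₚ.+-comm (level y) 1 , λ ρ S →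
    shift-sphere ρ {λ e → Only (fromℕ _) e × e ⊏ y} {λ e → μ i ⊏ e × e ⊏ up y}
      (λ { (τ j) (refl , q) → inj₁ (≡.trans (Finₚ.toℕ-fromℕ _) (≡.sym l)) , q
         ; (μ j) (_ , q) → l , q ; (up e) (_ , q) → inj₁ l , q })
      (λ { (up (τ j)) (inj₁ e , q) → Finₚ.toℕ-injective (≡.trans e (≡.trans l (≡.sym (Finₚ.toℕ-fromℕ _)))) , q
         ; (up (τ j)) (inj₂ e , q) → ⊥-elim (ℕₚ.<-irrefl (≡.trans e (≡.cong suc l)) (Finₚ.toℕ<n j))
         ; (up (μ j)) (_ , q) → tt , q
         ; (up (up e)) (_ , q) → tt , q
         ; (τ _) (() , _) ; (μ _) (() , _) })
      (lower-sphere (fromℕ _) y (shift ρ) S)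
  between (μ i) (up (τ j)) p | no _ = 0 , refl , λ ρ S →
    empty-interval ρ (λ { (up e) (_ , ()) ; (τ _) (() , _) ; (μ _) (() , _) }) S
  between (μ i) (up (μ j)) p | no ¬l = ⊥-elim (¬l p)
  between (μ i) (up (up y)) (inj₁ l) | no ¬l = ⊥-elim (¬l l)
  between {k = k} (μ i) (up (up y)) (inj₂ base) | no ¬l = suc (level y) , ℕₚ.+-comm (suc (level y)) 1 , λ ρ S →
    suspensionᴱ ρ {P = λ e → μ i ⊏ e × e ⊏ up (up y)} {Up (Up Q)} {up (τ i)} {up (τ i⁺)}
      (λ e → proj₂) (λ { eq → ℕₚ.1+n≢n (≡.trans (≡.sym toℕ-i⁺) (≡.cong toℕ (≡.sym (τ-injective (up-injective eq))))) })
      (λ ()) (λ ())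
      (inj₁ refl , base) (inj₂ toℕ-i⁺ , base)
      (λ { (up (up z)) (o , p) → (inj₂ o , p) , o , o })
      (λ { (up (τ j)) (inj₁ e , _) → inj₁ (≡.cong (λ j → up (τ j)) (Finₚ.toℕ-injective e))
         ; (up (τ j)) (inj₂ e , _) → inj₂ (inj₁ (≡.cong (λ j → up (τ j))
             (Finₚ.toℕ-injective (≡.trans e (≡.sym toℕ-i⁺)))))
         ; (up (μ j)) (l , _) → ⊥-elim (¬l l)
         ; (up (up z)) (inj₁ l , _) → ⊥-elim (¬l l)
         ; (up (up z)) (inj₂ o , p) → inj₂ (inj₂ (o , p))
         ; (τ _) (() , _) ; (μ _) (() , _) })
      (shift-sphere ρ {Up Q} {Up (Up Q)} (λ e p → p) (λ { (up e) p → p })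
        (shift-sphere (shift ρ) {Q} {Up Q} (λ e p → p) (λ { (up e) p → p })
          (lower-sphere zero y (shift (shift ρ)) S)))
    where
    Q : E (α (2 + k)) (2 + k) → Set
    Q z = Only zero z × z ⊏ y
    i<b : toℕ i ℕ.< α (suc k)
    i<b = ℕₚ.≤∧≢⇒< (Finₚ.toℕ≤pred[n] i) ¬l
    i⁺ : Fin (suc (α (suc k)))
    i⁺ = fromℕ< (ℕ.s≤s i<b)
    toℕ-i⁺ : toℕ i⁺ ≡ suc (toℕ i)
    toℕ-i⁺ = Finₚ.toℕ-fromℕ< (ℕ.s≤s i<b)

  Comparable : ∀ {a k} → E a k → E a k → Set
  Comparable e f = e ⊏ f ⊎ f ⊏ e

  module Links {a k} {y : E a k} (ρ : Labelling y (λ _ → ⊥)) where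

    open Labelling ρ hiding (⟨_⟩)

    Link : (E a k → Set) → List (E a k) → Vertex → Set
    Link P es v = ∃[ e ] (P e × e ⊏ y × All (Comparable e) es) × Label v e

    -- The part of the link above `x` takes the role of `L` while the interval below `x` is added.
    lower : ∀ {x es} → x ⊏ y → Labelling x (Link (x ⊏_) es)
    lower {x} x⊏y = record
      { Label = Label ; functional = functional ; injective = injective
      ; reflects = reflects ; preserves = preserves
      ; total = λ e⊏x → total (⊏-trans _ x y e⊏x x⊏y)
      ; below = λ { {e = e} e⊏x l (f , (x⊏f , _) , l′) → preserves l l′ (⊏-trans e x f e⊏x x⊏f) }
      }

    -- An element comparable with `x` lies on one side of it. Those below `x` are automatically
    -- comparable with `es`, which lies above `x`, so the link is the join of a lower interval and
    -- the link already built.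
    glue : ∀ {N x es} {P : E a k → Set} (x⊏y : x ⊏ y) → All (x ⊏_) es → (∀ {e} → x ⊏ e → P e) →
           Sphere N (⟨ lower {x} {es} x⊏y ⟩ (λ e → P e × e ⊏ x)) → Sphere N (Link P (x ∷ es))
    glue {x = x} {es} {P} x⊏y x⊏ up-closed = Sphere-resp
      (λ { (inj₁ (e , (p , e⊏x) , l)) →
             e , (p , ⊏-trans e x y e⊏x x⊏y , inj₁ e⊏x ∷ All.map (λ {f} x⊏f → inj₁ (⊏-trans e x f e⊏x x⊏f)) x⊏) , l
         ; (inj₂ (e , (x⊏e , e⊏y , c) , l)) → e , (up-closed x⊏e , e⊏y , inj₂ x⊏e ∷ c) , l })
      (λ { (e , (p , e⊏y , inj₁ e⊏x ∷ c) , l) → inj₁ (e , (p , e⊏x) , l)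
         ; (e , (p , e⊏y , inj₂ x⊏e ∷ c) , l) → inj₂ (e , (x⊏e , e⊏y , c) , l) })

    whole : ∀ {N} {P : E a k → Set} → Sphere N (⟨ ρ ⟩ (λ e → P e × e ⊏ y)) → Sphere N (Link P [])
    whole = Sphere-resp (λ { (inj₁ (e , (p , q) , l)) → e , (p , q , []) , l })
                        (λ { (e , (p , q , []) , l) → inj₁ (e , (p , q) , l) })

    no-labels : Sphere 0 (λ (_ : Vertex) → ⊥)
    no-labels = empty-sphere λ ()

    upper-link : ∀ x es → AllPairs _⊏_ (x ∷ es) → All (_⊏ y) (x ∷ es) →
                 ∃[ N ] N + length es + suc (level x) ≡ level y × Sphere N (Link (x ⊏_) es)
    upper-link x [] _ (x⊏y ∷ _) =
      let d , eq , f = between x y x⊏y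
      in d + 0 , ≡.trans (≡.cong (_+ suc (level x)) (≡.trans (ℕₚ.+-identityʳ (d + 0)) (ℕₚ.+-identityʳ d))) eq ,
         whole {P = x ⊏_} (f ρ no-labels)
    upper-link x (e ∷ es) ((x⊏e ∷ _) ∷ inc@(e⊏ ∷ _)) (x⊏y ∷ bs@(e⊏y ∷ _)) =
      -- The recursion settles the link above `e` first; the interval between `x` and `e` is then
      -- put below it.
      let N , eq , S = upper-link e es inc bs
          d , eq′ , f = between x e x⊏e
      in d + N , arithmetic d N (length es) eq′ eq ,
         glue {P = x ⊏_} e⊏y e⊏ (λ {f} → ⊏-trans x e f x⊏e) (f (lower e⊏y) S)
      where
      arithmetic : ∀ d N l {m n} → d + suc (level x) ≡ m → N + l + suc m ≡ n → d + N + suc l + suc (level x) ≡ n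
      arithmetic d N l {m} {n} refl refl = solve 4
        (λ d N l x → d :+ N :+ (con 1 :+ l) :+ x := N :+ l :+ (con 1 :+ (d :+ x))) refl d N l (suc (level x))
        where open ℕSolver.+-*-Solver

    -- With a single τ in level 0, Only t holds of every element.
    whole-link : ∀ t → (∀ e → Only t e) → ∀ es → AllPairs _⊏_ es → All (_⊏ y) es →
                 ∃[ N ] N + length es ≡ level y × Sphere N (Link (λ _ → ⊤) es)
    whole-link t only [] _ _ = level y + 0 ,
      ≡.trans (ℕₚ.+-identityʳ _) (ℕₚ.+-identityʳ _) ,
      whole {P = λ _ → ⊤} (⟨⟩-sphere ρ (λ e (_ , p) → tt , p) (λ e (_ , p) → only e , p)
        (lower-sphere t y ρ no-labels))
    whole-link t only (e ∷ es) inc@(e⊏ ∷ _) bs@(e⊏y ∷ _) =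
      let N , eq , S = upper-link e es inc bs
      in level e + N , ≡.trans (arithmetic (level e) N (length es)) eq ,
         glue {P = λ _ → ⊤} e⊏y e⊏ (λ _ → tt)
           (⟨⟩-sphere (lower e⊏y) (λ e (_ , p) → tt , p) (λ e (_ , p) → only e , p)
             (lower-sphere t e (lower e⊏y) S))
      where
      arithmetic : ∀ e N l → e + N + suc l ≡ N + l + suc e
      arithmetic = solve 3 (λ e N l → e :+ N :+ (con 1 :+ l) := N :+ l :+ (con 1 :+ e)) refl
        where open ℕSolver.+-*-Solver

-- The finite posets

module _ {A B : Set} (R : A → B → Set) (left-unique : ∀ {x x′ y} → R x y → R x′ y → x ≡ x′) where

  -- The pigeonhole principle: the partner of the first entry is removed from `ys`, and left
  -- uniqueness keeps it from being the partner of a later entry. Used in both directions it shows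
  -- that two enumerations have equal length.
  length-≤ : ∀ {xs : List A} (ys : List B) → Unique xs → (∀ {x} → x ∈ xs → ∃[ y ] y ∈ ys × R x y) →
             length xs ℕ.≤ length ys
  length-≤ {[]}     ys _         _ = ℕ.z≤n
  length-≤ {x ∷ xs} ys (x∉ ∷ u) f with f (here refl)
  ... | y , y∈ , xRy with ∈-∃++ y∈
  ...   | as , bs , refl = ℕₚ.≤-trans (ℕ.s≤s (length-≤ (as ++ bs) u f′)) (ℕₚ.≤-reflexive
    (≡.trans (≡.cong suc (length-++ as)) (≡.trans (≡.sym (ℕₚ.+-suc (length as) (length bs)))
      (≡.sym (length-++ as)))))
    where
    f′ : ∀ {x′} → x′ ∈ xs → ∃[ y′ ] y′ ∈ as ++ bs × R x′ y′
    f′ x′∈ with f (there x′∈)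
    ... | y′ , y′∈ , x′Ry′ with ∈-++⁻ as y′∈
    ...   | inj₁ ∈as         = y′ , ∈-++⁺ˡ ∈as , x′Ry′
    ...   | inj₂ (there ∈bs) = y′ , ∈-++⁺ʳ as ∈bs , x′Ry′
    ...   | inj₂ (here refl) = ⊥-elim (All.lookup x∉ x′∈ (left-unique xRy x′Ry′))

module _ {A : Set} {P : A → Set} (P? : ∀ x → Dec (P x)) where

  refineList : List A → List [ x ∈ A ∣ P x ]
  refineList []       = []
  refineList (x ∷ xs) with P? x
  ... | yes p = (x , [ p ]) ∷ refineList xs
  ... | no  _ = refineList xs

  ∈-refineList : ∀ xs (y : [ x ∈ A ∣ P x ]) → value y ∈ xs → y ∈ refineList xs
  ∈-refineList (x ∷ xs) (y , [ p ]) y∈ with P? x | y∈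
  ... | yes _ | here refl = here refl
  ... | yes _ | there y∈′ = there (∈-refineList xs (y , [ p ]) y∈′)
  ... | no ¬p | here refl = ⊥-elim (¬p (recompute (P? x) p))
  ... | no _  | there y∈′ = ∈-refineList xs (y , [ p ]) y∈′

  All-refineList : ∀ {ℓ} {Q : A → Set ℓ} {xs} → All Q xs → All (Q ∘ value) (refineList xs)
  All-refineList []                  = []
  All-refineList {xs = x ∷ xs} (q ∷ qs) with P? x
  ... | yes _ = q ∷ All-refineList qs
  ... | no  _ = All-refineList qs

  Unique-refineList : ∀ {xs} → Unique xs → Unique (refineList xs)
  Unique-refineList []                  = []
  Unique-refineList {x ∷ xs} (x∉ ∷ u) with P? x
  ... | yes _ = All.map (λ ≢ → λ { refl → ≢ refl }) (All-refineList x∉) ∷ Unique-refineList u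
  ... | no  _ = Unique-refineList u

module _ {A : Set} {_∼_ : A → A → Set} where

  All-interleaving : ∀ {P : A → Set} {F G H} → Interleaving F G H → All P F → All P G → All P H
  All-interleaving []        _        _        = []
  All-interleaving (consˡ i) (p ∷ ps) qs       = p ∷ All-interleaving i ps qs
  All-interleaving (consʳ i) ps       (q ∷ qs) = q ∷ All-interleaving i ps qs

  All-interleavingʳ : ∀ {P : A → Set} {F G H} → Interleaving F G H → All P H → All P G
  All-interleavingʳ []        _        = []
  All-interleavingʳ (consˡ i) (p ∷ ps) = All-interleavingʳ i ps
  All-interleavingʳ (consʳ i) (p ∷ ps) = p ∷ All-interleavingʳ i ps

  All-interleavingˡ : ∀ {P : A → Set} {F G H} → Interleaving F G H → All P H → All P F
  All-interleavingˡ []        _        = []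
  All-interleavingˡ (consˡ i) (p ∷ ps) = p ∷ All-interleavingˡ i ps
  All-interleavingˡ (consʳ i) (p ∷ ps) = All-interleavingˡ i ps

  interleaving-comparable : ∀ {F G H} → Interleaving F G H → AllPairs _∼_ H →
                            All (λ g → All (λ f → g ∼ f ⊎ f ∼ g) F) G
  interleaving-comparable []        _        = []
  interleaving-comparable (consˡ i) (f∼ ∷ h) = All.zipWith (λ (f∼g , c) → inj₂ f∼g ∷ c)
    (All-interleavingʳ i f∼ , interleaving-comparable i h)
  interleaving-comparable (consʳ i) (g∼ ∷ h) =
    All.map inj₁ (All-interleavingˡ i g∼) ∷ interleaving-comparable i h

  -- Converse to `interleaving-comparable`: comparing heads merges two chains whose members are
  -- pairwise comparable. This turns a set of link vertices into a face of the link.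
  merge : (∀ {x y z} → x ∼ y → y ∼ z → x ∼ z) → ∀ F G → AllPairs _∼_ F → AllPairs _∼_ G →
          All (λ g → All (λ f → g ∼ f ⊎ f ∼ g) F) G → ∃[ H ] Interleaving F G H × AllPairs _∼_ H
  merge tr []      G       _ g _ = G , right G , g
    where
    right : ∀ G → Interleaving [] G G
    right []      = []
    right (x ∷ G) = consʳ (right G)
  merge tr (f ∷ F) []      p _ _ = f ∷ F , Interleaving-emptyʳ (f ∷ F) , p
  merge tr (f ∷ F) (g ∷ G) (f∼ ∷ p) (g∼ ∷ q) ((inj₁ g∼f ∷ cs) ∷ c) =
    let H , i , h = merge tr (f ∷ F) G (f∼ ∷ p) q c
    in g ∷ H , consʳ i , All-interleaving i (g∼f ∷ All.map (tr g∼f) f∼) g∼ ∷ h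
  merge tr (f ∷ F) (g ∷ G) (f∼ ∷ p) (g∼ ∷ q) ((inj₂ f∼g ∷ cs) ∷ c) =
    let H , i , h = merge tr F (g ∷ G) p (g∼ ∷ q) (cs ∷ All.map (λ { (_ ∷ cs) → cs }) c)
    in f ∷ H , consˡ i , All-interleaving i f∼ (f∼g ∷ All.map (tr f∼g) g∼) ∷ h

module TowerPoset (α : ℕ → ℕ) where

  open import Data.Nat using (_+_)
  open Tower α

  E₀ : Set
  E₀ = E 0 0

  bottoms : ∀ a k → List (E a k)
  bottoms a k = map τ (allFin _) ++ map μ (allFin _)

  enumerate : ∀ a k → ℕ → List (E a k)
  enumerate a k zero    = []
  enumerate a k (suc d) = bottoms a k ++ map up (enumerate _ _ d)

  ∈-enumerate : ∀ {a k} d (x : E a k) → level x ℕ.< d → x ∈ enumerate a k d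
  ∈-enumerate (suc d) (τ j)  _           = ∈-++⁺ˡ (∈-++⁺ˡ (∈-map⁺ τ (∈-allFin j)))
  ∈-enumerate (suc d) (μ j)  _           = ∈-++⁺ˡ (∈-++⁺ʳ (map τ (allFin _)) (∈-map⁺ μ (∈-allFin j)))
  ∈-enumerate (suc d) (up x) (ℕ.s≤s x<d) = ∈-++⁺ʳ (bottoms _ _) (∈-map⁺ up (∈-enumerate d x x<d))

  bottoms-unique : ∀ a k → Unique (bottoms a k)
  bottoms-unique a k = Uniqueₚ.++⁺ (Uniqueₚ.map⁺ τ-injective (Uniqueₚ.allFin⁺ _))
    (Uniqueₚ.map⁺ μ-injective (Uniqueₚ.allFin⁺ _)) disjoint
    where
    disjoint : Disjoint (map (τ {a} {k}) (allFin _)) (map μ (allFin _))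
    disjoint (p , q) with ∈-map⁻ τ p | ∈-map⁻ μ q
    ... | _ , _ , refl | _ , _ , ()

  bottoms-level : ∀ {a k} {x : E a k} → x ∈ bottoms a k → level x ≡ 0
  bottoms-level {a} {k} x∈ with ∈-++⁻ (map τ (allFin (suc a))) x∈
  ... | inj₁ p with ∈-map⁻ τ p
  ...   | _ , _ , refl = refl
  bottoms-level {a} {k} x∈ | inj₂ q with ∈-map⁻ μ q
  ...   | _ , _ , refl = refl

  enumerate-unique : ∀ a k d → Unique (enumerate a k d)
  enumerate-unique a k zero    = []
  enumerate-unique a k (suc d) = Uniqueₚ.++⁺ (bottoms-unique a k)
    (Uniqueₚ.map⁺ up-injective (enumerate-unique _ _ d)) disjoint
    where
    disjoint : Disjoint (bottoms a k) (map up (enumerate _ _ d))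
    disjoint (p , q) with ∈-map⁻ up q | bottoms-level p
    ... | _ , _ , refl | ()

  -- The last `μ` of level `n`. Below it, for positive `n`, level `n - 1` keeps all its `τ`s but
  -- only its last `μ`.
  top : ∀ {a k} → ℕ → E a k
  top zero    = μ (fromℕ _)
  top (suc n) = up (top n)

  level-top : ∀ {a k} n → level (top {a} {k} n) ≡ n
  level-top zero    = refl
  level-top (suc n) = ≡.cong suc (level-top n)

  top⊏top : ∀ {a k} n → top {a} {k} n ⊏ top (suc n)
  top⊏top zero    = Finₚ.toℕ-fromℕ _
  top⊏top (suc n) = top⊏top n

  ⊏top⇒level< : ∀ {a k} n (x : E a k) → x ⊏ top n → level x ℕ.< n
  ⊏top⇒level< n x p = ≡.subst (level x ℕ.<_) (level-top n) (⊏⇒level< x (top n) p)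

  infix 4 _⊏⁰_
  _⊏⁰_ : Maybe E₀ → Maybe E₀ → Set
  _       ⊏⁰ nothing = ⊥
  nothing ⊏⁰ just _  = ⊤
  just x  ⊏⁰ just y  = x ⊏ y

  ⊏⁰-irrefl : ∀ x → ¬ x ⊏⁰ x
  ⊏⁰-irrefl (just x) = ⊏-irrefl x

  ⊏⁰-trans : ∀ x y z → x ⊏⁰ y → y ⊏⁰ z → x ⊏⁰ z
  ⊏⁰-trans nothing  (just _) (just _) _ _ = tt
  ⊏⁰-trans (just x) (just y) (just z) p q = ⊏-trans x y z p q

  _⊏⁰?_ : ∀ x y → Dec (x ⊏⁰ y)
  _       ⊏⁰? nothing = no λ ()
  nothing ⊏⁰? just _  = yes tt
  just x  ⊏⁰? just y  = x ⊏? y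

  poset : ℕ → FinitePoset
  poset n = record
    { Carrier           = C
    ; _≤ₚ_              = ToNonStrict._≤_ _≡_ _<_
    ; isDecPartialOrder = record
      { isPartialOrder = ToNonStrict.isPartialOrder _≡_ _<_ record
        { isEquivalence = ≡.isEquivalence
        ; irrefl        = λ { {x} refl → ⊏⁰-irrefl (ι x) }
        ; trans         = λ {x} {y} {z} → ⊏⁰-trans (ι x) (ι y) (ι z)
        ; <-resp-≈      = ≡.resp₂ _<_
        }
      ; _≟_  = _≟_
      ; _≤?_ = ToNonStrict.decidable _≡_ _<_ _≟_ λ x y → ι x ⊏⁰? ι y
      }
    ; elements          = nothing ∷ map just (refineList (_⊏? top n) (enumerate 0 0 n))
    ; elements-complete = λ
      { nothing  → here refl
      ; (just x) → there (∈-map⁺ just (∈-refineList (_⊏? top n) _ x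
          (∈-enumerate n (value x) (⊏top⇒level< n (value x) (below x)))))
      }
    ; elements-unique   = Allₚ.map⁺ (All.universal (λ _ ()) _) ∷
        Uniqueₚ.map⁺ Maybeₚ.just-injective (Unique-refineList (_⊏? top n) (enumerate-unique 0 0 n))
    ; 0̂                 = nothing
    ; 0̂-minimum         = λ { nothing → inj₂ refl ; (just _) → inj₁ tt }
    }
    where
    C : Set
    C = Maybe [ x ∈ E₀ ∣ x ⊏ top n ]
    ι : C → Maybe E₀
    ι = Maybe.map value
    _<_ : C → C → Set
    x < y = ι x ⊏⁰ ι y
    _≟_ : (x y : C) → Dec (x ≡ y)
    _≟_ = Maybeₚ.≡-dec (Data.Refinement._≟_ _≟ᴱ_)
    below : (x : [ x ∈ E₀ ∣ x ⊏ top n ]) → value x ⊏ top n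
    below (x , [ p ]) = recompute (x ⊏? top n) p

  -- Identifies the nonzero elements of `P` with the elements below `top n`. Both `poset n` and the
  -- boundary of the facet in `poset (suc n)` have such a presentation, so one computation of ranks
  -- and cd-index serves for both.
  record Presentation (P : FinitePoset) (n : ℕ) : Set where
    open FinitePoset P
    field
      ι           : Carrier → Maybe E₀
      ι-injective : ∀ {x y} → ι x ≡ ι y → x ≡ y
      ι-0̂         : ι 0̂ ≡ nothing
      <⇒⊏         : ∀ {x y} → x <ₚ y → ι x ⊏⁰ ι y
      ⊏⇒<         : ∀ {x y} → ι x ⊏⁰ ι y → x <ₚ y
      bounded     : ∀ {x e} → ι x ≡ just e → e ⊏ top n
      onto        : ∀ {e} → e ⊏ top n → ∃[ x ] ι x ≡ just e

  map-value-injective : ∀ {A : Set} {P : A → Set} {x y : Maybe [ a ∈ A ∣ P a ]} →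
                        Maybe.map value x ≡ Maybe.map value y → x ≡ y
  map-value-injective {x = nothing} {nothing} _ = refl
  map-value-injective {x = just x}  {just y}  e = ≡.cong just (value-injective (Maybeₚ.just-injective e))

  poset-presentation : ∀ n → Presentation (poset n) n
  poset-presentation n = record
    { ι           = Maybe.map value
    ; ι-injective = map-value-injective
    ; ι-0̂         = refl
    ; <⇒⊏         = λ { (inj₁ p , _) → p ; (inj₂ e , ≢) → ⊥-elim (≢ e) }
    ; ⊏⇒<         = λ {x} p → inj₁ p , λ { refl → ⊏⁰-irrefl (Maybe.map value x) p }
    ; bounded     = λ { {just (x , [ p ])} refl → recompute (x ⊏? top n) p }
    ; onto        = λ {e} p → just (e , [ p ]) , refl
    }

  facet : ∀ n → FinitePoset.Carrier (poset (suc n))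
  facet n = just (top n , [ top⊏top n ])

  facet≢0̂ : ∀ n → facet n ≢ FinitePoset.0̂ (poset (suc n))
  facet≢0̂ n ()

  ∂facet-presentation : ∀ n → Presentation (∂ₚ (poset (suc n)) (facet n) (facet≢0̂ n)) n
  ∂facet-presentation n = record
    { ι           = Maybe.map value ∘ value
    ; ι-injective = value-injective ∘ map-value-injective
    ; ι-0̂         = refl
    ; <⇒⊏         = λ { (inj₁ p , _) → p ; (inj₂ e , ≢) → ⊥-elim (≢ (value-injective e)) }
    ; ⊏⇒<         = λ {x} p → inj₁ p , λ { refl → ⊏⁰-irrefl (Maybe.map value (value x)) p }
    ; bounded     = λ
      { {just (x , _) , [ p ]} refl → recompute (x ⊏? top n) (below p) }
    ; onto        = λ {e} p → (just (e , [ ⊏-trans e (top n) (top (suc n)) p (top⊏top n) ]) ,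
                                [ (inj₁ p , λ { refl → ⊏-irrefl e p }) ]) , refl
    }
    where
    open FinitePoset (poset (suc n)) using (_<ₚ_)
    below : ∀ {x} .{q} → just (x , [ q ]) <ₚ facet n → x ⊏ top n
    below (inj₁ p , _) = p
    below (inj₂ e , ≢) = ⊥-elim (≢ e)

  chain-length-last : ∀ {a k} {x : E a k} {es e} → AllPairs _⊏_ (x ∷ es) → last (x ∷ es) ≡ just e →
                      length es + level x ℕ.≤ level e
  chain-length-last {es = []}     _                refl = ℕₚ.≤-refl
  chain-length-last {x = x} {es = f ∷ es} ((x⊏f ∷ _) ∷ c) eq   = ℕₚ.≤-trans
    (ℕₚ.≤-reflexive (≡.sym (ℕₚ.+-suc (length es) (level x))))
    (ℕₚ.≤-trans (ℕₚ.+-monoʳ-≤ (length es) (⊏⇒level< x f x⊏f)) (chain-length-last c eq))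

  chain-length : ∀ {a k} {y : E a k} {es} → AllPairs _⊏_ es → All (_⊏ y) es → length es ℕ.≤ level y
  chain-length {es = []} _ _ = ℕ.z≤n
  chain-length {y = y} {es = x ∷ es} c b = ℕₚ.≤-trans (ℕ.s≤s (ℕₚ.m≤m+n (length es) (level x))) (go c b)
    where
    go : ∀ {x es} → AllPairs _⊏_ (x ∷ es) → All (_⊏ y) (x ∷ es) → length es + level x ℕ.< level y
    go {x} {[]}     _                (x⊏y ∷ _) = ⊏⇒level< x y x⊏y
    go {x} {f ∷ es} ((x⊏f ∷ _) ∷ c) (_ ∷ b)   = ℕₚ.≤-<-trans
      (ℕₚ.≤-trans (ℕₚ.≤-reflexive (≡.sym (ℕₚ.+-suc (length es) (level x))))
                  (ℕₚ.+-monoʳ-≤ (length es) (⊏⇒level< x f x⊏f)))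
      (go c b)

  -- A chain ending in `e` that uses each level up to that of `e` once: it shows that the bound of
  -- `chain-length-last` is attained.
  record Saturated {a k} (e : E a k) : Set where
    field
      {head}       : E a k
      {tail}       : List (E a k)
      linked       : Linked _⊏_ (head ∷ tail)
      ends         : last (head ∷ tail) ≡ just e
      length-tail  : length tail ≡ level e
      level-head   : level head ≡ 0

  lower-cover : ∀ {a k} (x : E (α (suc k)) (suc k)) → level x ≡ 0 → ∃[ y ] y ⊏ up {a} x × level y ≡ 0
  lower-cover (τ zero)    _ = τ zero , refl , refl
  -- A copy other than the first does not lie above any `τ`, so one of its two `μ`s has to be taken.
  lower-cover (τ (suc j)) _ = μ (suc j) , inj₁ refl , refl
  lower-cover (μ i)       _ = τ zero , tt , refl

  saturated : ∀ {a k} (e : E a k) → Saturated e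
  saturated (τ j)  = record { head = τ j ; linked = [-] ; ends = refl ; length-tail = refl ; level-head = refl }
  saturated (μ i)  = record { head = μ i ; linked = [-] ; ends = refl ; length-tail = refl ; level-head = refl }
  saturated (up e) =
    let y , y⊏ , level-y = lower-cover head level-head
    in record
    { head        = y
    ; tail        = map up (head ∷ tail)
    ; linked      = y⊏ ∷ Linkedₚ.map⁺ linked
    ; ends        = ≡.trans (last-map up (head ∷ tail)) (≡.cong (Maybe.map up) ends)
    ; length-tail = ≡.cong suc (≡.trans (length-map up tail) length-tail)
    ; level-head  = level-y
    }
    where open Saturated (saturated e)

  below-last : ∀ {a k} {es : List (E a k)} {e} → AllPairs _⊏_ es → last es ≡ just e →
               All (λ f → f ⊏ e ⊎ f ≡ e) es
  below-last {es = x ∷ []}     _        refl = inj₂ refl ∷ []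
  below-last {es = x ∷ f ∷ es} {e} ((x⊏f ∷ _) ∷ c) eq with below-last c eq
  ... | bs@(inj₁ f⊏e ∷ _)  = inj₁ (⊏-trans x f e x⊏f f⊏e) ∷ bs
  ... | bs@(inj₂ refl ∷ _) = inj₁ x⊏f ∷ bs

  module Presented {P n} (pres : Presentation P n) where

    open FinitePoset P
    open Presentation pres

    Corr : List Carrier → List E₀ → Set
    Corr = Pointwise (λ x e → ι x ≡ just e)

    ι-≢0̂ : ∀ {x} → x ≢ 0̂ → ∃[ e ] ι x ≡ just e
    ι-≢0̂ {x} x≢0̂ with ι x in eq
    ... | just e  = e , refl
    ... | nothing = ⊥-elim (x≢0̂ (ι-injective (≡.trans eq (≡.sym ι-0̂))))

    ι-just : ∀ {x e} → ι x ≡ just e → x ≢ 0̂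
    ι-just eq refl with () ← ≡.trans (≡.sym eq) ι-0̂

    ⊏-of-< : ∀ {x y e f} → ι x ≡ just e → ι y ≡ just f → x <ₚ y → e ⊏ f
    ⊏-of-< p q x<y = ≡.subst₂ _⊏⁰_ p q (<⇒⊏ x<y)

    <-of-⊏ : ∀ {x y e f} → ι x ≡ just e → ι y ≡ just f → e ⊏ f → x <ₚ y
    <-of-⊏ p q e⊏f = ⊏⇒< (≡.subst₂ _⊏⁰_ (≡.sym p) (≡.sym q) e⊏f)

    corr : ∀ {C} → All (_≢ 0̂) C → ∃[ es ] Corr C es
    corr []       = [] , []
    corr (p ∷ ps) = let e , eq = ι-≢0̂ p ; es , c = corr ps in e ∷ es , eq ∷ c

    corr⁻¹ : ∀ {es} → All (_⊏ top n) es → ∃[ C ] Corr C es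
    corr⁻¹ []       = [] , []
    corr⁻¹ (p ∷ ps) = let x , eq = onto p ; C , c = corr⁻¹ ps in x ∷ C , eq ∷ c

    corr-unique : ∀ {C D es} → Corr C es → Corr D es → C ≡ D
    corr-unique []       []       = refl
    corr-unique (p ∷ ps) (q ∷ qs) = ≡.cong₂ _∷_ (ι-injective (≡.trans p (≡.sym q))) (corr-unique ps qs)

    corr-functional : ∀ {C es fs} → Corr C es → Corr C fs → es ≡ fs
    corr-functional []       []       = refl
    corr-functional (p ∷ ps) (q ∷ qs) =
      ≡.cong₂ _∷_ (Maybeₚ.just-injective (≡.trans (≡.sym p) q)) (corr-functional ps qs)

    corr-All : ∀ {p q} {Q : Carrier → Set p} {R : E₀ → Set q} {C es} →
               (∀ {x e} → ι x ≡ just e → Q x → R e) → Corr C es → All Q C → All R es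
    corr-All f []       []       = []
    corr-All f (p ∷ ps) (q ∷ qs) = f p q ∷ corr-All f ps qs

    corr-All⁻¹ : ∀ {p q} {Q : Carrier → Set p} {R : E₀ → Set q} {C es} →
                 (∀ {x e} → ι x ≡ just e → R e → Q x) → Corr C es → All R es → All Q C
    corr-All⁻¹ f []       []       = []
    corr-All⁻¹ f (p ∷ ps) (q ∷ qs) = f p q ∷ corr-All⁻¹ f ps qs

    corr-bounded : ∀ {C es} → Corr C es → All (_⊏ top n) es
    corr-bounded []       = []
    corr-bounded (p ∷ ps) = bounded p ∷ corr-bounded ps

    corr-AllPairs : ∀ {C es} → Corr C es → AllPairs _<ₚ_ C → AllPairs _⊏_ es
    corr-AllPairs []       []       = []
    corr-AllPairs (p ∷ ps) (q ∷ qs) = corr-All (λ r → ⊏-of-< p r) ps q ∷ corr-AllPairs ps qs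

    corr-IsChain : ∀ {C es} → Corr C es → AllPairs _⊏_ es → IsChain C
    corr-IsChain []       []       = [] , []
    corr-IsChain (p ∷ ps) (q ∷ qs) = let inc , ≢0̂ = corr-IsChain ps qs in
      corr-All⁻¹ (λ r → <-of-⊏ p r) ps q ∷ inc , ι-just p ∷ ≢0̂

    corr-last : ∀ {C es x e} → Corr C es → ι x ≡ just e → last C ≡ just x → last es ≡ just e
    corr-last (p ∷ [])         q refl = ≡.trans (≡.sym p) q
    corr-last (p ∷ ps@(_ ∷ _)) q eq   = corr-last ps q eq

    corr-last⁻¹ : ∀ {C es x e} → Corr C es → ι x ≡ just e → last es ≡ just e → last C ≡ just x
    corr-last⁻¹ (p ∷ [])         q refl = ≡.cong just (ι-injective (≡.trans p (≡.sym q)))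
    corr-last⁻¹ (p ∷ ps@(_ ∷ _)) q eq   = corr-last⁻¹ ps q eq

    <ₚ-trans : ∀ {x y z} → x <ₚ y → y <ₚ z → x <ₚ z
    <ₚ-trans {x} {y} {z} p q = ⊏⇒< (⊏⁰-trans (ι x) (ι y) (ι z) (<⇒⊏ p) (<⇒⊏ q))

    chain-unique : ∀ {C} → AllPairs _<ₚ_ C → Unique C
    chain-unique = AllPairs.map proj₂

    words-length : ∀ {k C} → C ∈ words k → length C ≡ k
    words-length {zero}  (here refl) = refl
    words-length {suc k} C∈ with ∈-cartesianProductWith⁻ _∷_ elements (words k) C∈
    ... | _ , _ , _ , D∈ , refl = ≡.cong suc (words-length D∈)

    ∈-words : ∀ C → C ∈ words (length C)
    ∈-words []      = here refl
    ∈-words (x ∷ C) = ∈-cartesianProductWith⁺ _∷_ (elements-complete x) (∈-words C)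

    words-unique : ∀ k → Unique (words k)
    words-unique zero    = [] ∷ []
    words-unique (suc k) = Uniqueₚ.cartesianProductWith⁺ _∷_ (λ { refl → refl , refl }) elements-unique (words-unique k)

    ∈-chains : ∀ {C} → IsChain C → C ∈ chains
    ∈-chains {C} ch@(inc , _) = ∈-concatMap⁺ (λ k → filter isChain? (words k))
      (Any.map (λ { refl → ∈-filter⁺ isChain? (∈-words C) ch }) (∈-upTo⁺ (ℕ.s≤s
        (length-≤ _≡_ (λ { refl refl → refl }) elements (chain-unique inc) λ {x} _ → x , elements-complete x , refl))))

    ∈-chains⁻ : ∀ {C} → C ∈ chains → IsChain C
    ∈-chains⁻ {C} C∈ with Any.satisfied (∈-concatMap⁻ (λ k → filter isChain? (words k)) {upTo (suc (length elements))} C∈)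
    ... | k , C∈k = proj₂ (∈-filter⁻ isChain? {xs = words k} C∈k)

    chains-unique : Unique chains
    chains-unique = Uniqueₚ.concat⁺ (Allₚ.map⁺ (All.universal (λ k → Uniqueₚ.filter⁺ isChain? (words-unique k))
      (upTo (suc (length elements)))))
      (disjoint (Uniqueₚ.upTo⁺ (suc (length elements))))
      where
      disjoint : ∀ {ks} → Unique ks → AllPairs Disjoint (map (λ k → filter isChain? (words k)) ks)
      disjoint []       = []
      disjoint {k ∷ _} (≢ ∷ u) = Allₚ.map⁺ (All.map (λ {l} k≢l {_} (p , q) → k≢l (≡.trans
        (≡.sym (words-length (proj₁ (∈-filter⁻ isChain? {xs = words k} p))))
        (words-length (proj₁ (∈-filter⁻ isChain? {xs = words l} q))))) ≢)
        ∷ disjoint u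

    chain⇒ : ∀ {C} → IsChain C → ∃[ es ] Corr C es × AllPairs _⊏_ es
    chain⇒ (inc , ≢0̂) = let es , c = corr ≢0̂ in es , c , corr-AllPairs c inc

    saturated-chain : ∀ {x e} → ι x ≡ just e → ∃[ C ] IsChain C × last C ≡ just x × length C ≡ suc (level e)
    saturated-chain {x} {e} eq =
      let C , c = corr⁻¹ (All.map (λ { (inj₁ f⊏e) → ⊏-trans _ e (top n) f⊏e (bounded eq) ; (inj₂ refl) → bounded eq })
                           (below-last inc ends))
      in C , corr-IsChain c inc , corr-last⁻¹ c eq ends ,
         ≡.trans (Pointwise-length c) (≡.cong suc length-tail)
      where
      open Saturated (saturated e)
      inc : AllPairs _⊏_ (head ∷ tail)
      inc = Linkedₚ.Linked⇒AllPairs (λ {x} {y} {z} → ⊏-trans x y z) linked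

    rankOf-ι : ∀ {x e} → ι x ≡ just e → rankOf x ≡ suc (level e)
    rankOf-ι {x} {e} eq = ℕₚ.≤-antisym
      (max≤v⁺ ℕ.z≤n (Allₚ.map⁺ (All.tabulate λ C∈ →
        let C∈chains , lst = ∈-filter⁻ (λ C → Maybeₚ.≡-dec _≟_ (last C) (just x)) C∈
            es , c , inc = chain⇒ (∈-chains⁻ C∈chains)
        in ≡.subst (ℕ._≤ suc (level e)) (≡.sym (Pointwise-length c)) (bound inc (corr-last c eq lst)))))
      (let C , ch , lst , len = saturated-chain eq in v≤max⁺ 0 _ (inj₂ (Anyₚ.map⁺
        (Any.map (λ { refl → ℕₚ.≤-reflexive (≡.sym len) })
          (∈-filter⁺ (λ C → Maybeₚ.≡-dec _≟_ (last C) (just x)) (∈-chains ch) lst)))))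
      where
      bound : ∀ {es} → AllPairs _⊏_ es → last es ≡ just e → length es ℕ.≤ suc (level e)
      bound {f ∷ es} inc lst = ℕ.s≤s (ℕₚ.≤-trans (ℕₚ.m≤m+n _ _) (chain-length-last inc lst))

    rank≡n : rank ≡ n
    rank≡n = ℕₚ.≤-antisym
      (max≤v⁺ ℕ.z≤n (Allₚ.map⁺ (All.tabulate λ C∈ →
        let es , c , inc = chain⇒ (∈-chains⁻ C∈)
        in ≡.subst₂ ℕ._≤_ (≡.sym (Pointwise-length c)) (level-top {0} {0} n) (chain-length inc (corr-bounded c)))))
      (attained n refl)
      where
      attained : ∀ m → m ≡ n → m ℕ.≤ rank
      attained zero    _    = ℕ.z≤n
      attained (suc m) refl =
        -- The saturated chain below `top m` has `suc m` elements, one in each level.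
        let x , eq = onto (top⊏top m)
            C , ch , _ , len = saturated-chain eq
        in v≤max⁺ 0 _ (inj₂ (Anyₚ.map⁺ (Any.map (λ { refl → ℕₚ.≤-reflexive
             (≡.sym (≡.trans len (≡.cong suc (level-top {0} {0} m)))) }) (∈-chains ch))))

    gorenstein : ∀ {c ℓ₁ ℓ₂} (K : HeytingField c ℓ₁ ℓ₂) → IsGorenstein* K P
    gorenstein {c} {ℓ₁} K F F∈Δ i = (λ { i≡ → top-homology i (≡.trans i≡ dim-eq) }) ,
      λ i≢ → H̃-other λ i≡ → i≢ (≡.trans i≡ (≡.sym dim-eq))
      where
      R = HeytingCommutativeRing.commutativeRing (HeytingField.heytingCommutativeRing K)
      Δ = link orderComplex F F∈Δ
      es = proj₁ (chain⇒ F∈Δ)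
      F~es = proj₁ (proj₂ (chain⇒ F∈Δ))
      inc = proj₂ (proj₂ (chain⇒ F∈Δ))
      open Intervals R Δ α

      ρ : Labelling {0} {0} (top n) (λ _ → ⊥)
      ρ = record
        { Label      = λ v e → ι v ≡ just e
        ; functional = λ p q → Maybeₚ.just-injective (≡.trans (≡.sym p) q)
        ; injective  = λ p q → ι-injective (≡.trans p (≡.sym q))
        ; reflects   = ⊏-of-<
        ; preserves  = <-of-⊏
        ; total      = onto
        ; below      = λ _ _ ()
        }
      open Links ρ

      only-zero : ∀ e → Only {0} {0} zero e
      only-zero (τ zero) = refl
      only-zero (μ _)    = tt
      only-zero (up _)   = tt

      sphere = whole-link zero only-zero es inc (corr-bounded F~es)
      N = proj₁ sphere

      face⇒ : ∀ {G} → OrderedComplex.Face Δ G → Chains.Simplex R Δ (Link (λ _ → ⊤) es) G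
      face⇒ {G} G∈@(H , (inc , ≢0̂) , il) = OrderedComplex.increasing Δ {G} G∈ ,
        All.zipWith (λ (v≢0̂ , c) → let e , eq = ι-≢0̂ v≢0̂ in
            e , (tt , bounded eq , corr-All (λ { p (inj₁ q) → inj₁ (⊏-of-< eq p q)
                                               ; p (inj₂ q) → inj₂ (⊏-of-< p eq q) }) F~es c) , eq)
          (All-interleavingʳ {_∼_ = _<ₚ_} il ≢0̂ , interleaving-comparable il inc)

      face⇐ : ∀ {G} → Chains.Simplex R Δ (Link (λ _ → ⊤) es) G → OrderedComplex.Face Δ G
      face⇐ {G} (inc , ∈L) =
        let H , il , h = merge <ₚ-trans F G (proj₁ F∈Δ) inc
              (All.map (λ { (e , (_ , _ , c) , eq) → corr-All⁻¹ (λ { p (inj₁ q) → inj₁ (<-of-⊏ eq p q)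
                                                                   ; p (inj₂ q) → inj₂ (<-of-⊏ p eq q) }) F~es c }) ∈L)
        in H , (h , All-interleaving {_∼_ = _<ₚ_} il (proj₂ F∈Δ) (All.map (λ { (_ , _ , eq) → ι-just eq }) ∈L)) , il

      open SphereHomology R Δ (proj₂ (proj₂ sphere)) face⇒ face⇐

      -- `whole-link` gives `N + length F` as the level of `top n`, which is `n` and hence the rank;
      -- so the dimension asked for is `N - 1`.
      dim-eq : (+ rank ℤ.- 1ℤ) ℤ.- + length F ≡ dimension N
      dim-eq = ≡.trans (≡.cong (λ r → (+ r ℤ.- 1ℤ) ℤ.- + length F) (≡.trans rank≡n (≡.sym (≡.trans
        (≡.cong (λ l → N ℕ.+ l) (Pointwise-length F~es)) (≡.trans (proj₁ (proj₂ sphere)) (level-top {0} {0} n))))))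
        (≡.trans (≡.cong (λ r → (r ℤ.- 1ℤ) ℤ.- + length F) (ℤₚ.pos-+ N (length F)))
          (solve 2 (λ N l → (N :+ l :- con 1ℤ) :- l := N :- con 1ℤ) refl (+ N) (+ length F)))
        where open ℤSolver.+-*-Solver

      top-homology : ∀ i → i ≡ dimension N → Homology.H̃ R Δ i ≅ TensorUnit.⟨module⟩ {R = R}
      top-homology i refl = H̃-top

-- Counting chains

does⁺ : ∀ {P : Set} (P? : Dec P) → P → T (does P?)
does⁺ (yes _) _ = tt
does⁺ (no ¬p) p = ¬p p

does⁻ : ∀ {P : Set} (P? : Dec P) → T (does P?) → P
does⁻ (yes p) _ = p

open import Data.Nat using (_+_; _*_)

sumFin : ∀ n → (Fin n → ℕ) → ℕ
sumFin zero    f = 0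
sumFin (suc n) f = f zero + sumFin n (f ∘ suc)

sumFin-cong : ∀ n {f g : Fin n → ℕ} → (∀ i → f i ≡ g i) → sumFin n f ≡ sumFin n g
sumFin-cong zero    e = refl
sumFin-cong (suc n) e = ≡.cong₂ _+_ (e zero) (sumFin-cong n (e ∘ suc))

sumFin-const : ∀ n c → sumFin n (λ _ → c) ≡ n * c
sumFin-const zero    c = refl
sumFin-const (suc n) c = ≡.cong (λ s → c + s) (sumFin-const n c)

sumFin-0 : ∀ n → sumFin n (λ _ → 0) ≡ 0
sumFin-0 n = ≡.trans (sumFin-const n 0) (ℕₚ.*-zeroʳ n)

sumFin-last : ∀ n (f : Fin (suc n) → ℕ) → sumFin (suc n) f ≡ sumFin n (f ∘ inject₁) + f (fromℕ n)
sumFin-last zero    f = ℕₚ.+-comm (f zero) 0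
sumFin-last (suc n) f = ≡.trans (≡.cong (λ s → f zero + s) (sumFin-last n (f ∘ suc))) (≡.sym (ℕₚ.+-assoc (f zero) _ _))

sumFin-single : ∀ n (t : Fin n) c → sumFin n (λ j → if does (j Finₚ.≟ t) then c else 0) ≡ c
sumFin-single (suc n) zero    c = ≡.trans (≡.cong (λ s → c + s) (sumFin-0 n)) (ℕₚ.+-identityʳ c)
sumFin-single (suc n) (suc t) c = sumFin-single n t c

sumFin-pair : ∀ n (i : Fin n) c →
              sumFin (suc n) (λ j → if (toℕ j ≡ᵇ toℕ i) ∨ (toℕ j ≡ᵇ suc (toℕ i)) then c else 0) ≡ 2 * c
sumFin-pair (suc n) zero    c = ≡.cong (λ s → c + (c + s)) (sumFin-0 n)
sumFin-pair (suc n) (suc i) c = sumFin-pair n i c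

module FlagNumbers (α : ℕ → ℕ) where

  open Tower α
  open TowerPoset α

  mutual

    -- The flag numbers of the chains of elements ⊏ top m with a single τ in level 0.
    -- upper counts those through an extra τ in level 1, middle those through some μ i in
    -- level 0 other than the last.
    flagNumber : ℕ → ∀ {m} → Subset m → ℕ
    flagNumber k []            = 1
    flagNumber k (outside ∷ S) = flagNumber (suc k) S + α (suc k) * upper k S
    flagNumber k (inside ∷ S)  = 2 * flagNumber (suc k) S + α (suc k) * middle k S

    upper : ℕ → ∀ {m} → Subset m → ℕ
    upper k []            = 0
    upper k (outside ∷ S) = 0
    upper k (inside ∷ S)  = flagNumber (2 + k) S

    middle : ℕ → ∀ {m} → Subset m → ℕ
    middle k []            = 0
    middle k (outside ∷ S) = flagNumber (2 + k) S
    middle k (inside ∷ S)  = 2 * flagNumber (2 + k) S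

  above : ∀ {a k} → (E a k → Bool) → E a k → E (α (suc k)) (suc k) → Bool
  above W x y = W (up y) ∧ does (x ⊏? up y)

  -- Chains inside `W` with rank set `S`, listed level by level. Whatever lies above an element has
  -- the form `up y`, so the remainder of a chain is a chain of the next tower, with `W` cut down to
  -- the elements above the one chosen. Unlike `chains`, this list can be counted by recursion on
  -- `S`.
  flags : ∀ {a k m} → (E a k → Bool) → Subset m → List (List (E a k))
  flagsFrom : ∀ {a k m} → (E a k → Bool) → Subset m → E a k → List (List (E a k))
  flags W []            = [] ∷ []
  flags W (outside ∷ S) = map (map up) (flags (W ∘ up) S)
  flags W (inside ∷ S)  = concatMap (flagsFrom W S) (bottoms _ _)
  flagsFrom W S x = if W x then map (λ C → x ∷ map up C) (flags (above W x) S) else []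

  rankSetᴱ : ∀ {a k} m → List (E a k) → Subset m
  rankSetᴱ m es = Vec.tabulate λ i → does (Any.any? (λ e → level e ℕ.≟ toℕ i) es)

  rankSetᴱ-up : ∀ {a k} m (es : List (E (α (suc k)) (suc k))) →
                rankSetᴱ (suc m) (map (up {a}) es) ≡ outside ∷ rankSetᴱ m es
  rankSetᴱ-up {a} {k} m es = ≡.cong₂ _∷_ (none es) (Vecₚ.tabulate-cong λ i → shifted i es)
    where
    none : ∀ es → does (Any.any? (λ e → level e ℕ.≟ 0) (map (up {a} {k}) es)) ≡ false
    none []       = refl
    none (e ∷ es) = none es
    shifted : ∀ {m} (i : Fin m) es → does (Any.any? (λ e → level e ℕ.≟ suc (toℕ i)) (map (up {a} {k}) es))
                           ≡ does (Any.any? (λ e → level e ℕ.≟ toℕ i) es)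
    shifted i []       = refl
    shifted i (e ∷ es) = ≡.cong ((level e ≡ᵇ toℕ i) ∨_) (shifted i es)

  rankSetᴱ-∷ : ∀ {a k} m (x : E a k) es → level x ≡ 0 →
               rankSetᴱ (suc m) (x ∷ map up es) ≡ inside ∷ rankSetᴱ m es
  rankSetᴱ-∷ m (τ j) es _ = ≡.cong (inside ∷_) (Vecₚ.∷-injectiveʳ (rankSetᴱ-up m es))
  rankSetᴱ-∷ m (μ j) es _ = ≡.cong (inside ∷_) (Vecₚ.∷-injectiveʳ (rankSetᴱ-up m es))

  ∈-bottoms : ∀ {a k} (x : E a k) → level x ≡ 0 → x ∈ bottoms a k
  ∈-bottoms (τ j) _ = ∈-++⁺ˡ (∈-map⁺ τ (∈-allFin j))
  ∈-bottoms (μ j) _ = ∈-++⁺ʳ (map τ (allFin _)) (∈-map⁺ μ (∈-allFin j))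

  AllPairs-up : ∀ {a k} {es : List (E (α (suc k)) (suc k))} → AllPairs _⊏_ es → AllPairs _⊏_ (map (up {a}) es)
  AllPairs-up = AllPairsₚ.map⁺

  AllPairs-up⁻ : ∀ {a k} {es : List (E (α (suc k)) (suc k))} → AllPairs _⊏_ (map (up {a}) es) → AllPairs _⊏_ es
  AllPairs-up⁻ {es = []}     []       = []
  AllPairs-up⁻ {es = e ∷ es} (p ∷ ps) = Allₚ.map⁻ p ∷ AllPairs-up⁻ ps

  ∈-flagsFrom⁻ : ∀ {a k m} (W : E a k → Bool) (S : Subset m) x {es} → es ∈ flagsFrom W S x →
                 T (W x) × ∃[ C ] C ∈ flags (above W x) S × es ≡ x ∷ map up C
  ∈-flagsFrom⁻ W S x es∈ with W x
  ... | true = tt , ∈-map⁻ (λ C → x ∷ map up C) es∈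
  ... | false with () ← es∈

  ∈-flagsFrom⁺ : ∀ {a k m} (W : E a k → Bool) (S : Subset m) x {C} → T (W x) → C ∈ flags (above W x) S →
                 x ∷ map up C ∈ flagsFrom W S x
  ∈-flagsFrom⁺ W S x Wx C∈ with W x
  ... | true = ∈-map⁺ (λ C → x ∷ map up C) C∈

  T-above : ∀ {a k} (W : E a k → Bool) x y → T (above W x y) → T (W (up y)) × x ⊏ up y
  T-above W x y t with W (up y)
  ... | true = tt , does⁻ (x ⊏? up y) t

  T-above⁻¹ : ∀ {a k} (W : E a k → Bool) x y → T (W (up y)) → x ⊏ up y → T (above W x y)
  T-above⁻¹ W x y t p with W (up y)
  ... | true = does⁺ (x ⊏? up y) p

  flags-sound : ∀ {a k m} (W : E a k → Bool) (S : Subset m) {es} → es ∈ flags W S →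
                AllPairs _⊏_ es × All (T ∘ W) es × rankSetᴱ m es ≡ S
  flags-sound W [] (here refl) = [] , [] , refl
  flags-sound {m = suc m} W (outside ∷ S) es∈ with ∈-map⁻ (map up) es∈
  ... | C , C∈ , refl =
    let inc , ∈W , eq = flags-sound (W ∘ up) S C∈
    in AllPairs-up inc , Allₚ.map⁺ ∈W , ≡.trans (rankSetᴱ-up m C) (≡.cong (outside ∷_) eq)
  flags-sound {m = suc m} W (inside ∷ S) es∈
    with find (∈-concatMap⁻ (flagsFrom W S) {bottoms _ _} es∈)
  ... | x , x∈ , es∈x with ∈-flagsFrom⁻ W S x es∈x
  ...   | Wx , C , C∈ , refl =
    let inc , ∈W , eq = flags-sound (above W x) S C∈
    in Allₚ.map⁺ (All.map (λ {y} t → proj₂ (T-above W x y t)) ∈W) ∷ AllPairs-up inc ,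
       Wx ∷ Allₚ.map⁺ (All.map (λ {y} t → proj₁ (T-above W x y t)) ∈W) ,
       ≡.trans (rankSetᴱ-∷ m x C (bottoms-level x∈)) (≡.cong (inside ∷_) eq)

  all-up : ∀ {a k} {x : E a k} {es} → All (x ⊏_) es → ∃[ C ] es ≡ map up C
  all-up []                = [] , refl
  all-up {es = up y ∷ _} (_ ∷ ps) = let C , eq = all-up ps in y ∷ C , ≡.cong (up y ∷_) eq
  all-up {es = τ _ ∷ _} (() ∷ _)
  all-up {es = μ _ ∷ _} (() ∷ _)

  flags-complete : ∀ {a k} m (W : E a k → Bool) {es} → AllPairs _⊏_ es → All (T ∘ W) es →
                   All (λ e → level e ℕ.< m) es → es ∈ flags W (rankSetᴱ m es)
  flags-complete zero    W []      []  []  = here refl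
  flags-complete zero    W (_ ∷ _) _   (() ∷ _)
  flags-complete {a} {k} (suc m) W {es} inc ∈W lev = go es inc ∈W lev
    where
    lift : ∀ C → AllPairs _⊏_ (map (up {a} {k}) C) → All (T ∘ W) (map (up {a} {k}) C) → All (λ e → level e ℕ.< suc m) (map (up {a} {k}) C) →
           map (up {a} {k}) C ∈ flags W (rankSetᴱ (suc m) (map (up {a} {k}) C))
    lift C inc ∈W lev = ≡.subst (λ S → map (up {a} {k}) C ∈ flags W S) (≡.sym (rankSetᴱ-up m C))
      (∈-map⁺ (map up) (flags-complete m (W ∘ up) (AllPairs-up⁻ inc) (Allₚ.map⁻ ∈W)
        (All.map ℕ.s≤s⁻¹ (Allₚ.map⁻ lev))))

    bottom : ∀ (x : E a k) C → level x ≡ 0 → AllPairs _⊏_ (x ∷ map up C) → All (T ∘ W) (x ∷ map up C) →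
             All (λ e → level e ℕ.< suc m) (x ∷ map up C) →
             x ∷ map up C ∈ flags W (rankSetᴱ (suc m) (x ∷ map up C))
    bottom x C l0 (x⊏ ∷ inc) (Wx ∷ ∈W) (_ ∷ lev) =
      ≡.subst (λ S → x ∷ map up C ∈ flags W S) (≡.sym (rankSetᴱ-∷ m x C l0))
        (∈-concatMap⁺ (flagsFrom W (rankSetᴱ m C)) (lose (∈-bottoms x l0)
          (∈-flagsFrom⁺ W (rankSetᴱ m C) x Wx (flags-complete m (above W x) (AllPairs-up⁻ inc)
            (All.zipWith (λ {y} (t , p) → T-above⁻¹ W x y t p) (Allₚ.map⁻ ∈W , Allₚ.map⁻ x⊏))
            (All.map ℕ.s≤s⁻¹ (Allₚ.map⁻ lev))))))

    go : ∀ es → AllPairs _⊏_ es → All (T ∘ W) es → All (λ e → level e ℕ.< suc m) es →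
         es ∈ flags W (rankSetᴱ (suc m) es)
    go []          inc ∈W lev = lift [] inc ∈W lev
    go (x ∷ es) inc@(x⊏ ∷ _) ∈W lev with all-up x⊏
    go (τ j ∷ _)  inc ∈W lev | C , refl = bottom (τ j) C refl inc ∈W lev
    go (μ j ∷ _)  inc ∈W lev | C , refl = bottom (μ j) C refl inc ∈W lev
    go (up y ∷ _) inc ∈W lev | C , refl = lift (y ∷ C) inc ∈W lev

  map-up-injective : ∀ {a k} {C D : List (E (α (suc k)) (suc k))} → map (up {a}) C ≡ map up D → C ≡ D
  map-up-injective = map-injective up-injective

  flags-unique : ∀ {a k m} (W : E a k → Bool) (S : Subset m) → Unique (flags W S)
  flags-unique W []            = [] ∷ []
  flags-unique W (outside ∷ S) = Uniqueₚ.map⁺ map-up-injective (flags-unique (W ∘ up) S)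
  flags-unique {a} {k} W (inside ∷ S)  = Uniqueₚ.concat⁺
    (Allₚ.map⁺ (All.universal from-unique (bottoms a k))) (disjoint (bottoms-unique a k))
    where
    from-unique : ∀ x → Unique (flagsFrom W S x)
    from-unique x with W x
    ... | true  = Uniqueₚ.map⁺ (λ { e → map-up-injective (∷-injectiveʳ e) }) (flags-unique (above W x) S)
    ... | false = []
    disjoint : ∀ {xs} → Unique xs → AllPairs Disjoint (map (flagsFrom W S) xs)
    disjoint []                = []
    disjoint {x ∷ _} (x∉ ∷ u) = Allₚ.map⁺ (All.map (λ {y} x≢y {_} (p , q) → apart x≢y p q) x∉) ∷ disjoint u
      where
      apart : ∀ {y es} → x ≢ y → es ∈ flagsFrom W S x → es ∈ flagsFrom W S y → ⊥
      apart {y} x≢y p q with ∈-flagsFrom⁻ W S x p | ∈-flagsFrom⁻ W S y q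
      ... | _ , _ , _ , e | _ , _ , _ , f = x≢y (∷-injectiveˡ (≡.trans (≡.sym e) f))

  count : ∀ {a k m} → (E a k → Bool) → Subset m → ℕ
  countFrom : ∀ {a k m} → (E a k → Bool) → Subset m → E a k → ℕ
  count W []            = 1
  count W (outside ∷ S) = count (W ∘ up) S
  count W (inside ∷ S)  = sumFin _ (countFrom W S ∘ τ) + sumFin _ (countFrom W S ∘ μ)
  countFrom W S x = if W x then count (above W x) S else 0

  length-concatMap : ∀ {A B C : Set} (f : B → List C) (g : A → B) n (h : Fin n → A) →
                     length (concatMap f (map g (tabulate h))) ≡ sumFin n (λ i → length (f (g (h i))))
  length-concatMap f g zero    h = refl
  length-concatMap f g (suc n) h = ≡.trans (length-++ (f (g (h zero))))
    (≡.cong (λ s → length (f (g (h zero))) + s) (length-concatMap f g n (h ∘ suc)))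

  length-flags : ∀ {a k m} (W : E a k → Bool) (S : Subset m) → length (flags W S) ≡ count W S
  length-flags W []            = refl
  length-flags W (outside ∷ S) = ≡.trans (length-map (map up) (flags (W ∘ up) S)) (length-flags (W ∘ up) S)
  length-flags {a} {k} W (inside ∷ S) = ≡.trans
    (≡.cong length (concatMap-++ (flagsFrom W S) (map τ (allFin (suc a))) (map μ (allFin _))))
    (≡.trans (length-++ (concatMap (flagsFrom W S) (map τ (allFin (suc a)))))
      (≡.cong₂ _+_
        (≡.trans (length-concatMap (flagsFrom W S) τ _ id) (sumFin-cong _ (from ∘ τ)))
        (≡.trans (length-concatMap (flagsFrom W S) μ _ id) (sumFin-cong _ (from ∘ μ)))))
    where
    from : ∀ x → length (flagsFrom W S x) ≡ countFrom W S x
    from x with W x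
    ... | true  = ≡.trans (length-map _ (flags (above W x) S)) (length-flags (above W x) S)
    ... | false = refl

  count-cong : ∀ {a k m} {W W′ : E a k → Bool} (S : Subset m) → (∀ x → W x ≡ W′ x) → count W S ≡ count W′ S
  count-cong []            e = refl
  count-cong (outside ∷ S) e = count-cong S (e ∘ up)
  count-cong {W = W} {W′} (inside ∷ S)  e =
    ≡.cong₂ _+_ (sumFin-cong _ (from ∘ τ)) (sumFin-cong _ (from ∘ μ))
    where
    from : ∀ x → countFrom W S x ≡ countFrom W′ S x
    from x = ≡.cong₂ (λ w c → if w then c else 0) (e x)
      (count-cong S λ y → ≡.cong (_∧ does (x ⊏? up y)) (e (up y)))

  below? : ∀ {a k} → ℕ → E a k → Bool
  below? n x = does (x ⊏? top n)

  onlyBelow? : ∀ {a k} → Fin (suc a) → ℕ → E a k → Bool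
  onlyBelow? t n x = does (only? t x) ∧ does (x ⊏? top n)

  only-top : ∀ {a k} n → Only zero (top {a} {k} n)
  only-top zero    = tt
  only-top (suc n) = tt

  τ⊏top : ∀ {a k} (j : Fin (suc a)) n → does (τ {k = k} j ⊏? top (suc n)) ≡ true
  τ⊏top j n = dec-true (τ j ⊏? top (suc n)) (only-top n)

  above-τ : ∀ {a k m} (j : Fin (suc a)) (S : Subset m) →
            count (above {a} {k} (below? (suc m)) (τ j)) S ≡ count (onlyBelow? {α (suc k)} {suc k} zero m) S
  above-τ {m = m} j S = count-cong S λ y → Boolₚ.∧-comm (does (y ⊏? top m)) (does (only? zero y))

  ¬last : ∀ {b} (i : Fin b) → does (last? (inject₁ i)) ≡ false
  ¬last i = dec-false (last? (inject₁ i)) λ e →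
    ℕₚ.<-irrefl (≡.trans (≡.sym (Finₚ.toℕ-inject₁ i)) e) (Finₚ.toℕ<n i)

  last⊏up : ∀ {a k} (y : E (α (suc k)) (suc k)) →
            does (μ {a} (fromℕ (α (suc k))) ⊏? up y) ≡ does (only? (fromℕ (α (suc k))) y)
  last⊏up {k = k} (τ j) = does-⇔ (mk⇔ (λ
      { (inj₁ e) → Finₚ.toℕ-injective e
      ; (inj₂ e) → ⊥-elim (ℕₚ.<-irrefl (≡.trans e (≡.cong suc (Finₚ.toℕ-fromℕ _))) (Finₚ.toℕ<n j)) })
    (λ { refl → inj₁ refl }))
    (μ {0} {k} (fromℕ _) ⊏? up (τ j)) (only? {k = suc k} (fromℕ (α (suc k))) (τ j))
  last⊏up {k = k} (μ j)  = dec-true (last? (fromℕ (α (suc k)))) (Finₚ.toℕ-fromℕ (α (suc k)))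
  last⊏up {k = k} (up y) = ≡.cong (_∨ does (only? zero y)) (dec-true (last? (fromℕ (α (suc k)))) (Finₚ.toℕ-fromℕ (α (suc k))))

  if-true : ∀ {b} {x y : ℕ} → b ≡ true → (if b then x else y) ≡ x
  if-true refl = refl

  if-false : ∀ {b} {x y : ℕ} → b ≡ false → (if b then x else y) ≡ y
  if-false refl = refl

  mutual

    -- In the inside case `τ t` and the last `μ` each see a section with one copy, the first and the
    -- last respectively. As the count does not depend on the copy, they contribute equally, which
    -- is the factor 2; the other `μ`s contribute `middle`.
    count-only : ∀ {a k m} (t : Fin (suc a)) (S : Subset m) →
                 count (onlyBelow? {a} {k} t m) S ≡ flagNumber k S
    count-only         t []            = refl
    count-only         t (outside ∷ S) = count-all S
    count-only {a} {k} {suc m} t (inside ∷ S)  = ≡.trans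
      (≡.cong₂ _+_
        (≡.trans (sumFin-cong (suc a) (λ j → ≡.cong₂ (λ w c → if w then c else 0)
            (≡.trans (≡.cong (does (j Finₚ.≟ t) ∧_) (τ⊏top {a} {k} j m)) (Boolₚ.∧-identityʳ (does (j Finₚ.≟ t))))
            (≡.trans (above-τ {a} {k} {m} j S) (count-only zero S))))
          (sumFin-single (suc a) t (flagNumber (suc k) S)))
        (count-μ {a} {k} {m} S))
      (solve 2 (λ f x → f :+ (f :+ x) := con 2 :* f :+ x) refl (flagNumber (suc k) S) (α (suc k) * middle k S))
      where open ℕSolver.+-*-Solver

    -- Here all `α (suc k) + 1` copies are present. One belongs to `flagNumber`, and each further
    -- copy adds the chains through it, counted by `upper`.
    count-all : ∀ {k m} (S : Subset m) →
                count (below? {α (suc k)} {suc k} m) S ≡ flagNumber (suc k) S + α (suc k) * upper k S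
    count-all {k} []            = ≡.cong suc (≡.sym (ℕₚ.*-zeroʳ (α (suc k))))
    count-all {k} (outside ∷ S) = ≡.trans (count-all S)
      (≡.sym (≡.trans (≡.cong (λ s → flagNumber (suc k) (outside ∷ S) + s) (ℕₚ.*-zeroʳ (α (suc k)))) (ℕₚ.+-identityʳ _)))
    count-all {k} {suc m} (inside ∷ S)  = ≡.trans
      (≡.cong₂ _+_
        (≡.trans (sumFin-cong (suc b) τ-term) (sumFin-const (suc b) (flagNumber (2 + k) S)))
        (count-μ {b} {suc k} {m} S))
      (solve 3 (λ b f x → (f :+ b :* f) :+ (f :+ x) := (con 2 :* f :+ x) :+ b :* f) refl b
        (flagNumber (2 + k) S) (α (2 + k) * middle (suc k) S))
      where
      open ℕSolver.+-*-Solver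
      b = α (suc k)
      τ-term : ∀ j → countFrom (below? {b} {suc k} (suc m)) S (τ j) ≡ flagNumber (2 + k) S
      τ-term j = ≡.trans (if-true (τ⊏top {b} {suc k} j m))
        (≡.trans (above-τ {b} {suc k} {m} j S) (count-only zero S))

    -- The last `μ` sees the section of the last copy; each of the remaining `b` ones contributes
    -- `middle`.
    count-μ : ∀ {a k m} (S : Subset m) → sumFin _ (countFrom (below? {a} {k} (suc m)) S ∘ μ)
              ≡ flagNumber (suc k) S + α (suc k) * middle k S
    count-μ {a} {k} {m} S = ≡.trans (sumFin-last b (countFrom (below? {a} {k} (suc m)) S ∘ μ))
      (≡.trans (ℕₚ.+-comm (sumFin b _) _) (≡.cong₂ _+_
        (≡.trans (if-true (≡.trans (last⊏up {a} (top m)) (only-last m)))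
          (≡.trans (count-cong S λ y → ≡.trans (≡.cong (does (y ⊏? top m) ∧_) (last⊏up {a} y))
                                               (Boolₚ.∧-comm (does (y ⊏? top m)) _))
            (count-only (fromℕ b) S)))
        (≡.trans (sumFin-cong b (λ i → count-middle {a} i S)) (sumFin-const b (middle k S)))))
      where
      b = α (suc k)
      only-last : ∀ m → does (only? {k = suc k} (fromℕ b) (top m)) ≡ true
      only-last zero    = refl
      only-last (suc m) = refl

    -- In level 1 such a `μ` sees exactly two copies and no `μ`. Whether a chain uses one of the
    -- copies or skips level 1, it continues in the part above the split atom, counted by
    -- `flagNumber (2 + k)`.
    count-middle : ∀ {a k m} (i : Fin (α (suc k))) (S : Subset m) →
                   countFrom (below? {a} {k} (suc m)) S (μ (inject₁ i)) ≡ middle k S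
    count-middle i [] = if-false (¬last i)
    count-middle {a} {k} {suc m} i (outside ∷ S) = ≡.trans
      (if-true (≡.trans (≡.cong (does (last? (inject₁ i)) ∨_) (dec-true (only? {α (2 + k)} {2 + k} zero (top m)) (only-top m)))
                        (Boolₚ.∨-zeroʳ (does (last? (inject₁ i))))))
      (≡.trans (count-cong S λ z → ≡.trans
          (≡.cong (λ l → does (z ⊏? top m) ∧ (l ∨ does (only? zero z))) (¬last i))
          (Boolₚ.∧-comm (does (z ⊏? top m)) _))
        (count-only zero S))
    count-middle {a} {k} {suc m} i (inside ∷ S) = ≡.trans
      (if-true (≡.trans (≡.cong (does (last? (inject₁ i)) ∨_)
                          (dec-true (only? {α (2 + k)} {2 + k} zero (top m)) (only-top m)))
                        (Boolₚ.∨-zeroʳ (does (last? (inject₁ i))))))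
      (≡.trans (≡.cong₂ _+_
        (≡.trans (sumFin-cong (suc b) τ-term) (sumFin-pair b i (flagNumber (2 + k) S)))
        (≡.trans (sumFin-cong (suc (α (2 + k))) μ-term) (sumFin-0 (suc (α (2 + k))))))
        (ℕₚ.+-identityʳ _))
      where
      b = α (suc k)
      W : E b (suc k) → Bool
      W = above (below? {a} {k} (2 + m)) (μ (inject₁ i))
      -- Being above `μ i` and being above `τ j` impose the same condition `Only zero` on an element
      -- of level 2 or more, so it occurs twice.
      absorb : ∀ p o → (p ∧ o) ∧ o ≡ o ∧ p
      absorb true  true  = refl
      absorb true  false = refl
      absorb false true  = refl
      absorb false false = refl
      τ-term : ∀ j → countFrom W S (τ j) ≡
               (if (toℕ j ≡ᵇ toℕ i) ∨ (toℕ j ≡ᵇ suc (toℕ i)) then flagNumber (2 + k) S else 0)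
      τ-term j = ≡.cong₂ (λ w c → if w then c else 0)
        (≡.trans (≡.cong (_∧ does (μ {a} {k} (inject₁ i) ⊏? up (τ j))) (τ⊏top {b} {suc k} j m))
          (≡.cong (λ t → (toℕ j ≡ᵇ t) ∨ (toℕ j ≡ᵇ suc t)) (Finₚ.toℕ-inject₁ i)))
        (≡.trans (count-cong S (λ z → ≡.trans
            (≡.cong (λ l → (does (z ⊏? top m) ∧ (l ∨ does (only? zero z))) ∧ does (only? zero z)) (¬last i))
            (absorb (does (z ⊏? top m)) (does (only? zero z)))))
          (count-only zero S))
      μ-term : ∀ l → countFrom W S (μ l) ≡ 0
      μ-term l = if-false (≡.trans (≡.cong (does (μ {b} {suc k} l ⊏? top (suc m)) ∧_) (¬last i))
                                   (Boolₚ.∧-zeroʳ (does (μ {b} {suc k} l ⊏? top (suc m)))))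

  module FlagVector {P n} (pres : Presentation P n) where

    open FinitePoset P
    open Presentation pres
    open Presented pres

    rankSet-corr : ∀ {C es} → Corr C es → rankSet C ≡ rankSetᴱ rank es
    rankSet-corr c = Vecₚ.tabulate-cong λ i → go i c
      where
      go : ∀ {m C es} (i : Fin m) → Corr C es → does (Any.any? (λ x → rankOf x ℕ.≟ suc (toℕ i)) C)
                                     ≡ does (Any.any? (λ e → level e ℕ.≟ toℕ i) es)
      go i []       = refl
      go i (p ∷ ps) = ≡.cong₂ _∨_ (≡.cong (_≡ᵇ suc (toℕ i)) (rankOf-ι p)) (go i ps)

    -- `Corr` matches the chains of `P` with rank set `S` with the lists in `flags`. Both
    -- enumerations are free of repetitions, so two injections give equal lengths.
    flag-f≡ : ∀ S → flag-f P S ≡ flagNumber 0 S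
    flag-f≡ S = ≡.trans (ℕₚ.≤-antisym
        (length-≤ Corr corr-unique (flags W S) (Uniqueₚ.filter⁺ rankSet≟ chains-unique) λ {C} C∈ →
          let C∈chains , rs = ∈-filter⁻ rankSet≟ C∈
              es , c , inc = chain⇒ (∈-chains⁻ C∈chains)
          in es , ≡.subst (λ S → es ∈ flags W S) (≡.trans (≡.sym (rankSet-corr c)) rs)
                    (flags-complete rank W inc (All.map (λ {e} p → does⁺ (e ⊏? top n) p) (corr-bounded c))
                      (All.map (λ {e} p → ≡.subst (level e ℕ.<_) (≡.sym rank≡n) (⊏top⇒level< n e p)) (corr-bounded c)))
             , c)
        (length-≤ (λ es C → Corr C es) corr-functional (filter rankSet≟ chains) (flags-unique W S) λ {es} es∈ →
          let inc , ∈W , rs = flags-sound W S es∈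
              C , c = corr⁻¹ (All.map (λ {e} t → does⁻ (e ⊏? top n) t) ∈W)
          in C , ∈-filter⁺ rankSet≟ (∈-chains (corr-IsChain c inc)) (≡.trans (rankSet-corr c) rs) , c))
      (≡.trans (length-flags W S) (≡.trans (≡.cong (λ n → count (below? {0} {0} n) S) (≡.sym rank≡n))
        (≡.trans (count-cong S only) (count-only zero S))))
      where
      W : E₀ → Bool
      W = below? n
      rankSet≟ : ∀ C → Dec (rankSet C ≡ S)
      rankSet≟ C = Vecₚ.≡-dec Boolₚ._≟_ (rankSet C) S
      -- Level 0 of `E₀` has one `τ`, so the poset is its own section.
      only : ∀ {n} (x : E₀) → below? n x ≡ onlyBelow? zero n x
      only (τ zero) = refl
      only (μ _)    = refl
      only (up _)   = refl

ℤ-ring = ℤₚ.+-*-commutativeRing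
open LinearCombinations ℤ-ring
module ABWords = Words ℤ-ring _≟ᴬᴮ_
module CDWords = Words ℤ-ring _≟ᶜᵈ_

-- Möbius inversion over the subsets of [m]

möbiusTerm : ∀ {m} → (Subset m → ℤ) → Subset m → Subset m → ℤ
möbiusTerm g S T = (-1ℤ ℤ.^ (∣ S ∣ ∸ ∣ T ∣)) ℤ.* g T

möbiusOver : ∀ {m} → List (Subset m) → (Subset m → ℤ) → Subset m → ℤ
möbiusOver xs g S = foldr ℤ._+_ 0ℤ (map (möbiusTerm g S) (filter (_⊆? S) xs))

möbius : ∀ {m} → (Subset m → ℤ) → Subset m → ℤ
möbius g S = möbiusOver (subsets _) g S

möbiusOver-++ : ∀ {m} xs ys (g : Subset m → ℤ) S →
                möbiusOver (xs ++ ys) g S ≡ möbiusOver xs g S ℤ.+ möbiusOver ys g S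
möbiusOver-++ []       ys g S = ≡.sym (ℤₚ.+-identityˡ _)
möbiusOver-++ (T ∷ xs) ys g S with T ⊆? S
... | yes _ = ≡.trans (≡.cong (λ s → möbiusTerm g S T ℤ.+ s) (möbiusOver-++ xs ys g S)) (≡.sym (ℤₚ.+-assoc (möbiusTerm g S T) _ _))
... | no  _ = möbiusOver-++ xs ys g S

möbiusOver-oo : ∀ {m} xs (g : Subset (suc m) → ℤ) S →
                möbiusOver (map (outside ∷_) xs) g (outside ∷ S) ≡ möbiusOver xs (g ∘ (outside ∷_)) S
möbiusOver-oo []       g S = refl
möbiusOver-oo (T ∷ xs) g S with T ⊆? S
... | yes _ = ≡.cong (λ s → möbiusTerm (g ∘ (outside ∷_)) S T ℤ.+ s) (möbiusOver-oo xs g S)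
... | no  _ = möbiusOver-oo xs g S

möbiusOver-ii : ∀ {m} xs (g : Subset (suc m) → ℤ) S →
                möbiusOver (map (inside ∷_) xs) g (inside ∷ S) ≡ möbiusOver xs (g ∘ (inside ∷_)) S
möbiusOver-ii []       g S = refl
möbiusOver-ii (T ∷ xs) g S with T ⊆? S
... | yes _ = ≡.cong (λ s → möbiusTerm (g ∘ (inside ∷_)) S T ℤ.+ s) (möbiusOver-ii xs g S)
... | no  _ = möbiusOver-ii xs g S

möbiusOver-io : ∀ {m} xs (g : Subset (suc m) → ℤ) S →
                möbiusOver (map (inside ∷_) xs) g (outside ∷ S) ≡ 0ℤ
möbiusOver-io []       g S = refl
möbiusOver-io (T ∷ xs) g S = möbiusOver-io xs g S

-- Adding to `S` an element that `T` lacks raises the exponent of the sign by one. The inclusion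
-- `T ⊆ S` keeps the truncated subtraction of sizes exact.
möbiusOver-oi : ∀ {m} xs (g : Subset (suc m) → ℤ) S →
                möbiusOver (map (outside ∷_) xs) g (inside ∷ S) ≡ ℤ.- möbiusOver xs (g ∘ (outside ∷_)) S
möbiusOver-oi []       g S = refl
möbiusOver-oi (T ∷ xs) g S with T ⊆? S
... | no  _   = möbiusOver-oi xs g S
... | yes T⊆S = ≡.trans (≡.cong₂ ℤ._+_ term (möbiusOver-oi xs g S))
  (≡.sym (ℤₚ.neg-distrib-+ (möbiusTerm g′ S T) (möbiusOver xs g′ S)))
  where
  g′ = g ∘ (outside ∷_)
  term : (-1ℤ ℤ.^ (suc ∣ S ∣ ∸ ∣ T ∣)) ℤ.* g′ T ≡ ℤ.- möbiusTerm g′ S T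
  term = ≡.trans (≡.cong (λ n → (-1ℤ ℤ.^ n) ℤ.* g′ T) (ℕₚ.+-∸-assoc 1 (p⊆q⇒∣p∣≤∣q∣ T⊆S)))
    (≡.trans (ℤₚ.*-assoc -1ℤ (-1ℤ ℤ.^ (∣ S ∣ ∸ ∣ T ∣)) (g′ T)) (ℤₚ.-1*i≡-i _))

subsets-suc : ∀ m → subsets (suc m) ≡ map (outside ∷_) (subsets m) ++ map (inside ∷_) (subsets m)
subsets-suc m = ≡.cong (map (outside ∷_) (subsets m) ++_) (++-identityʳ _)

möbius-[] : ∀ g → möbius g [] ≡ g []
möbius-[] g = ≡.trans (ℤₚ.+-identityʳ _) (ℤₚ.*-identityˡ (g []))

möbius-outside : ∀ {m} g (S : Subset m) → möbius g (outside ∷ S) ≡ möbius (g ∘ (outside ∷_)) S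
möbius-outside {m} g S = ≡.trans (≡.cong (λ xs → möbiusOver xs g (outside ∷ S)) (subsets-suc m))
  (≡.trans (möbiusOver-++ (map (outside ∷_) (subsets m)) _ g (outside ∷ S))
    (≡.trans (≡.cong₂ ℤ._+_ (möbiusOver-oo (subsets m) g S) (möbiusOver-io (subsets m) g S)) (ℤₚ.+-identityʳ _)))

möbius-inside : ∀ {m} g (S : Subset m) →
                möbius g (inside ∷ S) ≡ möbius (g ∘ (inside ∷_)) S ℤ.- möbius (g ∘ (outside ∷_)) S
möbius-inside {m} g S = ≡.trans (≡.cong (λ xs → möbiusOver xs g (inside ∷ S)) (subsets-suc m))
  (≡.trans (möbiusOver-++ (map (outside ∷_) (subsets m)) _ g (inside ∷ S))
    (≡.trans (≡.cong₂ ℤ._+_ (möbiusOver-oi (subsets m) g S) (möbiusOver-ii (subsets m) g S))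
      (ℤₚ.+-comm (ℤ.- möbius (g ∘ (outside ∷_)) S) _)))

möbius-cong : ∀ {m} {g h : Subset m → ℤ} → (∀ T → g T ≡ h T) → ∀ S → möbius g S ≡ möbius h S
möbius-cong {g = g} {h} e []            = ≡.trans (möbius-[] g) (≡.trans (e []) (≡.sym (möbius-[] h)))
möbius-cong {g = g} {h} e (outside ∷ S) = ≡.trans (möbius-outside g S)
  (≡.trans (möbius-cong (e ∘ (outside ∷_)) S) (≡.sym (möbius-outside h S)))
möbius-cong {g = g} {h} e (inside ∷ S)  = ≡.trans (möbius-inside g S)
  (≡.trans (≡.cong₂ ℤ._-_ (möbius-cong (e ∘ (inside ∷_)) S) (möbius-cong (e ∘ (outside ∷_)) S))
    (≡.sym (möbius-inside h S)))

möbius-linear : ∀ {m} a b (g h : Subset m → ℤ) S →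
                möbius (λ T → a ℤ.* g T ℤ.+ b ℤ.* h T) S ≡ a ℤ.* möbius g S ℤ.+ b ℤ.* möbius h S
möbius-linear a b g h []            = ≡.trans (möbius-[] (λ T → a ℤ.* g T ℤ.+ b ℤ.* h T))
  (≡.cong₂ (λ x y → a ℤ.* x ℤ.+ b ℤ.* y) (≡.sym (möbius-[] g)) (≡.sym (möbius-[] h)))
möbius-linear a b g h (outside ∷ S) = ≡.trans (möbius-outside (λ T → a ℤ.* g T ℤ.+ b ℤ.* h T) S)
  (≡.trans (möbius-linear a b (g ∘ (outside ∷_)) (h ∘ (outside ∷_)) S)
    (≡.cong₂ (λ x y → a ℤ.* x ℤ.+ b ℤ.* y) (≡.sym (möbius-outside g S)) (≡.sym (möbius-outside h S))))
möbius-linear a b g h (inside ∷ S)  = ≡.trans (möbius-inside (λ T → a ℤ.* g T ℤ.+ b ℤ.* h T) S)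
  (≡.trans (≡.cong₂ ℤ._-_ (möbius-linear a b (g ∘ (inside ∷_)) (h ∘ (inside ∷_)) S)
                          (möbius-linear a b (g ∘ (outside ∷_)) (h ∘ (outside ∷_)) S))
    (≡.trans (regroup a b (möbius (g ∘ (inside ∷_)) S) (möbius (h ∘ (inside ∷_)) S)
                          (möbius (g ∘ (outside ∷_)) S) (möbius (h ∘ (outside ∷_)) S))
      (≡.cong₂ (λ x y → a ℤ.* x ℤ.+ b ℤ.* y) (≡.sym (möbius-inside g S)) (≡.sym (möbius-inside h S)))))
  where
  regroup : ∀ a b x y z w → (a ℤ.* x ℤ.+ b ℤ.* y) ℤ.- (a ℤ.* z ℤ.+ b ℤ.* w)
                            ≡ a ℤ.* (x ℤ.- z) ℤ.+ b ℤ.* (y ℤ.- w)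
  regroup = solve 6 (λ a b x y z w → (a :* x :+ b :* y) :- (a :* z :+ b :* w) := a :* (x :- z) :+ b :* (y :- w)) refl
    where open ℤSolver.+-*-Solver

möbius-0 : ∀ {m} (S : Subset m) → möbius (λ _ → 0ℤ) S ≡ 0ℤ
möbius-0 S = möbius-linear 0ℤ 0ℤ (λ _ → 0ℤ) (λ _ → 0ℤ) S

-- The ab-polynomial with a given coefficient for each subset of [m]

abWord : ∀ {m} → Subset m → List AB
abWord S = Vec.toList (Vec.map (λ i∈S → if i∈S then 𝐛 else 𝐚) S)

abPoly : ∀ {m} → (Subset m → ℤ) → ℤ⟨ AB ⟩
abPoly g = map (λ S → g S , abWord S) (subsets _)

-- Reads a word letter by letter as a subset and returns the value of `g` there; words of any length
-- other than `m` get 0.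
abCoeff : ∀ {m} → (Subset m → ℤ) → List AB → ℤ
abCoeff {zero}  g []      = g []
abCoeff {zero}  g (_ ∷ _) = 0ℤ
abCoeff {suc m} g []      = 0ℤ
abCoeff {suc m} g (𝐚 ∷ w) = abCoeff (g ∘ (outside ∷_)) w
abCoeff {suc m} g (𝐛 ∷ w) = abCoeff (g ∘ (inside ∷_)) w

abCoeff-cong : ∀ {m} {g h : Subset m → ℤ} → (∀ S → g S ≡ h S) → ∀ w → abCoeff g w ≡ abCoeff h w
abCoeff-cong {zero}  e []      = e []
abCoeff-cong {zero}  e (_ ∷ _) = refl
abCoeff-cong {suc m} e []      = refl
abCoeff-cong {suc m} e (𝐚 ∷ w) = abCoeff-cong (e ∘ (outside ∷_)) w
abCoeff-cong {suc m} e (𝐛 ∷ w) = abCoeff-cong (e ∘ (inside ∷_)) w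

abCoeff-0 : ∀ m w → abCoeff {m} (λ _ → 0ℤ) w ≡ 0ℤ
abCoeff-0 zero    []      = refl
abCoeff-0 zero    (_ ∷ _) = refl
abCoeff-0 (suc m) []      = refl
abCoeff-0 (suc m) (𝐚 ∷ w) = abCoeff-0 m w
abCoeff-0 (suc m) (𝐛 ∷ w) = abCoeff-0 m w

abCoeff-linear : ∀ {m} a (g h : Subset m → ℤ) w →
                 abCoeff (λ S → g S ℤ.+ a ℤ.* h S) w ≡ abCoeff g w ℤ.+ a ℤ.* abCoeff h w
abCoeff-linear {zero}  a g h []      = refl
abCoeff-linear {zero}  a g h (_ ∷ _) = ≡.sym (≡.trans (ℤₚ.+-identityˡ _) (ℤₚ.*-zeroʳ a))
abCoeff-linear {suc m} a g h []      = ≡.sym (≡.trans (ℤₚ.+-identityˡ _) (ℤₚ.*-zeroʳ a))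
abCoeff-linear {suc m} a g h (𝐚 ∷ w) = abCoeff-linear a (g ∘ (outside ∷_)) (h ∘ (outside ∷_)) w
abCoeff-linear {suc m} a g h (𝐛 ∷ w) = abCoeff-linear a (g ∘ (inside ∷_)) (h ∘ (inside ∷_)) w

abPoly-suc : ∀ {m} (g : Subset (suc m) → ℤ) →
             abPoly g ≡ ABWords.cons 𝐚 (abPoly (g ∘ (outside ∷_))) ++ ABWords.cons 𝐛 (abPoly (g ∘ (inside ∷_)))
abPoly-suc {m} g = ≡.trans (≡.cong (map word) (subsets-suc m))
  (≡.trans (map-++ word (map (outside ∷_) (subsets m)) _)
    (≡.cong₂ _++_ (≡.trans (≡.sym (map-∘ (subsets m))) (map-∘ (subsets m)))
                  (≡.trans (≡.sym (map-∘ (subsets m))) (map-∘ (subsets m)))))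
  where
  word : ∀ {m} {g : Subset m → ℤ} → Subset m → ℤ × List AB
  word {g = g} S = g S , abWord S

coeff-abPoly : ∀ {m} (g : Subset m → ℤ) w → ABPoly.coeff (abPoly g) w ≡ abCoeff g w
coeff-abPoly {zero}  g []      = ℤₚ.+-identityʳ _
coeff-abPoly {zero}  g (_ ∷ _) = refl
coeff-abPoly {suc m} g w = ≡.trans (≡.cong (λ p → ABPoly.coeff p w) (abPoly-suc g))
  (≡.trans (ABPoly.coeff-++ (ABWords.cons 𝐚 p) (ABWords.cons 𝐛 q) w) (by-head w))
  where
  p = abPoly (g ∘ (outside ∷_))
  q = abPoly (g ∘ (inside ∷_))
  by-head : ∀ w → ABPoly.coeff (ABWords.cons 𝐚 p) w ℤ.+ ABPoly.coeff (ABWords.cons 𝐛 q) w ≡ abCoeff g w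
  by-head []      = ≡.cong₂ ℤ._+_ (ABWords.coeff-cons-≢ 𝐚 p λ _ ()) (ABWords.coeff-cons-≢ 𝐛 q λ _ ())
  by-head (𝐚 ∷ w) = ≡.trans (≡.cong₂ ℤ._+_ (ABWords.coeff-cons 𝐚 p w) (ABWords.coeff-cons-≢ 𝐛 q λ _ ()))
    (≡.trans (ℤₚ.+-identityʳ _) (coeff-abPoly (g ∘ (outside ∷_)) w))
  by-head (𝐛 ∷ w) = ≡.trans (≡.cong₂ ℤ._+_ (ABWords.coeff-cons-≢ 𝐚 p λ _ ()) (ABWords.coeff-cons 𝐛 q w))
    (≡.trans (ℤₚ.+-identityˡ _) (coeff-abPoly (g ∘ (inside ∷_)) w))

-- The substitution 𝐜 ↦ 𝐚 + 𝐛, 𝐝 ↦ 𝐚𝐛 + 𝐛𝐚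

-- The image of a monomial sorted by its first letter in 𝐚 and 𝐛, so that coefficients can be
-- compared by recursion on words.
expand : List CD → ℤ⟨ AB ⟩
expand []      = (1ℤ , []) ∷ []
expand (𝐜 ∷ u) = ABWords.cons 𝐚 (expand u) ++ ABWords.cons 𝐛 (expand u)
expand (𝐝 ∷ u) = ABWords.cons 𝐚 (ABWords.cons 𝐛 (expand u)) ++ ABWords.cons 𝐛 (ABWords.cons 𝐚 (expand u))

⊛-two-words : ∀ (v w : List AB) (p : ℤ⟨ AB ⟩) → ((1ℤ , v) ∷ (1ℤ , w) ∷ []) ⊛ p ≡
              map (λ (r , u) → r , v ++ u) p ++ map (λ (r , u) → r , w ++ u) p
⊛-two-words v w p = ≡.cong₂ _++_ (unit v) (≡.trans (++-identityʳ _) (unit w))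
  where
  unit : ∀ v → map (λ (r , u) → 1ℤ ℤ.* r , v ++ u) p ≡ map (λ (r , u) → r , v ++ u) p
  unit v = map-cong (λ (r , u) → ≡.cong (_, v ++ u) (ℤₚ.*-identityˡ r)) p

-- The letters of cd→ab are a local definition, so this is stated for any step of the fold that
-- agrees with it.
extend-foldr : ∀ (step : CD → ℤ⟨ AB ⟩ → ℤ⟨ AB ⟩) →
               (∀ q → step 𝐜 q ≡ ((1ℤ , 𝐚 ∷ []) ∷ (1ℤ , 𝐛 ∷ []) ∷ []) ⊛ q) →
               (∀ q → step 𝐝 q ≡ ((1ℤ , 𝐚 ∷ 𝐛 ∷ []) ∷ (1ℤ , 𝐛 ∷ 𝐚 ∷ []) ∷ []) ⊛ q) →
               ∀ p → extend (foldr step ((1ℤ , []) ∷ [])) p ≡ extend expand p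
extend-foldr step step-𝐜 step-𝐝 p = concatMap-cong (λ (r , u) → ≡.cong (r ·_) (go u)) p
  where
  go : ∀ u → foldr step ((1ℤ , []) ∷ []) u ≡ expand u
  go []      = refl
  go (𝐜 ∷ u) = ≡.trans (step-𝐜 _) (≡.trans (≡.cong (((1ℤ , 𝐚 ∷ []) ∷ (1ℤ , 𝐛 ∷ []) ∷ []) ⊛_) (go u))
    (⊛-two-words (𝐚 ∷ []) (𝐛 ∷ []) (expand u)))
  go (𝐝 ∷ u) = ≡.trans (step-𝐝 _) (≡.trans (≡.cong (((1ℤ , 𝐚 ∷ 𝐛 ∷ []) ∷ (1ℤ , 𝐛 ∷ 𝐚 ∷ []) ∷ []) ⊛_) (go u))
    (≡.trans (⊛-two-words (𝐚 ∷ 𝐛 ∷ []) (𝐛 ∷ 𝐚 ∷ []) (expand u))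
      (≡.cong₂ _++_ (map-∘ (expand u)) (map-∘ (expand u)))))

cd→ab≡ : ∀ p → cd→ab p ≡ extend expand p
cd→ab≡ = extend-foldr _ (λ _ → refl) (λ _ → refl)

expandCoeff : ℤ⟨ CD ⟩ → List AB → ℤ
expandCoeff p w = ABPoly.coeff (extend expand p) w

expandCoeff-∷ : ∀ r u p w → expandCoeff ((r , u) ∷ p) w ≡ r ℤ.* ABPoly.coeff (expand u) w ℤ.+ expandCoeff p w
expandCoeff-∷ r u p w = ≡.trans (ABPoly.coeff-++ (r · expand u) (extend expand p) w)
  (≡.cong (ℤ._+ expandCoeff p w) (ABPoly.coeff-· r (expand u) w))

expandCoeff-++ : ∀ p q w → expandCoeff (p ++ q) w ≡ expandCoeff p w ℤ.+ expandCoeff q w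
expandCoeff-++ p q w = ≡.trans (ABPoly.extend-++ expand p q w) (ABPoly.coeff-++ (extend expand p) _ w)

expandCoeff-· : ∀ r p w → expandCoeff (r · p) w ≡ r ℤ.* expandCoeff p w
expandCoeff-· r p w = ≡.trans (ABPoly.extend-· expand r p w) (ABPoly.coeff-· r (extend expand p) w)

expandCoeff-cons : ∀ {x w w′} → (∀ u → ABPoly.coeff (expand (x ∷ u)) w ≡ ABPoly.coeff (expand u) w′) →
                   ∀ p → expandCoeff (CDWords.cons x p) w ≡ expandCoeff p w′
expandCoeff-cons e []            = refl
expandCoeff-cons {x} {w} {w′} e ((r , u) ∷ p) = ≡.trans (expandCoeff-∷ r (x ∷ u) (CDWords.cons x p) w)
  (≡.trans (≡.cong₂ (λ c d → r ℤ.* c ℤ.+ d) (e u) (expandCoeff-cons e p)) (≡.sym (expandCoeff-∷ r u p w′)))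

expandCoeff-cons-0 : ∀ {x w} → (∀ u → ABPoly.coeff (expand (x ∷ u)) w ≡ 0ℤ) →
                     ∀ p → expandCoeff (CDWords.cons x p) w ≡ 0ℤ
expandCoeff-cons-0 e []            = refl
expandCoeff-cons-0 {x} {w} e ((r , u) ∷ p) = ≡.trans (expandCoeff-∷ r (x ∷ u) (CDWords.cons x p) w)
  (≡.trans (≡.cong₂ (λ c d → r ℤ.* c ℤ.+ d) (e u) (expandCoeff-cons-0 e p))
    (≡.trans (ℤₚ.+-identityʳ _) (ℤₚ.*-zeroʳ r)))

module _ (p q : ℤ⟨ AB ⟩) where

  open ABWords using (cons; coeff-cons; coeff-cons-≢)

  coeff-𝐚p+𝐛q-[] : ABPoly.coeff (cons 𝐚 p ++ cons 𝐛 q) [] ≡ 0ℤ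
  coeff-𝐚p+𝐛q-[] = ≡.trans (ABPoly.coeff-++ (cons 𝐚 p) (cons 𝐛 q) [])
    (≡.cong₂ ℤ._+_ (coeff-cons-≢ 𝐚 p λ _ ()) (coeff-cons-≢ 𝐛 q λ _ ()))

  coeff-𝐚p+𝐛q-𝐚 : ∀ w → ABPoly.coeff (cons 𝐚 p ++ cons 𝐛 q) (𝐚 ∷ w) ≡ ABPoly.coeff p w
  coeff-𝐚p+𝐛q-𝐚 w = ≡.trans (ABPoly.coeff-++ (cons 𝐚 p) (cons 𝐛 q) (𝐚 ∷ w))
    (≡.trans (≡.cong₂ ℤ._+_ (coeff-cons 𝐚 p w) (coeff-cons-≢ 𝐛 q λ _ ())) (ℤₚ.+-identityʳ _))

  coeff-𝐚p+𝐛q-𝐛 : ∀ w → ABPoly.coeff (cons 𝐚 p ++ cons 𝐛 q) (𝐛 ∷ w) ≡ ABPoly.coeff q w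
  coeff-𝐚p+𝐛q-𝐛 w = ≡.trans (ABPoly.coeff-++ (cons 𝐚 p) (cons 𝐛 q) (𝐛 ∷ w))
    (≡.trans (≡.cong₂ ℤ._+_ (coeff-cons-≢ 𝐚 p λ _ ()) (coeff-cons 𝐛 q w)) (ℤₚ.+-identityˡ _))

-- The cd-index of the tower

module TowerIndex (α : ℕ → ℕ) where

  open FlagNumbers α
  open TowerPoset α

  mutual

    cdIndex : ℕ → ℕ → ℤ⟨ CD ⟩
    cdIndex k zero    = (1ℤ , []) ∷ []
    cdIndex k (suc m) = CDWords.cons 𝐜 (cdIndex (suc k) m) ++ (+ α (suc k)) · cdIndex-𝐝 k m

    -- The term 𝐝 Φ in degree `m + 1`; it vanishes in degree one, where no 𝐝 fits.
    cdIndex-𝐝 : ℕ → ℕ → ℤ⟨ CD ⟩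
    cdIndex-𝐝 k zero    = []
    cdIndex-𝐝 k (suc m) = CDWords.cons 𝐝 (cdIndex (2 ℕ.+ k) m)

  -- The first letter of `u` selects the summand. A 𝐝 at offset `k` yields the factor `α (suc k)`
  -- and, in `dPositions`, the entry `suc k`.
  coeff-cdIndex : ∀ k m u → degree u ≡ m →
                  CDPoly.coeff (cdIndex k m) u ≡ + product (map α (dPositions k u))
  coeff-cdIndex k zero    []      _  = refl
  coeff-cdIndex k zero    (𝐜 ∷ u) ()
  coeff-cdIndex k zero    (𝐝 ∷ u) ()
  coeff-cdIndex k (suc m) (𝐜 ∷ u) eq = ≡.trans
    (CDPoly.coeff-++ (CDWords.cons 𝐜 (cdIndex (suc k) m)) ((+ α (suc k)) · cdIndex-𝐝 k m) (𝐜 ∷ u))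
    (≡.trans (≡.cong₂ ℤ._+_
      (≡.trans (CDWords.coeff-cons 𝐜 (cdIndex (suc k) m) u) (coeff-cdIndex (suc k) m u (ℕₚ.suc-injective eq)))
      (≡.trans (CDPoly.coeff-· (+ α (suc k)) (cdIndex-𝐝 k m) (𝐜 ∷ u))
        (≡.trans (≡.cong (λ c → (+ α (suc k)) ℤ.* c) (absent m)) (ℤₚ.*-zeroʳ (+ α (suc k))))))
      (ℤₚ.+-identityʳ _))
    where
    absent : ∀ m → CDPoly.coeff (cdIndex-𝐝 k m) (𝐜 ∷ u) ≡ 0ℤ
    absent zero    = refl
    absent (suc m) = CDWords.coeff-cons-≢ 𝐝 (cdIndex (2 ℕ.+ k) m) λ _ ()
  coeff-cdIndex k (suc (suc m)) (𝐝 ∷ u) eq = ≡.trans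
    (CDPoly.coeff-++ (CDWords.cons 𝐜 (cdIndex (suc k) (suc m))) ((+ α (suc k)) · cdIndex-𝐝 k (suc m)) (𝐝 ∷ u))
    (≡.trans (≡.cong₂ ℤ._+_
      (CDWords.coeff-cons-≢ 𝐜 (cdIndex (suc k) (suc m)) λ _ ())
      (≡.trans (CDPoly.coeff-· (+ α (suc k)) (cdIndex-𝐝 k (suc m)) (𝐝 ∷ u))
        (≡.cong (λ c → (+ α (suc k)) ℤ.* c)
          (≡.trans (CDWords.coeff-cons 𝐝 (cdIndex (2 ℕ.+ k) m) u)
            (coeff-cdIndex (2 ℕ.+ k) m u (ℕₚ.suc-injective (ℕₚ.suc-injective eq)))))))
      (≡.trans (ℤₚ.+-identityˡ _) (≡.sym (ℤₚ.pos-* (α (suc k)) _))))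

  α-cdIndex : ∀ n (S : 𝒜 n) → α[ cdIndex 0 n , S ] ≡ + product (map α (value S))
  α-cdIndex n S = ≡.trans (monomial (Inverse.from (κ n) S))
    (≡.cong (λ T → + product (map α (value T))) (Inverse.strictlyInverseˡ (κ n) S))
    where
    monomial : ∀ u → CDPoly.coeff (cdIndex 0 n) (value u) ≡ + product (map α (dPositions 0 (value u)))
    monomial (u , [ deg ]) = coeff-cdIndex 0 n u (recompute (degree u ℕ.≟ n) deg)

  hNumber : ℕ → ∀ {m} → Subset m → ℤ
  hNumber k = möbius (λ T → + flagNumber k T)

  hUpper : ℕ → ∀ {m} → Subset m → ℤ
  hUpper k = möbius (λ T → + upper k T)

  -- `hUpper` and `hDiff` will be the coefficients of 𝐛 Φ and 𝐚 Φ, which follow the first letter 𝐚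
  -- or 𝐛 in 𝐝 Φ, where Φ belongs to `2 + k`. The subtraction arises because Möbius inversion at a
  -- set containing level 0 removes the chains that skip level 0, among them those through the extra
  -- copy.
  hDiff : ℕ → ∀ {m} → Subset m → ℤ
  hDiff k S = möbius (λ T → + middle k T) S ℤ.- hUpper k S

  pos-linear : ∀ a f b g → + (a ℕ.* f ℕ.+ b ℕ.* g) ≡ (+ a) ℤ.* (+ f) ℤ.+ (+ b) ℤ.* (+ g)
  pos-linear a f b g = ≡.trans (ℤₚ.pos-+ (a ℕ.* f) (b ℕ.* g)) (≡.cong₂ ℤ._+_ (ℤₚ.pos-* a f) (ℤₚ.pos-* b g))

  hNumber-outside : ∀ k {m} (S : Subset m) →
                    hNumber k (outside ∷ S) ≡ hNumber (suc k) S ℤ.+ (+ α (suc k)) ℤ.* hUpper k S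
  hNumber-outside k S = ≡.trans (möbius-outside (λ T → + flagNumber k T) S)
    (≡.trans (möbius-cong (λ T → ≡.trans (≡.cong (λ f → + (f ℕ.+ α (suc k) ℕ.* upper k T)) (≡.sym (ℕₚ.*-identityˡ _)))
                                         (pos-linear 1 (flagNumber (suc k) T) (α (suc k)) (upper k T))) S)
      (≡.trans (möbius-linear 1ℤ (+ α (suc k)) (λ T → + flagNumber (suc k) T) (λ T → + upper k T) S)
        (≡.cong (ℤ._+ (+ α (suc k)) ℤ.* hUpper k S) (ℤₚ.*-identityˡ (hNumber (suc k) S)))))

  -- The two minimal elements of the 𝐜 step give twice the h-number of the next tower, and skipping
  -- level 0 takes one away; equal contributions after 𝐚 and 𝐛 make up the factor 𝐜.
  hNumber-inside : ∀ k {m} (S : Subset m) →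
                   hNumber k (inside ∷ S) ≡ hNumber (suc k) S ℤ.+ (+ α (suc k)) ℤ.* hDiff k S
  hNumber-inside k S = ≡.trans (möbius-inside (λ T → + flagNumber k T) S)
    (≡.trans (≡.cong₂ ℤ._-_
      (≡.trans (möbius-cong (λ T → pos-linear 2 (flagNumber (suc k) T) (α (suc k)) (middle k T)) S)
        (möbius-linear (+ 2) (+ α (suc k)) (λ T → + flagNumber (suc k) T) (λ T → + middle k T) S))
      (≡.trans (≡.sym (möbius-outside (λ T → + flagNumber k T) S)) (hNumber-outside k S)))
      (regroup (hNumber (suc k) S) (+ α (suc k)) (möbius (λ T → + middle k T) S) (hUpper k S)))
    where
    regroup : ∀ h a x u → ((+ 2) ℤ.* h ℤ.+ a ℤ.* x) ℤ.- (h ℤ.+ a ℤ.* u) ≡ h ℤ.+ a ℤ.* (x ℤ.- u)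
    regroup = solve 4 (λ h a x u → (con (+ 2) :* h :+ a :* x) :- (h :+ a :* u) := h :+ a :* (x :- u)) refl
      where open ℤSolver.+-*-Solver

  hUpper-outside : ∀ k {m} (S : Subset m) → hUpper k (outside ∷ S) ≡ 0ℤ
  hUpper-outside k S = ≡.trans (möbius-outside (λ T → + upper k T) S) (möbius-0 S)

  hUpper-inside : ∀ k {m} (S : Subset m) → hUpper k (inside ∷ S) ≡ hNumber (2 ℕ.+ k) S
  hUpper-inside k S = ≡.trans (möbius-inside (λ T → + upper k T) S)
    (≡.trans (≡.cong (λ z → hNumber (2 ℕ.+ k) S ℤ.- z) (möbius-0 S)) (ℤₚ.+-identityʳ _))

  hDiff-outside : ∀ k {m} (S : Subset m) → hDiff k (outside ∷ S) ≡ hNumber (2 ℕ.+ k) S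
  hDiff-outside k S = ≡.trans (≡.cong₂ ℤ._-_ (möbius-outside (λ T → + middle k T) S) (hUpper-outside k S))
    (ℤₚ.+-identityʳ _)

  -- The two copies above a `μ` contribute twice the h-number; one is removed for skipping level 1
  -- and one for the extra copy.
  hDiff-inside : ∀ k {m} (S : Subset m) → hDiff k (inside ∷ S) ≡ 0ℤ
  hDiff-inside k S = ≡.trans (≡.cong₂ ℤ._-_
    (≡.trans (möbius-inside (λ T → + middle k T) S) (≡.cong (ℤ._- hNumber (2 ℕ.+ k) S)
      (≡.trans (möbius-cong (λ T → pos-double (flagNumber (2 ℕ.+ k) T)) S)
               (möbius-linear (+ 2) 0ℤ (λ T → + flagNumber (2 ℕ.+ k) T) (λ _ → 0ℤ) S))))
    (hUpper-inside k S))
    (cancel (hNumber (2 ℕ.+ k) S) (möbius (λ _ → 0ℤ) S))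
    where
    pos-double : ∀ f → + (2 ℕ.* f) ≡ (+ 2) ℤ.* (+ f) ℤ.+ 0ℤ ℤ.* 0ℤ
    pos-double f = ≡.trans (ℤₚ.pos-* 2 f) (≡.sym (ℤₚ.+-identityʳ _))
    cancel : ∀ h z → ((+ 2) ℤ.* h ℤ.+ 0ℤ ℤ.* z) ℤ.- h ℤ.- h ≡ 0ℤ
    cancel = solve 2 (λ h z → (con (+ 2) :* h :+ con 0ℤ :* z) :- h :- h := con 0ℤ) refl
      where open ℤSolver.+-*-Solver

  mutual

    -- Behind a first letter 𝐚 or 𝐛 the summand from 𝐜 leaves the polynomial of the next tower, and
    -- the one from 𝐝 leaves the letter 𝐛 or 𝐚 followed by the tower two levels up. These are the
    -- recursions `hNumber-outside` and `hNumber-inside`.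
    expand-cdIndex : ∀ k m w → expandCoeff (cdIndex k m) w ≡ abCoeff {m} (hNumber k) w
    expand-cdIndex k zero    []      = refl
    expand-cdIndex k zero    (_ ∷ _) = refl
    expand-cdIndex k (suc m) w       = ≡.trans
      (expandCoeff-++ (CDWords.cons 𝐜 (cdIndex (suc k) m)) ((+ α (suc k)) · cdIndex-𝐝 k m) w)
      (≡.trans (≡.cong (λ e → expandCoeff (CDWords.cons 𝐜 (cdIndex (suc k) m)) w ℤ.+ e)
                       (expandCoeff-· (+ α (suc k)) (cdIndex-𝐝 k m) w))
        (by-head w))
      where
      by-head : ∀ w → expandCoeff (CDWords.cons 𝐜 (cdIndex (suc k) m)) w
                      ℤ.+ (+ α (suc k)) ℤ.* expandCoeff (cdIndex-𝐝 k m) w ≡ abCoeff {suc m} (hNumber k) w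
      by-head []      = ≡.trans (≡.cong₂ (λ c d → c ℤ.+ (+ α (suc k)) ℤ.* d)
          (expandCoeff-cons-0 {𝐜} {[]} (λ u → coeff-𝐚p+𝐛q-[] (expand u) (expand u)) (cdIndex (suc k) m))
          (expand-𝐝-[] k m))
        (≡.trans (ℤₚ.+-identityˡ _) (ℤₚ.*-zeroʳ (+ α (suc k))))
      by-head (𝐚 ∷ w) = ≡.trans (≡.cong₂ (λ c d → c ℤ.+ (+ α (suc k)) ℤ.* d)
          (≡.trans (expandCoeff-cons {𝐜} {𝐚 ∷ w} {w} (λ u → coeff-𝐚p+𝐛q-𝐚 (expand u) (expand u) w) (cdIndex (suc k) m))
                   (expand-cdIndex (suc k) m w))
          (expand-𝐝-𝐚 k m w))
        (≡.trans (≡.sym (abCoeff-linear {m} (+ α (suc k)) (hNumber (suc k)) (hUpper k) w))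
          (abCoeff-cong {m} (λ S → ≡.sym (hNumber-outside k S)) w))
      by-head (𝐛 ∷ w) = ≡.trans (≡.cong₂ (λ c d → c ℤ.+ (+ α (suc k)) ℤ.* d)
          (≡.trans (expandCoeff-cons {𝐜} {𝐛 ∷ w} {w} (λ u → coeff-𝐚p+𝐛q-𝐛 (expand u) (expand u) w) (cdIndex (suc k) m))
                   (expand-cdIndex (suc k) m w))
          (expand-𝐝-𝐛 k m w))
        (≡.trans (≡.sym (abCoeff-linear {m} (+ α (suc k)) (hNumber (suc k)) (hDiff k) w))
          (abCoeff-cong {m} (λ S → ≡.sym (hNumber-inside k S)) w))

    expand-𝐝-[] : ∀ k m → expandCoeff (cdIndex-𝐝 k m) [] ≡ 0ℤ
    expand-𝐝-[] k zero    = refl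
    expand-𝐝-[] k (suc m) = expandCoeff-cons-0 {𝐝} {[]}
      (λ u → coeff-𝐚p+𝐛q-[] (ABWords.cons 𝐛 (expand u)) (ABWords.cons 𝐚 (expand u))) (cdIndex (2 ℕ.+ k) m)

    expand-𝐝-𝐚 : ∀ k m w → expandCoeff (cdIndex-𝐝 k m) (𝐚 ∷ w) ≡ abCoeff {m} (hUpper k) w
    expand-𝐝-𝐚 k zero    []      = refl
    expand-𝐝-𝐚 k zero    (_ ∷ _) = refl
    expand-𝐝-𝐚 k (suc m) []      = expandCoeff-cons-0 {𝐝} {𝐚 ∷ []} (λ u → ≡.trans
      (coeff-𝐚p+𝐛q-𝐚 (ABWords.cons 𝐛 (expand u)) (ABWords.cons 𝐚 (expand u)) [])
      (ABWords.coeff-cons-≢ 𝐛 (expand u) λ _ ())) (cdIndex (2 ℕ.+ k) m)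
    expand-𝐝-𝐚 k (suc m) (𝐚 ∷ w) = ≡.trans (expandCoeff-cons-0 {𝐝} {𝐚 ∷ 𝐚 ∷ w} (λ u → ≡.trans
        (coeff-𝐚p+𝐛q-𝐚 (ABWords.cons 𝐛 (expand u)) (ABWords.cons 𝐚 (expand u)) (𝐚 ∷ w))
        (ABWords.coeff-cons-≢ 𝐛 (expand u) λ _ ())) (cdIndex (2 ℕ.+ k) m))
      (≡.sym (≡.trans (abCoeff-cong {m} (hUpper-outside k) w) (abCoeff-0 m w)))
    expand-𝐝-𝐚 k (suc m) (𝐛 ∷ w) = ≡.trans (expandCoeff-cons {𝐝} {𝐚 ∷ 𝐛 ∷ w} {w} (λ u → ≡.trans
        (coeff-𝐚p+𝐛q-𝐚 (ABWords.cons 𝐛 (expand u)) (ABWords.cons 𝐚 (expand u)) (𝐛 ∷ w))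
        (ABWords.coeff-cons 𝐛 (expand u) w)) (cdIndex (2 ℕ.+ k) m))
      (≡.trans (expand-cdIndex (2 ℕ.+ k) m w) (≡.sym (abCoeff-cong {m} (hUpper-inside k) w)))

    expand-𝐝-𝐛 : ∀ k m w → expandCoeff (cdIndex-𝐝 k m) (𝐛 ∷ w) ≡ abCoeff {m} (hDiff k) w
    expand-𝐝-𝐛 k zero    []      = refl
    expand-𝐝-𝐛 k zero    (_ ∷ _) = refl
    expand-𝐝-𝐛 k (suc m) []      = expandCoeff-cons-0 {𝐝} {𝐛 ∷ []} (λ u → ≡.trans
      (coeff-𝐚p+𝐛q-𝐛 (ABWords.cons 𝐛 (expand u)) (ABWords.cons 𝐚 (expand u)) [])
      (ABWords.coeff-cons-≢ 𝐚 (expand u) λ _ ())) (cdIndex (2 ℕ.+ k) m)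
    expand-𝐝-𝐛 k (suc m) (𝐛 ∷ w) = ≡.trans (expandCoeff-cons-0 {𝐝} {𝐛 ∷ 𝐛 ∷ w} (λ u → ≡.trans
        (coeff-𝐚p+𝐛q-𝐛 (ABWords.cons 𝐛 (expand u)) (ABWords.cons 𝐚 (expand u)) (𝐛 ∷ w))
        (ABWords.coeff-cons-≢ 𝐚 (expand u) λ _ ())) (cdIndex (2 ℕ.+ k) m))
      (≡.sym (≡.trans (abCoeff-cong {m} (hDiff-inside k) w) (abCoeff-0 m w)))
    expand-𝐝-𝐛 k (suc m) (𝐚 ∷ w) = ≡.trans (expandCoeff-cons {𝐝} {𝐛 ∷ 𝐚 ∷ w} {w} (λ u → ≡.trans
        (coeff-𝐚p+𝐛q-𝐛 (ABWords.cons 𝐛 (expand u)) (ABWords.cons 𝐚 (expand u)) (𝐚 ∷ w))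
        (ABWords.coeff-cons 𝐚 (expand u) w)) (cdIndex (2 ℕ.+ k) m))
      (≡.trans (expand-cdIndex (2 ℕ.+ k) m w) (≡.sym (abCoeff-cong {m} (hDiff-outside k) w)))

  isCDIndex : ∀ {P n} → Presentation P n → IsCDIndex P (cdIndex 0 n)
  isCDIndex {P} {n} pres w = ≡.trans (≡.cong (λ p → ABPoly.coeff p w) (cd→ab≡ (cdIndex 0 n)))
    (≡.trans (≡.cong (λ n → expandCoeff (cdIndex 0 n) w) (≡.sym rank≡n))
      (≡.trans (expand-cdIndex 0 rank w) (≡.trans
        (abCoeff-cong (möbius-cong (λ T → ≡.cong +_ (≡.sym (flag-f≡ T)))) w)
        (≡.sym (coeff-abPoly (flag-h P) w)))))
    where
    open FinitePoset P using (rank)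
    open Presented pres using (rank≡n)
    open FlagVector pres

proposition7p10 : ∀ {c ℓ₁ ℓ₂} (K : HeytingField c ℓ₁ ℓ₂) (n : ℕ) → 1 ≤ n → (α : ℕ → ℕ) →
    Σ[ P ∈ FinitePoset ] let open FinitePoset P in
    IsGorenstein* K P × rank ≡ n ×
    (Σ[ Φ ∈ ℤ⟨ CD ⟩ ] IsCDIndex P Φ ×
    ((S : 𝒜 n) → α[ Φ , S ] ≡ + product (map α (value S)))) ×
    (Σ[ σ ∈ Carrier ] Σ[ σ≢0̂ ∈ σ ≢ 0̂ ] rankOf σ ≡ n ×
    (Σ[ Φ ∈ ℤ⟨ CD ⟩ ] IsCDIndex (∂ₚ P σ σ≢0̂) Φ ×
    ((S : 𝒜 (n ∸ 1)) → α[ Φ , S ] ≡ + product (map α (value S)))))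
proposition7p10 K (suc n) _ α =
  poset (suc n) , gorenstein K , rank≡n ,
  (cdIndex 0 (suc n) , isCDIndex pres , α-cdIndex (suc n)) ,
  facet n , facet≢0̂ n , ≡.trans (rankOf-ι refl) (≡.cong suc (level-top {0} {0} n)) ,
  (cdIndex 0 n , isCDIndex (∂facet-presentation n) , α-cdIndex n)
  where
  open TowerPoset α
  open TowerIndex α
  pres = poset-presentation (suc n)
  open Presented pres
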